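{- For all $n \geq 0$, $$p_{\xi}(3n) \equiv \begin{cases} 1 \pmod{4}, & \text{if } n=0,\\ 2 \pmod{4}, & \text{if } n \text{ is a (positive) square},\\ 0 \pmod{4}, & \text{otherwise}.\end{cases}$$
   Context: $(a;q)_n=(1-a)(1-aq)\cdots(1-aq^{n-1})$, $(a;q)_0=1$. The coefficients $p_\xi(n)$ are defined by $\sum_{n\ge0}p_\xi(n)q^n=\xi(q)=1+2\sum_{n\ge1}\frac{q^{6n^2-6n+1}}{(q;q^6)_n(q^5;q^6)_n}$. -}

module Defs where

open import Data.Nat as ℕ using (ℕ; zero; suc; _∸_; _≤ᵇ_)
open import Data.Integer using (ℤ; +_; _+_; _*_; -_)
open import Data.Bool using (if_then_else_)

Series : Set
Series = ℕ → ℤ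

sumTo : ℕ → (ℕ → ℤ) → ℤ
sumTo zero    f = + 0
sumTo (suc n) f = sumTo n f + f n

one : Series
one zero    = + 1
one (suc _) = + 0

mono : ℕ → Series
mono k m = if (k ≤ᵇ m) then (if (m ≤ᵇ k) then + 1 else + 0) else + 0

_⊕_ : Series → Series → Series
(f ⊕ g) m = f m + g m

_⊖_ : Series → Series → Series
(f ⊖ g) m = f m + - g m

_⊛_ : Series → Series → Series
(f ⊛ g) m = sumTo (suc m) (λ i → f i * g (m ∸ i))

shift : ℕ → Series → Series
shift k f m = if (k ≤ᵇ m) then f (m ∸ k) else + 0

-- Multiplicative inverse of a series with constant term 1:
-- g 0 = 1,  g m = - Σ_{i=1}^{m} f i * g (m - i).
-- invUpTo f m j is correct for j ≤ m.
invUpTo : Series → ℕ → ℕ → ℤ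
invUpTo f zero    = λ _ → + 1
invUpTo f (suc m) = λ j →
  if (j ≤ᵇ m) then invUpTo f m j
  else - sumTo (suc m) (λ i → f (suc i) * invUpTo f m (m ∸ i))

inv : Series → Series
inv f m = invUpTo f m m

poch : ℕ → ℕ → ℕ → Series
poch a d zero    = one
poch a d (suc n) = poch a d n ⊛ (one ⊖ mono (a ℕ.+ d ℕ.* n))

xiTerm : ℕ → Series
xiTerm n = shift (6 ℕ.* n ℕ.* n ∸ 6 ℕ.* n ℕ.+ 1) (inv (poch 1 6 n ⊛ poch 5 6 n))

-- p_ξ(N): coefficient of q^N in ξ(q) = 1 + 2 Σ_{n≥1} xiTerm n.
-- Summands with n > N have q-order 6n²-6n+1 > N, so they contribute 0
-- to the coefficient of q^N; the sum is truncated at n = N accordingly.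
pξ : ℕ → ℤ
pξ N = one N + (+ 2) * sumTo N (λ i → xiTerm (suc i) N)

{-# OPTIONS --safe #-}
module Submission where

-- Write F = Σ_{L≥0} q^(6L²+6L+1)/((q;q⁶)_{L+1}(q⁵;q⁶)_{L+1}), so that ξ = 1 + 2F, and let U take
-- Σ f(n) qⁿ to Σ f(3n) qⁿ. Bailey's lemma gives
--   (q⁶;q⁶)_∞ F = q Σ_r (-1)^r Q^(3r(r+1)/2) (1 - Q^(2r+1))/((1 - qQ^r)(1 - q⁵Q^r)),  Q = q⁶,
-- and modulo 2 the partial fractions on the right are geometric series, so that (q²;q²)_∞ U F ≡ G with
--   G = Σ_r q^(3r²+7r+1)/(1 - q^(6r+1)) + Σ_r q^(3r²+5r+2)/(1 - q^(6r+5)).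
-- On the other hand (q²;q²)_∞ ≡ (q;q)_∞² (1 + 2T) modulo 4 with T = Σ_i q^i/(1 - q^i) ≡ Σ_{k≥1} q^(k²)
-- modulo 2, while the pentagonal number theorem gives (q²;q²)_∞ - (q;q)_∞² ≡ 2W modulo 4, where W counts
-- pairs of pentagonal numbers. Hence (q²;q²)_∞ T ≡ W modulo 2, and it remains to see W ≡ G modulo 2.
-- The coefficients of W count representations of 3n as a sum of two triangular numbers, that is, of 12n+1 as
-- a² + 4b²; by Zagier's involution on a² + 4yz = 12n+1 their parity is given by the factorisations of 12n+1,
-- which is what G counts.

open import Defs
open import Algebra.Bundles using (CommutativeRing; RawRing)
import Algebra.Properties.AbelianGroup
import Algebra.Properties.Semiring.Mult.TCOptimised
import Algebra.Solver.Ring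
open import Algebra.Solver.Ring.AlmostCommutativeRing
  using (fromCommutativeRing; _-Raw-AlmostCommutative⟶_)
import Algebra.Solver.Ring.NaturalCoefficients.Default
open import Data.Bool as Bool using (true; false)
open import Data.Integer as ℤ using (ℤ; +_)
open import Data.Integer.DivMod using (_%ℕ_; _/ℕ_; n%ℕd<d; a≡a%ℕn+[a/ℕn]*n)
open import Data.Integer.Divisibility.Signed as ℤ∣ using (divides)
import Data.Integer.Properties as ℤₚ
import Data.Integer.Solver as ℤ-Solver
open import Data.List using (List; []; _∷_; foldr)
open import Data.Maybe using (Maybe; just; nothing)
open import Data.Nat as ℕ using (ℕ; zero; suc; _∸_; _≤_; _<_; z≤n; s≤s; _≤ᵇ_)
import Data.Nat.Properties as ℕₚ
open import Data.Nat.Divisibility as ℕ∣ using (>⇒∤)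
open import Data.Nat.Tactic.RingSolver using (solve-∀)
open import Data.Product using (_×_; _,_; ∃-syntax)
open import Data.Sum using (_⊎_; inj₁; inj₂)
open import Level using (0ℓ)
import Relation.Binary.PropositionalEquality as ≡
open ≡ using (_≡_; _≢_)
open import Relation.Binary.Definitions using (tri<; tri≈; tri>)
import Relation.Binary.Reasoning.Setoid
open import Relation.Nullary using (¬_; yes; no; contradiction)

-- Only the parity of F matters, but parity alone cannot isolate T: modulo 2 the products (q²;q²)_∞
-- and (q;q)_∞² coincide. Their difference is therefore evaluated twice modulo 4, and the common
-- factor 2 is removed coefficient by coefficient. (q⁶;q⁶)_∞ is a series in q³, so it leaves U as
-- (q²;q²)_∞; this is a unit and is cancelled at the end. Triangular numbers divisible by 3 are
-- three times pentagonal numbers, which is how W becomes a count of triangular pairs. The sign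
-- (-1)^r ≡ 1 + 2r modulo 4 leaves terms of multiplicity r in W; the boundary between Zagier's
-- regions produces the same terms with the same multiplicity, and the two cancel. All identities
-- live in a ring where q^(K+1) = 0: infinite sums and products are then finite and 1 - q^k is a
-- unit for k > 0. The precision is 3n for F and n for U F. The counting is done on one coefficient
-- at a time, since it sorts exponents modulo 3.

module RingKit {c ℓ} (R : CommutativeRing c ℓ) where
  open CommutativeRing R hiding (zero)
  open Relation.Binary.Reasoning.Setoid setoid

  -- The ring solver with coefficients (a , b) standing for the integer a - b.
  module Solver where
    open Algebra.Properties.Semiring.Mult.TCOptimised semiring
      using () renaming (_×_ to _×′_; ×-homo-+ to ×′-homo-+; ×1-homo-* to ×′1-homo-*)
    module N = Algebra.Solver.Ring.NaturalCoefficients.Default commutativeSemiring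

    reduce : ℕ → ℕ → ℕ × ℕ
    reduce a b = a ∸ b , b ∸ a

    Coeff : RawRing _ _
    Coeff = record
      { Carrier = ℕ × ℕ
      ; _≈_ = _≡_
      ; _+_ = λ { (a , b) (c , d) → reduce (a ℕ.+ c) (b ℕ.+ d) }
      ; _*_ = λ { (a , b) (c , d) → reduce (a ℕ.* c ℕ.+ b ℕ.* d) (a ℕ.* d ℕ.+ b ℕ.* c) }
      ; -_ = λ { (a , b) → b , a }
      ; 0# = 0 , 0
      ; 1# = 1 , 0 }

    -- The case `b = 0` is separate so that (0 , 0) and (1 , 0) denote `0#` and `1#` by computation.
    ⟦_⟧ : ℕ × ℕ → Carrier
    ⟦ a , zero ⟧ = a ×′ 1#
    ⟦ a , suc b ⟧ = a ×′ 1# - suc b ×′ 1#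

    ⟦⟧-spec : ∀ a b → ⟦ a , b ⟧ + b ×′ 1# ≈ a ×′ 1#
    ⟦⟧-spec a zero = +-identityʳ _
    ⟦⟧-spec a (suc b) = begin
      a ×′ 1# - suc b ×′ 1# + suc b ×′ 1#     ≈⟨ +-assoc _ _ _ ⟩
      a ×′ 1# + (- (suc b ×′ 1#) + suc b ×′ 1#) ≈⟨ +-congˡ (-‿inverseˡ _) ⟩
      a ×′ 1# + 0#                            ≈⟨ +-identityʳ _ ⟩
      a ×′ 1#                                 ∎

    -- The subtraction-free equation x + b = a determines the value of (a , b), so the homomorphism
    -- laws can be checked with the semiring solver `N`.
    ⟦⟧-unique : ∀ x a b → x + b ×′ 1# ≈ a ×′ 1# → ⟦ a , b ⟧ ≈ x
    ⟦⟧-unique x a b p = Algebra.Properties.AbelianGroup.∙-cancelʳ +-abelianGroup (b ×′ 1#) _ _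
      (trans (⟦⟧-spec a b) (sym p))

    ⟦reduce⟧ : ∀ x a b → x + b ×′ 1# ≈ a ×′ 1# → ⟦ reduce a b ⟧ ≈ x
    ⟦reduce⟧ x a b p = ⟦⟧-unique x (a ∸ b) (b ∸ a)
      (Algebra.Properties.AbelianGroup.∙-cancelʳ +-abelianGroup ((a ℕ.⊓ b) ×′ 1#) _ _ (begin
      x + (b ∸ a) ×′ 1# + (a ℕ.⊓ b) ×′ 1#    ≈⟨ +-assoc _ _ _ ⟩
      x + ((b ∸ a) ×′ 1# + (a ℕ.⊓ b) ×′ 1#)  ≈⟨ +-congˡ (×′-homo-+ 1# (b ∸ a) (a ℕ.⊓ b)) ⟨
      x + (b ∸ a ℕ.+ a ℕ.⊓ b) ×′ 1#
        ≡⟨ ≡.cong (λ k → x + k ×′ 1#) (≡.trans (ℕₚ.+-comm (b ∸ a) _) (ℕₚ.m⊓n+n∸m≡n a b)) ⟩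
      x + b ×′ 1#                            ≈⟨ p ⟩
      a ×′ 1#
        ≡⟨ ≡.cong (_×′ 1#) (≡.trans (ℕₚ.+-comm (a ∸ b) _) (≡.trans (≡.cong (ℕ._+ (a ∸ b)) (ℕₚ.⊓-comm a b)) (ℕₚ.m⊓n+n∸m≡n b a))) ⟨
      (a ∸ b ℕ.+ a ℕ.⊓ b) ×′ 1#              ≈⟨ ×′-homo-+ 1# (a ∸ b) (a ℕ.⊓ b) ⟩
      (a ∸ b) ×′ 1# + (a ℕ.⊓ b) ×′ 1#        ∎))

    morphism : Coeff -Raw-AlmostCommutative⟶ fromCommutativeRing R
    morphism = record
      { ⟦_⟧ = ⟦_⟧
      ; +-homo = λ { (a , b) (c , d) → ⟦reduce⟧ _ (a ℕ.+ c) (b ℕ.+ d) (begin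
          ⟦ a , b ⟧ + ⟦ c , d ⟧ + (b ℕ.+ d) ×′ 1#         ≈⟨ +-congˡ (×′-homo-+ 1# b d) ⟩
          ⟦ a , b ⟧ + ⟦ c , d ⟧ + (b ×′ 1# + d ×′ 1#)
            ≈⟨ N.solve 4 (λ x y b d → x N.:+ y N.:+ (b N.:+ d) N.:= (x N.:+ b) N.:+ (y N.:+ d)) refl _ _ _ _ ⟩
          (⟦ a , b ⟧ + b ×′ 1#) + (⟦ c , d ⟧ + d ×′ 1#)   ≈⟨ +-cong (⟦⟧-spec a b) (⟦⟧-spec c d) ⟩
          a ×′ 1# + c ×′ 1#                               ≈⟨ ×′-homo-+ 1# a c ⟨
          (a ℕ.+ c) ×′ 1#                                 ∎) }
      ; *-homo = λ { (a , b) (c , d) → ⟦reduce⟧ _ (a ℕ.* c ℕ.+ b ℕ.* d) (a ℕ.* d ℕ.+ b ℕ.* c) (begin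
          ⟦ a , b ⟧ * ⟦ c , d ⟧ + (a ℕ.* d ℕ.+ b ℕ.* c) ×′ 1#
            ≈⟨ +-congˡ (prods a d b c) ⟩
          ⟦ a , b ⟧ * ⟦ c , d ⟧ + (a ×′ 1# * d ×′ 1# + b ×′ 1# * c ×′ 1#)
            ≈⟨ +-congˡ (+-cong (*-congʳ (⟦⟧-spec a b)) (*-congˡ (⟦⟧-spec c d))) ⟨
          ⟦ a , b ⟧ * ⟦ c , d ⟧ + ((⟦ a , b ⟧ + b ×′ 1#) * d ×′ 1# + b ×′ 1# * (⟦ c , d ⟧ + d ×′ 1#))
            ≈⟨ N.solve 4 (λ x y b d → x N.:* y N.:+ ((x N.:+ b) N.:* d N.:+ b N.:* (y N.:+ d))
                 N.:= (x N.:+ b) N.:* (y N.:+ d) N.:+ b N.:* d) refl _ _ _ _ ⟩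
          (⟦ a , b ⟧ + b ×′ 1#) * (⟦ c , d ⟧ + d ×′ 1#) + b ×′ 1# * d ×′ 1#
            ≈⟨ +-congʳ (*-cong (⟦⟧-spec a b) (⟦⟧-spec c d)) ⟩
          a ×′ 1# * c ×′ 1# + b ×′ 1# * d ×′ 1#
            ≈⟨ prods a c b d ⟨
          (a ℕ.* c ℕ.+ b ℕ.* d) ×′ 1# ∎) }
      ; -‿homo = λ { (a , b) → ⟦⟧-unique _ b a (begin
          - ⟦ a , b ⟧ + a ×′ 1#               ≈⟨ +-congˡ (⟦⟧-spec a b) ⟨
          - ⟦ a , b ⟧ + (⟦ a , b ⟧ + b ×′ 1#) ≈⟨ +-assoc _ _ _ ⟨
          - ⟦ a , b ⟧ + ⟦ a , b ⟧ + b ×′ 1#   ≈⟨ +-congʳ (-‿inverseˡ _) ⟩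
          0# + b ×′ 1#                        ≈⟨ +-identityˡ _ ⟩
          b ×′ 1#                             ∎) }
      ; 0-homo = refl
      ; 1-homo = refl }
      where
      prods : ∀ a b c d → (a ℕ.* b ℕ.+ c ℕ.* d) ×′ 1# ≈ a ×′ 1# * b ×′ 1# + c ×′ 1# * d ×′ 1#
      prods a b c d = trans (×′-homo-+ 1# (a ℕ.* b) (c ℕ.* d)) (+-cong (×′1-homo-* a b) (×′1-homo-* c d))

    coeff≟ : ∀ x y → Maybe (⟦ x ⟧ ≈ ⟦ y ⟧)
    coeff≟ (a , b) (c , d) with a ℕ.+ d ℕ.≟ c ℕ.+ b
    ... | no _ = nothing
    ... | yes e = just (⟦⟧-unique _ a b (Algebra.Properties.AbelianGroup.∙-cancelʳ +-abelianGroup (d ×′ 1#) _ _ (begin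
      ⟦ c , d ⟧ + b ×′ 1# + d ×′ 1#  ≈⟨ N.solve 3 (λ x b d → x N.:+ b N.:+ d N.:= x N.:+ d N.:+ b) refl _ _ _ ⟩
      ⟦ c , d ⟧ + d ×′ 1# + b ×′ 1#  ≈⟨ +-congʳ (⟦⟧-spec c d) ⟩
      c ×′ 1# + b ×′ 1#              ≈⟨ ×′-homo-+ 1# c b ⟨
      (c ℕ.+ b) ×′ 1#                ≡⟨ ≡.cong (_×′ 1#) e ⟨
      (a ℕ.+ d) ×′ 1#                ≈⟨ ×′-homo-+ 1# a d ⟩
      a ×′ 1# + d ×′ 1#              ∎)))

    open Algebra.Solver.Ring Coeff (fromCommutativeRing R) morphism coeff≟ public
      using (solve; _:=_; _:+_; _:*_; _:-_; :-_; Polynomial; con)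

    :1 : ∀ {n} → Polynomial n
    :1 = con (1 , 0)

    :0 : ∀ {n} → Polynomial n
    :0 = con (0 , 0)

  open Solver public using (solve; _:=_; _:+_; _:*_; _:-_; :-_; :1; :0)

  -- Finite sums over a commutative ring

  ∑ : ℕ → (ℕ → Carrier) → Carrier
  ∑ zero    f = 0#
  ∑ (suc n) f = ∑ n f + f n

  infixl 6.5 ∑
  syntax ∑ n (λ i → x) = ∑[ i < n ] x

  ∑-cong : ∀ n {f g} → (∀ i → i < n → f i ≈ g i) → ∑ n f ≈ ∑ n g
  ∑-cong zero    p = refl
  ∑-cong (suc n) p = +-cong (∑-cong n (λ i i<n → p i (ℕₚ.m<n⇒m<1+n i<n))) (p n (ℕₚ.n<1+n n))

  ∑-cong′ : ∀ n {f g} → (∀ i → f i ≈ g i) → ∑ n f ≈ ∑ n g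
  ∑-cong′ n p = ∑-cong n (λ i _ → p i)

  ∑-0 : ∀ n {f} → (∀ i → i < n → f i ≈ 0#) → ∑ n f ≈ 0#
  ∑-0 zero    p = refl
  ∑-0 (suc n) p = trans (+-cong (∑-0 n (λ i i<n → p i (ℕₚ.m<n⇒m<1+n i<n))) (p n (ℕₚ.n<1+n n))) (+-identityˡ 0#)

  ∑-+ : ∀ n f g → ∑[ i < n ] (f i + g i) ≈ ∑ n f + ∑ n g
  ∑-+ zero    f g = sym (+-identityˡ 0#)
  ∑-+ (suc n) f g = trans (+-congʳ (∑-+ n f g))
    (solve 4 (λ a b c d → a :+ b :+ (c :+ d) := (a :+ c) :+ (b :+ d)) refl _ _ _ _)

  ∑-*ˡ : ∀ n a f → ∑[ i < n ] (a * f i) ≈ a * ∑ n f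
  ∑-*ˡ zero    a f = sym (zeroʳ a)
  ∑-*ˡ (suc n) a f = trans (+-congʳ (∑-*ˡ n a f)) (sym (distribˡ _ _ _))

  ∑-*ʳ : ∀ n a f → ∑[ i < n ] (f i * a) ≈ ∑ n f * a
  ∑-*ʳ n a f = trans (∑-cong′ n (λ i → *-comm _ _)) (trans (∑-*ˡ n a f) (*-comm _ _))

  ∑-single : ∀ n f k → k < n → (∀ i → i ≢ k → f i ≈ 0#) → ∑ n f ≈ f k
  ∑-single (suc n) f k (s≤s k≤n) p with ℕₚ.m≤n⇒m<n∨m≡n k≤n
  ... | inj₁ k<n = trans (+-cong (∑-single n f k k<n p) (p n (λ { ≡.refl → ℕₚ.<-irrefl ≡.refl k<n }))) (+-identityʳ _)
  ... | inj₂ ≡.refl = trans (+-congʳ (∑-0 n (λ i i<n → p i (ℕₚ.<⇒≢ i<n)))) (+-identityˡ _)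

  ∑-first : ∀ n f → ∑ (suc n) f ≈ f 0 + ∑[ i < n ] f (suc i)
  ∑-first zero    f = +-comm _ _
  ∑-first (suc n) f = trans (+-congʳ (∑-first n f)) (+-assoc _ _ _)

  ∑-split : ∀ m n f → ∑ (m ℕ.+ n) f ≈ ∑ m f + ∑[ i < n ] f (m ℕ.+ i)
  ∑-split m zero f = trans (reflexive (≡.cong (λ k → ∑ k f) (ℕₚ.+-identityʳ m))) (sym (+-identityʳ _))
  ∑-split m (suc n) f = trans (reflexive (≡.cong (λ k → ∑ k f) (ℕₚ.+-suc m n)))
    (trans (+-congʳ (∑-split m n f)) (+-assoc _ _ _))

  ∑-extend : ∀ {m n} f → n ≤ m → (∀ i → n ≤ i → f i ≈ 0#) → ∑ m f ≈ ∑ n f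
  ∑-extend {m} {n} f n≤m z = begin
    ∑ m f                                  ≡⟨ ≡.cong (λ k → ∑ k f) (ℕₚ.m+[n∸m]≡n n≤m) ⟨
    ∑ (n ℕ.+ (m ∸ n)) f                    ≈⟨ ∑-split n (m ∸ n) f ⟩
    ∑ n f + ∑[ i < m ∸ n ] f (n ℕ.+ i)
      ≈⟨ +-congˡ (∑-0 (m ∸ n) (λ i _ → z _ (ℕₚ.m≤m+n n i))) ⟩
    ∑ n f + 0#                             ≈⟨ +-identityʳ _ ⟩
    ∑ n f                                  ∎

  ∑-extend-shift : ∀ k n f → (∀ i → n ≤ i → f i ≈ 0#) → ∑ n f ≈ ∑ k f + ∑[ i < n ] f (k ℕ.+ i)
  ∑-extend-shift k n f z = trans (sym (∑-extend {k ℕ.+ n} f (ℕₚ.m≤n+m n k) z)) (∑-split k n f)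

  ∑-even-odd : ∀ n f → ∑ (n ℕ.+ n) f ≈ ∑[ i < n ] f (i ℕ.+ i) + ∑[ i < n ] f (suc (i ℕ.+ i))
  ∑-even-odd zero    f = sym (+-identityˡ 0#)
  ∑-even-odd (suc n) f = begin
    ∑ (n ℕ.+ suc n) f + f (n ℕ.+ suc n)
      ≡⟨ ≡.cong (λ k → ∑ k f + f k) (ℕₚ.+-suc n n) ⟩
    ∑ (n ℕ.+ n) f + f (n ℕ.+ n) + f (suc (n ℕ.+ n))
      ≈⟨ +-congʳ (+-congʳ (∑-even-odd n f)) ⟩
    ∑[ i < n ] f (i ℕ.+ i) + ∑[ i < n ] f (suc (i ℕ.+ i)) + f (n ℕ.+ n) + f (suc (n ℕ.+ n))
      ≈⟨ solve 4 (λ a b c d → a :+ b :+ c :+ d := (a :+ c) :+ (b :+ d)) refl _ _ _ _ ⟩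
    ∑[ i < suc n ] f (i ℕ.+ i) + ∑[ i < suc n ] f (suc (i ℕ.+ i)) ∎

  ∑-thirds : ∀ n f → ∑ (n ℕ.* 3) f ≈ ∑[ r < n ] (f (r ℕ.* 3) + f (1 ℕ.+ r ℕ.* 3) + f (2 ℕ.+ r ℕ.* 3))
  ∑-thirds zero    f = refl
  ∑-thirds (suc n) f = trans (+-congʳ (+-congʳ (+-congʳ (∑-thirds n f))))
    (solve 4 (λ a b c d → a :+ b :+ c :+ d := a :+ (b :+ c :+ d)) refl _ _ _ _)

  ∑-swap : ∀ m n (f : ℕ → ℕ → Carrier) → ∑[ i < m ] ∑[ j < n ] f i j ≈ ∑[ j < n ] ∑[ i < m ] f i j
  ∑-swap zero    n f = sym (∑-0 n (λ _ _ → refl))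
  ∑-swap (suc m) n f = trans (+-congʳ (∑-swap m n f)) (sym (∑-+ n _ _))

  ∑-triangle : ∀ n (f : ℕ → ℕ → Carrier) →
    ∑[ x < n ] ∑[ y < suc x ] f x y ≈ ∑[ y < n ] ∑[ d < n ∸ y ] f (y ℕ.+ d) y
  ∑-triangle zero    f = refl
  ∑-triangle (suc n) f = begin
    ∑[ x < n ] ∑ (suc x) (f x) + ∑ (suc n) (f n)
      ≈⟨ +-congʳ (∑-triangle n f) ⟩
    ∑[ y < n ] ∑[ d < n ∸ y ] f (y ℕ.+ d) y + (∑ n (f n) + f n n)
      ≈⟨ +-assoc _ _ _ ⟨
    ∑[ y < n ] ∑[ d < n ∸ y ] f (y ℕ.+ d) y + ∑ n (f n) + f n n
      ≈⟨ +-cong (sym (∑-+ n _ _)) (trans (reflexive (≡.cong (λ k → f k n) (≡.sym (ℕₚ.+-identityʳ n)))) (sym (+-identityˡ _))) ⟩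
    ∑[ y < n ] (∑[ d < n ∸ y ] f (y ℕ.+ d) y + f n y) + ∑[ d < 1 ] f (n ℕ.+ d) n
      ≈⟨ +-cong (∑-cong n (λ y y<n → step y (ℕₚ.<⇒≤ y<n))) (reflexive (≡.cong (λ k → ∑ k (λ d → f (n ℕ.+ d) n)) (≡.sym (ℕₚ.m+n∸n≡m 1 n)))) ⟩
    ∑[ y < suc n ] ∑[ d < suc n ∸ y ] f (y ℕ.+ d) y ∎
    where
    step : ∀ y → y ≤ n → ∑[ d < n ∸ y ] f (y ℕ.+ d) y + f n y ≈ ∑[ d < suc n ∸ y ] f (y ℕ.+ d) y
    step y y≤n = begin
      ∑[ d < n ∸ y ] f (y ℕ.+ d) y + f n y
        ≡⟨ ≡.cong (λ k → ∑[ d < n ∸ y ] f (y ℕ.+ d) y + f k y) (ℕₚ.m+[n∸m]≡n y≤n) ⟨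
      ∑[ d < suc (n ∸ y) ] f (y ℕ.+ d) y
        ≡⟨ ≡.cong (λ k → ∑ k (λ d → f (y ℕ.+ d) y)) (ℕₚ.+-∸-assoc 1 y≤n) ⟨
      ∑[ d < suc n ∸ y ] f (y ℕ.+ d) y ∎

  -- Vanishing outside [0,B)² lets every reindexed double sum below run over the same box.
  Supp : ℕ → (ℕ → ℕ → Carrier) → Set _
  Supp B f = ∀ x y → B ≤ x ⊎ B ≤ y → f x y ≈ 0#

  ∑-below : ∀ B f → Supp B f →
    ∑[ x < B ] ∑[ y < x ] f x y ≈ ∑[ y < B ] ∑[ t < B ] f (suc (y ℕ.+ t)) y
  ∑-below zero    f s = refl
  ∑-below (suc B) f s = begin
    ∑[ x < suc B ] ∑[ y < x ] f x y                         ≈⟨ ∑-first B _ ⟩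
    0# + ∑[ x < B ] ∑[ y < suc x ] f (suc x) y              ≈⟨ +-identityˡ _ ⟩
    ∑[ x < B ] ∑[ y < suc x ] f (suc x) y                   ≈⟨ ∑-triangle B _ ⟩
    ∑[ y < B ] ∑[ d < B ∸ y ] f (suc (y ℕ.+ d)) y
      ≈⟨ ∑-cong B (λ y y<B → sym (∑-extend _ (ℕₚ.≤-trans (ℕₚ.m∸n≤m B y) (ℕₚ.n≤1+n B)) (λ d p →
           s _ y (inj₁ (s≤s (ℕₚ.≤-trans (ℕₚ.m≤n+m∸n B y) (ℕₚ.+-monoʳ-≤ y p))))))) ⟩
    ∑[ y < B ] ∑[ d < suc B ] f (suc (y ℕ.+ d)) y           ≈⟨ ∑-extend {suc B} {B} _ (ℕₚ.n≤1+n B) (λ y p →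
           ∑-0 (suc B) (λ d _ → s _ y (inj₁ (s≤s (ℕₚ.≤-trans p (ℕₚ.m≤m+n y d)))))) ⟨
    ∑[ y < suc B ] ∑[ d < suc B ] f (suc (y ℕ.+ d)) y       ∎

  -- The box is cut along its diagonal: w = y - x where y ≥ x, and t = x - y - 1 where y < x.
  ∑-cases : ∀ B f → Supp B f → ∑[ x < B ] ∑[ y < B ] f x y
    ≈ ∑[ x < B ] ∑[ w < B ] f x (x ℕ.+ w) + ∑[ y < B ] ∑[ t < B ] f (suc (y ℕ.+ t)) y
  ∑-cases B f s = begin
    ∑[ x < B ] ∑ B (f x)                                            ≈⟨ ∑-cong′ B (λ x → ∑-extend-shift x B (f x) (λ y p → s x y (inj₂ p))) ⟩
    ∑[ x < B ] (∑ x (f x) + ∑[ w < B ] f x (x ℕ.+ w))               ≈⟨ ∑-+ B _ _ ⟩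
    ∑[ x < B ] ∑ x (f x) + ∑[ x < B ] ∑[ w < B ] f x (x ℕ.+ w)      ≈⟨ +-comm _ _ ⟩
    ∑[ x < B ] ∑[ w < B ] f x (x ℕ.+ w) + ∑[ x < B ] ∑ x (f x)      ≈⟨ +-congˡ (∑-below B f s) ⟩
    _ ∎

  ∑-square : ∀ n f → ∑ n f * ∑ n f
    ≈ ∑[ r < n ] (f r * f r) + (1# + 1#) * (∑[ r < n ] ∑[ q < r ] (f q * f r))
  ∑-square zero    f = solve 0 (:0 :* :0 := :0 :+ (:1 :+ :1) :* :0) refl
  ∑-square (suc n) f = begin
    (∑ n f + f n) * (∑ n f + f n)
      ≈⟨ solve 2 (λ s x → (s :+ x) :* (s :+ x) := s :* s :+ (x :* x :+ (:1 :+ :1) :* (s :* x))) refl _ _ ⟩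
    ∑ n f * ∑ n f + (f n * f n + (1# + 1#) * (∑ n f * f n))
      ≈⟨ +-cong (∑-square n f) (+-congˡ (*-congˡ (sym (∑-*ʳ n _ _)))) ⟩
    _ + (f n * f n + (1# + 1#) * (∑[ q < n ] (f q * f n)))
      ≈⟨ solve 4 (λ a b x y → a :+ (:1 :+ :1) :* b :+ (x :+ (:1 :+ :1) :* y) := (a :+ x) :+ (:1 :+ :1) :* (b :+ y)) refl _ _ _ _ ⟩
    _ ∎

  module Char2 (1+1≈0 : 1# + 1# ≈ 0#) where
    x+x≈0 : ∀ x → x + x ≈ 0#
    x+x≈0 x = trans (solve 1 (λ x → x :+ x := (:1 :+ :1) :* x) refl x) (trans (*-congʳ 1+1≈0) (zeroˡ x))

    x+y≈0⇒x≈y : ∀ {x y} → x + y ≈ 0# → x ≈ y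
    x+y≈0⇒x≈y {x} {y} p = begin
      x           ≈⟨ solve 2 (λ x y → x := x :+ y :- y) refl x y ⟩
      x + y - y   ≈⟨ +-congʳ (trans p (sym (x+x≈0 y))) ⟩
      y + y - y   ≈⟨ solve 1 (λ y → y :+ y :- y := y) refl y ⟩
      y           ∎

    -x≈x : ∀ x → - x ≈ x
    -x≈x x = x+y≈0⇒x≈y (-‿inverseˡ x)

    -- Exchanging i and j pairs off everything outside the diagonal, and each pair sums to 0. All
    -- parity arguments by involution below reduce to this.
    ∑-symmetric : ∀ n (f : ℕ → ℕ → Carrier) → (∀ i j → i < n → j < n → f i j ≈ f j i) →
      ∑[ i < n ] ∑[ j < n ] f i j ≈ ∑[ i < n ] f i i
    ∑-symmetric zero    f p = refl
    ∑-symmetric (suc n) f p = begin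
      ∑[ i < n ] (∑ n (f i) + f i n) + (∑ n (f n) + f n n)
        ≈⟨ +-cong (∑-+ n _ _) (+-congʳ (∑-cong n (λ j j<n → p n j (ℕₚ.n<1+n n) (ℕₚ.m<n⇒m<1+n j<n)))) ⟩
      ∑[ i < n ] ∑ n (f i) + ∑[ i < n ] f i n + (∑[ i < n ] f i n + f n n)
        ≈⟨ solve 3 (λ a b c → a :+ b :+ (b :+ c) := a :+ c :+ (b :+ b)) refl _ _ _ ⟩
      ∑[ i < n ] ∑ n (f i) + f n n + (∑[ i < n ] f i n + ∑[ i < n ] f i n)
        ≈⟨ +-cong (+-congʳ (∑-symmetric n f (λ i j i<n j<n → p i j (ℕₚ.m<n⇒m<1+n i<n) (ℕₚ.m<n⇒m<1+n j<n)))) (x+x≈0 _) ⟩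
      ∑[ i < n ] f i i + f n n + 0#
        ≈⟨ +-identityʳ _ ⟩
      ∑[ i < suc n ] f i i ∎

-- Integers modulo m

infix 4 _≡_[mod_]
-- A record, because `x` and `y` could not be recovered by unification from a bare divisibility
-- statement about their difference.
record _≡_[mod_] (x y : ℤ) (m : ℕ) : Set where
  constructor congruent
  field divisible : + m ℤ∣.∣ x ℤ.- y
open _≡_[mod_]

≡⇒≡mod : ∀ {m x y} → x ≡ y → x ≡ y [mod m ]
≡⇒≡mod {m} {x} ≡.refl = congruent (≡.subst (+ m ℤ∣.∣_) (≡.sym (ℤₚ.+-inverseʳ x)) (divides (+ 0) ≡.refl))

ℤ/ : ℕ → CommutativeRing 0ℓ 0ℓ
ℤ/ m = record
  { Carrier = ℤ
  ; _≈_ = _≡_[mod m ]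
  ; _+_ = ℤ._+_
  ; _*_ = ℤ._*_
  ; -_ = ℤ.-_
  ; 0# = + 0
  ; 1# = + 1
  ; isCommutativeRing = record
    { isRing = record
      { +-isAbelianGroup = record
        { isGroup = record
          { isMonoid = record
            { isSemigroup = record
              { isMagma = record
                { isEquivalence = record
                  { refl = ≡⇒≡mod ≡.refl
                  ; sym = λ {x} {y} p → by (swap x y) (ℤ∣.∣m⇒∣-m (divisible p))
                  ; trans = λ {x} {y} {z} p q → by (chain x y z) (ℤ∣.∣m∣n⇒∣m+n (divisible p) (divisible q)) }
                ; ∙-cong = λ {x} {y} {u} {v} p q → by (plus x y u v) (ℤ∣.∣m∣n⇒∣m+n (divisible p) (divisible q)) }
              ; assoc = λ x y z → ≡⇒≡mod (ℤₚ.+-assoc x y z) }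
            ; identity = (λ x → ≡⇒≡mod (ℤₚ.+-identityˡ x)) , (λ x → ≡⇒≡mod (ℤₚ.+-identityʳ x)) }
          ; inverse = (λ x → ≡⇒≡mod (ℤₚ.+-inverseˡ x)) , (λ x → ≡⇒≡mod (ℤₚ.+-inverseʳ x))
          ; ⁻¹-cong = λ {x} {y} p → by (neg x y) (ℤ∣.∣m⇒∣-m (divisible p)) }
        ; comm = λ x y → ≡⇒≡mod (ℤₚ.+-comm x y) }
      ; *-cong = λ {x} {y} {u} {v} p q → by (times x y u v)
          (ℤ∣.∣m∣n⇒∣m+n (ℤ∣.∣m⇒∣m*n u (divisible p)) (ℤ∣.∣n⇒∣m*n y (divisible q)))
      ; *-assoc = λ x y z → ≡⇒≡mod (ℤₚ.*-assoc x y z)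
      ; *-identity = (λ x → ≡⇒≡mod (ℤₚ.*-identityˡ x)) , (λ x → ≡⇒≡mod (ℤₚ.*-identityʳ x))
      ; distrib = (λ x y z → ≡⇒≡mod (ℤₚ.*-distribˡ-+ x y z)) , (λ x y z → ≡⇒≡mod (ℤₚ.*-distribʳ-+ x y z)) }
    ; *-comm = λ x y → ≡⇒≡mod (ℤₚ.*-comm x y) } }
  where
  open ℤ-Solver.+-*-Solver
  by : ∀ {x y d} → d ≡ x ℤ.- y → + m ℤ∣.∣ d → x ≡ y [mod m ]
  by ≡.refl p = congruent p
  swap : ∀ x y → ℤ.- (x ℤ.- y) ≡ y ℤ.- x
  swap = solve 2 (λ x y → :- (x :- y) := y :- x) ≡.refl
  chain : ∀ x y z → (x ℤ.- y) ℤ.+ (y ℤ.- z) ≡ x ℤ.- z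
  chain = solve 3 (λ x y z → (x :- y) :+ (y :- z) := x :- z) ≡.refl
  plus : ∀ x y u v → (x ℤ.- y) ℤ.+ (u ℤ.- v) ≡ (x ℤ.+ u) ℤ.- (y ℤ.+ v)
  plus = solve 4 (λ x y u v → (x :- y) :+ (u :- v) := (x :+ u) :- (y :+ v)) ≡.refl
  neg : ∀ x y → ℤ.- (x ℤ.- y) ≡ (ℤ.- x) ℤ.- (ℤ.- y)
  neg = solve 2 (λ x y → :- (x :- y) := (:- x) :- (:- y)) ≡.refl
  times : ∀ x y u v → (x ℤ.- y) ℤ.* u ℤ.+ y ℤ.* (u ℤ.- v) ≡ x ℤ.* u ℤ.- y ℤ.* v
  times = solve 4 (λ x y u v → (x :- y) :* u :+ y :* (u :- v) := x :* u :- y :* v) ≡.refl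

-- Coefficients of monomials, inverses and convolutions

mono-suc : ∀ k n → mono (suc k) (suc n) ≡ mono k n
mono-suc zero    zero    = ≡.refl
mono-suc zero    (suc n) = ≡.refl
mono-suc (suc k) zero    = ≡.refl
mono-suc (suc k) (suc n) = ≡.refl

mono-diag : ∀ k → mono k k ≡ + 1
mono-diag zero    = ≡.refl
mono-diag (suc k) = ≡.trans (mono-suc k k) (mono-diag k)

mono-off : ∀ k n → k ≢ n → mono k n ≡ + 0
mono-off zero    zero    p = contradiction ≡.refl p
mono-off zero    (suc n) p = ≡.refl
mono-off (suc k) zero    p = ≡.refl
mono-off (suc k) (suc n) p = ≡.trans (mono-suc k n) (mono-off k n (λ q → p (≡.cong suc q)))

shift-suc : ∀ k f n → shift (suc k) f (suc n) ≡ shift k f n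
shift-suc zero    f n = ≡.refl
shift-suc (suc k) f zero = ≡.refl
shift-suc (suc k) f (suc n) = ≡.refl

shift-mono : ∀ k l n → shift k (mono l) n ≡ mono (k ℕ.+ l) n
shift-mono zero    l n       = ≡.refl
shift-mono (suc k) l zero    = ≡.refl
shift-mono (suc k) l (suc n) =
  ≡.trans (shift-suc k (mono l) n) (≡.trans (shift-mono k l n) (≡.sym (mono-suc (k ℕ.+ l) n)))

sumTo-cong : ∀ n {f g : ℕ → ℤ} → (∀ i → i < n → f i ≡ g i) → sumTo n f ≡ sumTo n g
sumTo-cong zero    p = ≡.refl
sumTo-cong (suc n) p = ≡.cong₂ ℤ._+_ (sumTo-cong n (λ i i<n → p i (ℕₚ.m<n⇒m<1+n i<n))) (p n (ℕₚ.n<1+n n))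

sumTo-first : ∀ n f → sumTo (suc n) f ≡ f 0 ℤ.+ sumTo n (λ i → f (suc i))
sumTo-first zero    f = ℤₚ.+-comm (+ 0) (f 0)
sumTo-first (suc n) f = ≡.trans (≡.cong (ℤ._+ f (suc n)) (sumTo-first n f)) (ℤₚ.+-assoc (f 0) _ _)

≤ᵇ-true : ∀ {m n} → m ≤ n → (m ≤ᵇ n) ≡ true
≤ᵇ-true {m} {n} p with m ≤ᵇ n | ℕₚ.≤⇒≤ᵇ p
... | true | _ = ≡.refl

≤ᵇ-false : ∀ {m n} → n < m → (m ≤ᵇ n) ≡ false
≤ᵇ-false {m} {n} p with m ≤ᵇ n in eq
... | false = ≡.refl
... | true = contradiction (ℕₚ.≤ᵇ⇒≤ m n (≡.subst Bool.T (≡.sym eq) _)) (ℕₚ.<⇒≱ p)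

-- Each stage of `invUpTo` copies the earlier entries and adds one, so the stages agree with the
-- single series `inv f`.
invUpTo-stable : ∀ f m j → j ≤ m → invUpTo f m j ≡ inv f j
invUpTo-stable f zero    zero p = ≡.refl
invUpTo-stable f (suc m) j p with ℕₚ.m≤n⇒m<n∨m≡n p
... | inj₂ ≡.refl = ≡.refl
... | inj₁ (s≤s j≤m) rewrite ≤ᵇ-true j≤m = invUpTo-stable f m j j≤m

inv-suc : ∀ f m → inv f (suc m) ≡ ℤ.- sumTo (suc m) (λ i → f (suc i) ℤ.* inv f (m ∸ i))
inv-suc f m rewrite ≤ᵇ-false (ℕₚ.n<1+n m) = ≡.cong ℤ.-_ (sumTo-cong (suc m)
  (λ i _ → ≡.cong (f (suc i) ℤ.*_) (invUpTo-stable f m (m ∸ i) (ℕₚ.m∸n≤m m i))))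

inv-correct : ∀ f → f 0 ≡ + 1 → ∀ n → (f ⊛ inv f) n ≡ one n
inv-correct f f0 zero rewrite f0 = ≡.refl
inv-correct f f0 (suc m) = begin
  (f ⊛ inv f) (suc m)                       ≡⟨ sumTo-first (suc m) _ ⟩
  f 0 ℤ.* inv f (suc m) ℤ.+ S               ≡⟨ ≡.cong₂ (λ a b → a ℤ.* b ℤ.+ S) f0 (inv-suc f m) ⟩
  + 1 ℤ.* (ℤ.- S) ℤ.+ S                     ≡⟨ ≡.cong (ℤ._+ S) (ℤₚ.*-identityˡ (ℤ.- S)) ⟩
  ℤ.- S ℤ.+ S                               ≡⟨ ℤₚ.+-inverseˡ S ⟩
  + 0                                       ∎
  where
  open ≡.≡-Reasoning
  S = sumTo (suc m) (λ i → f (suc i) ℤ.* inv f (m ∸ i))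

-- Convolution peeled at the constant term of the first factor: the ring laws
-- become structural inductions.
conv : Series → Series → Series
conv f g zero    = f 0 ℤ.* g 0
conv f g (suc n) = f 0 ℤ.* g (suc n) ℤ.+ conv (λ i → f (suc i)) g n

⊛-conv : ∀ f g n → (f ⊛ g) n ≡ conv f g n
⊛-conv f g zero    = ℤₚ.+-identityˡ _
⊛-conv f g (suc n) = ≡.trans (sumTo-first (suc n) _)
  (≡.cong (λ x → f 0 ℤ.* g (suc n) ℤ.+ x) (⊛-conv (λ i → f (suc i)) g n))

module _ where
  open ≡.≡-Reasoning
  open ℤ-Solver.+-*-Solver

  conv-+ : ∀ f g h n → conv (λ i → f i ℤ.+ g i) h n ≡ conv f h n ℤ.+ conv g h n
  conv-+ f g h zero = ℤₚ.*-distribʳ-+ (h 0) (f 0) (g 0)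
  conv-+ f g h (suc n) = ≡.trans (≡.cong (λ x → (f 0 ℤ.+ g 0) ℤ.* h (suc n) ℤ.+ x) (conv-+ _ _ h n))
    (solve 5 (λ a b c x y → (a :+ b) :* c :+ (x :+ y) := (a :* c :+ x) :+ (b :* c :+ y)) ≡.refl
      (f 0) (g 0) (h (suc n)) _ _)

  conv-* : ∀ a f h n → conv (λ i → a ℤ.* f i) h n ≡ a ℤ.* conv f h n
  conv-* a f h zero = ℤₚ.*-assoc a (f 0) (h 0)
  conv-* a f h (suc n) = ≡.trans (≡.cong (λ x → a ℤ.* f 0 ℤ.* h (suc n) ℤ.+ x) (conv-* a _ h n))
    (solve 4 (λ a b c x → a :* b :* c :+ a :* x := a :* (b :* c :+ x)) ≡.refl a (f 0) (h (suc n)) _)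

  -- The definition of `conv` splits off the constant term of the first factor; commutativity needs
  -- the splitting at the opposite end as well.
  conv-last : ∀ f g n → conv f g (suc n) ≡ conv f (λ i → g (suc i)) n ℤ.+ f (suc n) ℤ.* g 0
  conv-last f g zero = ≡.refl
  conv-last f g (suc n) = ≡.trans (≡.cong (λ x → f 0 ℤ.* g (suc (suc n)) ℤ.+ x) (conv-last _ g n))
    (≡.sym (ℤₚ.+-assoc (f 0 ℤ.* g (suc (suc n))) _ _))

  conv-comm : ∀ f g n → conv f g n ≡ conv g f n
  conv-comm f g zero = ℤₚ.*-comm (f 0) (g 0)
  conv-comm f g (suc n) = begin
    f 0 ℤ.* g (suc n) ℤ.+ conv (λ i → f (suc i)) g n  ≡⟨ ℤₚ.+-comm (f 0 ℤ.* g (suc n)) _ ⟩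
    conv (λ i → f (suc i)) g n ℤ.+ f 0 ℤ.* g (suc n)
      ≡⟨ ≡.cong₂ ℤ._+_ (conv-comm _ g n) (ℤₚ.*-comm (f 0) (g (suc n))) ⟩
    conv g (λ i → f (suc i)) n ℤ.+ g (suc n) ℤ.* f 0  ≡⟨ conv-last g f n ⟨
    conv g f (suc n)                                  ∎

  conv-assoc : ∀ f g h n → conv (conv f g) h n ≡ conv f (conv g h) n
  conv-assoc f g h zero = ℤₚ.*-assoc (f 0) (g 0) (h 0)
  conv-assoc f g h (suc n) = begin
    f 0 ℤ.* g 0 ℤ.* h (suc n) ℤ.+ conv (λ i → f 0 ℤ.* g (suc i) ℤ.+ conv f′ g i) h n
      ≡⟨ ≡.cong (λ x → f 0 ℤ.* g 0 ℤ.* h (suc n) ℤ.+ x) (≡.trans (conv-+ _ (conv f′ g) h n)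
           (≡.cong₂ ℤ._+_ (conv-* (f 0) g′ h n) (conv-assoc f′ g h n))) ⟩
    f 0 ℤ.* g 0 ℤ.* h (suc n) ℤ.+ (f 0 ℤ.* conv g′ h n ℤ.+ conv f′ (conv g h) n)
      ≡⟨ solve 5 (λ a b c x y → a :* b :* c :+ (a :* x :+ y) := a :* (b :* c :+ x) :+ y) ≡.refl
           (f 0) (g 0) (h (suc n)) _ _ ⟩
    f 0 ℤ.* conv g h (suc n) ℤ.+ conv f′ (conv g h) n ∎
    where
    f′ = λ i → f (suc i)
    g′ = λ i → g (suc i)

  conv-0 : ∀ f g n → (∀ i → f i ≡ + 0) → conv f g n ≡ + 0
  conv-0 f g zero    p rewrite p 0 = ≡.refl
  conv-0 f g (suc n) p rewrite p 0 = ≡.trans (ℤₚ.+-identityˡ _) (conv-0 _ g n (λ i → p (suc i)))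

  conv-one : ∀ g n → conv one g n ≡ g n
  conv-one g zero    = ℤₚ.*-identityˡ (g 0)
  conv-one g (suc n) = ≡.trans (≡.cong₂ ℤ._+_ (ℤₚ.*-identityˡ (g (suc n))) (conv-0 (λ i → one (suc i)) g n (λ _ → ≡.refl)))
    (ℤₚ.+-identityʳ _)

  conv-mono : ∀ k g n → conv (mono k) g n ≡ shift k g n
  conv-mono zero g zero = ℤₚ.*-identityˡ (g 0)
  conv-mono zero g (suc n) = ≡.trans (≡.cong₂ ℤ._+_ (ℤₚ.*-identityˡ (g (suc n))) (conv-0 (λ i → one (suc i)) g n (λ _ → ≡.refl)))
    (ℤₚ.+-identityʳ _)
  conv-mono (suc k) g zero = ≡.refl
  conv-mono (suc k) g (suc n) = begin
    + 0 ℤ.+ conv (λ i → mono (suc k) (suc i)) g n   ≡⟨ ℤₚ.+-identityˡ _ ⟩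
    conv (λ i → mono (suc k) (suc i)) g n           ≡⟨ conv-congˡ n (mono-suc k) ⟩
    conv (mono k) g n                               ≡⟨ conv-mono k g n ⟩
    shift k g n                                     ≡⟨ shift-suc k g n ⟨
    shift (suc k) g (suc n)                         ∎
    where
    conv-congˡ : ∀ {f f′ g} n → (∀ i → f i ≡ f′ i) → conv f g n ≡ conv f′ g n
    conv-congˡ zero    p = ≡.cong (ℤ._* _) (p 0)
    conv-congˡ (suc n) p = ≡.cong₂ ℤ._+_ (≡.cong (ℤ._* _) (p 0)) (conv-congˡ n (λ i → p (suc i)))

⊛-mono : ∀ k g n → (mono k ⊛ g) n ≡ shift k g n
⊛-mono k g n = ≡.trans (⊛-conv (mono k) g n) (conv-mono k g n)

-- Truncated power series as a commutative ring

zeros : Series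
zeros _ = + 0

-- ℤ[[q]] modulo m and q^(K+1).
module Truncated (m K : ℕ) where
  private module Z = CommutativeRing (ℤ/ m)

  infix 4 _≃_
  record _≃_ (f g : Series) : Set where
    constructor coeffs
    field coeff : ∀ j → j ≤ K → f j Z.≈ g j
  open _≃_ public

  ≗⇒≃ : ∀ {f g : Series} → (∀ j → f j ≡ g j) → f ≃ g
  ≗⇒≃ p = coeffs λ j _ → Z.reflexive (p j)

  conv-cong : ∀ n {f f′ g g′} → (∀ i → i ≤ n → f i Z.≈ f′ i) → (∀ i → i ≤ n → g i Z.≈ g′ i) →
    conv f g n Z.≈ conv f′ g′ n
  conv-cong zero    p q = Z.*-cong (p 0 z≤n) (q 0 z≤n)
  conv-cong (suc n) p q = Z.+-cong (Z.*-cong (p 0 z≤n) (q (suc n) ℕₚ.≤-refl))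
    (conv-cong n (λ i i≤n → p (suc i) (s≤s i≤n)) (λ i i≤n → q i (ℕₚ.m≤n⇒m≤1+n i≤n)))

  ⊛-cong : ∀ {f f′ g g′} → f ≃ f′ → g ≃ g′ → (f ⊛ g) ≃ (f′ ⊛ g′)
  ⊛-cong {f} {f′} {g} {g′} p q = coeffs λ j j≤K →
    ≡.subst₂ Z._≈_ (≡.sym (⊛-conv f g j)) (≡.sym (⊛-conv f′ g′ j))
      (conv-cong j (λ i i≤j → coeff p i (ℕₚ.≤-trans i≤j j≤K)) (λ i i≤j → coeff q i (ℕₚ.≤-trans i≤j j≤K)))

  series : CommutativeRing 0ℓ 0ℓ
  series = record
    { Carrier = Series
    ; _≈_ = _≃_
    ; _+_ = _⊕_
    ; _*_ = _⊛_
    ; -_ = λ f j → ℤ.- f j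
    ; 0# = zeros
    ; 1# = one
    ; isCommutativeRing = record
      { isRing = record
        { +-isAbelianGroup = record
          { isGroup = record
            { isMonoid = record
              { isSemigroup = record
                { isMagma = record
                  { isEquivalence = record
                    { refl = coeffs λ j _ → Z.refl
                    ; sym = λ p → coeffs λ j j≤K → Z.sym (coeff p j j≤K)
                    ; trans = λ p q → coeffs λ j j≤K → Z.trans (coeff p j j≤K) (coeff q j j≤K) }
                  ; ∙-cong = λ p q → coeffs λ j j≤K → Z.+-cong (coeff p j j≤K) (coeff q j j≤K) }
                ; assoc = λ f g h → coeffs λ j _ → Z.+-assoc (f j) (g j) (h j) }
              ; identity = (λ f → coeffs λ j _ → Z.+-identityˡ (f j)) , (λ f → coeffs λ j _ → Z.+-identityʳ (f j)) }
            ; inverse = (λ f → coeffs λ j _ → Z.-‿inverseˡ (f j)) , (λ f → coeffs λ j _ → Z.-‿inverseʳ (f j))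
            ; ⁻¹-cong = λ p → coeffs λ j j≤K → Z.-‿cong (coeff p j j≤K) }
          ; comm = λ f g → coeffs λ j _ → Z.+-comm (f j) (g j) }
        ; *-cong = ⊛-cong
        ; *-assoc = λ f g h → ≗⇒≃ (assoc f g h)
        ; *-identity = (λ f → ≗⇒≃ (identity f)) , (λ f → ≗⇒≃ (λ j → ≡.trans (comm f one j) (identity f j)))
        ; distrib = (λ f g h → ≗⇒≃ (λ j → ≡.trans (comm f (g ⊕ h) j)
              (≡.trans (distribʳ f g h j) (≡.cong₂ ℤ._+_ (comm g f j) (comm h f j)))))
            , (λ f g h → ≗⇒≃ (distribʳ f g h)) }
      ; *-comm = λ f g → ≗⇒≃ (comm f g) } }
    where
    comm : ∀ f g j → (f ⊛ g) j ≡ (g ⊛ f) j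
    comm f g j = ≡.trans (⊛-conv f g j) (≡.trans (conv-comm f g j) (≡.sym (⊛-conv g f j)))
    identity : ∀ f j → (one ⊛ f) j ≡ f j
    identity f j = ≡.trans (⊛-conv one f j) (conv-one f j)
    distribʳ : ∀ f g h j → ((g ⊕ h) ⊛ f) j ≡ (g ⊛ f) j ℤ.+ (h ⊛ f) j
    distribʳ f g h j = ≡.trans (⊛-conv (g ⊕ h) f j)
      (≡.trans (conv-+ g h f j) (≡.sym (≡.cong₂ ℤ._+_ (⊛-conv g f j) (⊛-conv h f j))))
    conv-ext : ∀ {f f′ g g′} n → (∀ i → f i ≡ f′ i) → (∀ i → g i ≡ g′ i) → conv f g n ≡ conv f′ g′ n
    conv-ext zero    p q = ≡.cong₂ ℤ._*_ (p 0) (q 0)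
    conv-ext (suc n) p q = ≡.cong₂ ℤ._+_ (≡.cong₂ ℤ._*_ (p 0) (q (suc n))) (conv-ext n (λ i → p (suc i)) q)
    assoc : ∀ f g h j → ((f ⊛ g) ⊛ h) j ≡ (f ⊛ (g ⊛ h)) j
    assoc f g h j = begin
      ((f ⊛ g) ⊛ h) j       ≡⟨ ⊛-conv (f ⊛ g) h j ⟩
      conv (f ⊛ g) h j      ≡⟨ conv-ext j (⊛-conv f g) (λ _ → ≡.refl) ⟩
      conv (conv f g) h j   ≡⟨ conv-assoc f g h j ⟩
      conv f (conv g h) j   ≡⟨ conv-ext j (λ _ → ≡.refl) (λ i → ≡.sym (⊛-conv g h i)) ⟩
      conv f (g ⊛ h) j      ≡⟨ ⊛-conv f (g ⊛ h) j ⟨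
      (f ⊛ (g ⊛ h)) j       ∎
      where open ≡.≡-Reasoning

  open CommutativeRing series using (_≈_)

  mono-+ : ∀ k l → mono (k ℕ.+ l) ≈ mono k ⊛ mono l
  mono-+ k l = ≗⇒≃ (λ j → ≡.sym (≡.trans (⊛-mono k (mono l) j) (shift-mono k l j)))

  mono-0 : mono 0 ≈ one
  mono-0 = ≗⇒≃ λ { zero → ≡.refl ; (suc j) → ≡.refl }

  mono-big : ∀ k → K < k → mono k ≈ zeros
  mono-big k K<k = coeffs λ j j≤K → Z.reflexive (mono-off k j (λ { ≡.refl → ℕₚ.<⇒≱ K<k j≤K }))

  shift-≈ : ∀ k f → shift k f ≈ mono k ⊛ f
  shift-≈ k f = ≗⇒≃ (λ j → ≡.sym (⊛-mono k f j))

  inv-≈ : ∀ f → f 0 ≡ + 1 → f ⊛ inv f ≈ one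
  inv-≈ f f0 = ≗⇒≃ (inv-correct f f0)

-- Products and geometric series in q, with `e n` in the role of q^n

module QSeries {c ℓ} (R : CommutativeRing c ℓ) (e : ℕ → CommutativeRing.Carrier R)
  (e-0 : CommutativeRing._≈_ R (e 0) (CommutativeRing.1# R))
  (e-+ : ∀ m n → CommutativeRing._≈_ R (e (m ℕ.+ n)) (CommutativeRing._*_ R (e m) (e n)))
  (K : ℕ) (e-big : ∀ n → K < n → CommutativeRing._≈_ R (e n) (CommutativeRing.0# R)) where

  open CommutativeRing R hiding (zero)
  open RingKit R
  open Relation.Binary.Reasoning.Setoid setoid

  -- Powers of q from `N` on vanish, so a sum whose r-th term has order at least r may be cut at
  -- `N`, and `prod N` below is the infinite product.
  N : ℕ
  N = suc K

  e-cong : ∀ {m n} → m ≡ n → e m ≈ e n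
  e-cong p = reflexive (≡.cong e p)

  e-≥N : ∀ {n m} → N ≤ n → n ≤ m → e m ≈ 0#
  e-≥N p q = e-big _ (ℕₚ.≤-trans p q)

  -- 1/(1 - q^k), for k ≥ 1.
  geom : ℕ → Carrier
  geom k = ∑[ t < N ] e (t ℕ.* k)

  geom-partial : ∀ k n → (1# - e k) * (∑[ t < n ] e (t ℕ.* k)) ≈ 1# - e (n ℕ.* k)
  geom-partial k zero = trans (zeroʳ _) (sym (trans (+-congˡ (-‿cong e-0)) (-‿inverseʳ 1#)))
  geom-partial k (suc n) = begin
    (1# - e k) * (∑[ t < n ] e (t ℕ.* k) + e (n ℕ.* k))
      ≈⟨ distribˡ _ _ _ ⟩
    (1# - e k) * (∑[ t < n ] e (t ℕ.* k)) + (1# - e k) * e (n ℕ.* k)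
      ≈⟨ +-congʳ (geom-partial k n) ⟩
    1# - e (n ℕ.* k) + (1# - e k) * e (n ℕ.* k)
      ≈⟨ solve 2 (λ x y → :1 :- y :+ (:1 :- x) :* y := :1 :- x :* y) refl _ _ ⟩
    1# - e k * e (n ℕ.* k)
      ≈⟨ +-congˡ (-‿cong (e-+ k (n ℕ.* k))) ⟨
    1# - e (suc n ℕ.* k) ∎

  geom-inverse : ∀ k → 0 < k → (1# - e k) * geom k ≈ 1#
  geom-inverse k 0<k = begin
    (1# - e k) * geom k    ≈⟨ geom-partial k N ⟩
    1# - e (N ℕ.* k)       ≈⟨ +-congˡ (-‿cong (e-≥N ℕₚ.≤-refl (ℕₚ.m≤m*n N k ⦃ ℕ.>-nonZero 0<k ⦄))) ⟩
    1# - 0#                ≈⟨ solve 0 (:1 :- :0 := :1) refl ⟩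
    1#                     ∎

  geom-cancel : ∀ k x → 0 < k → (1# - e k) * x ≈ 0# → x ≈ 0#
  geom-cancel k x 0<k p = begin
    x                          ≈⟨ *-identityˡ x ⟨
    1# * x                     ≈⟨ *-congʳ (geom-inverse k 0<k) ⟨
    (1# - e k) * geom k * x    ≈⟨ solve 3 (λ a b x → a :* b :* x := b :* (a :* x)) refl _ _ _ ⟩
    geom k * ((1# - e k) * x)  ≈⟨ *-congˡ p ⟩
    geom k * 0#                ≈⟨ zeroʳ _ ⟩
    0#                         ∎

  -- The base is Q = q^s, and E n = Q^n.
  module Base (s : ℕ) (0<s : 0 < s) where
    E : ℕ → Carrier
    E n = e (s ℕ.* n)

    E-0 : E 0 ≈ 1#
    E-0 = trans (e-cong (ℕₚ.*-zeroʳ s)) e-0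

    E-+ : ∀ m n → E (m ℕ.+ n) ≈ E m * E n
    E-+ m n = trans (e-cong (ℕₚ.*-distribˡ-+ s m n)) (e-+ _ _)

    -- Splitting an exponent into summands turns an identity between powers into a polynomial one
    -- for `solve`. The closing factor `1#` accounts for the `:1` ending such products there.
    E-expand : ∀ {k} (ms : List ℕ) → k ≡ foldr ℕ._+_ 0 ms → E k ≈ foldr (λ m x → E m * x) 1# ms
    E-expand [] ≡.refl = E-0
    E-expand (m ∷ ms) ≡.refl = trans (E-+ m _) (*-congˡ (E-expand ms ≡.refl))

    E-≥N : ∀ {n m} → N ≤ n → n ≤ m → E m ≈ 0#
    E-≥N {n} {m} p q = e-≥N p (ℕₚ.≤-trans q (ℕₚ.m≤n*m m s ⦃ ℕ.>-nonZero 0<s ⦄))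

    0<s*suc : ∀ n → 0 < s ℕ.* suc n
    0<s*suc n = ℕₚ.<-≤-trans 0<s (ℕₚ.m≤m*n s (suc n))

    -- prod n = (Q;Q)_n, with inverse a n.
    prod : ℕ → Carrier
    prod zero    = 1#
    prod (suc n) = prod n * (1# - E (suc n))

    a : ℕ → Carrier
    a zero    = 1#
    a (suc n) = a n * geom (s ℕ.* suc n)

    a-suc : ∀ n → (1# - E (suc n)) * a (suc n) ≈ a n
    a-suc n = begin
      (1# - E (suc n)) * (a n * geom (s ℕ.* suc n))
        ≈⟨ solve 3 (λ x y z → x :* (y :* z) := (x :* z) :* y) refl _ _ _ ⟩
      (1# - E (suc n)) * geom (s ℕ.* suc n) * a n  ≈⟨ *-congʳ (geom-inverse _ (0<s*suc n)) ⟩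
      1# * a n                                     ≈⟨ *-identityˡ _ ⟩
      a n                                          ∎

    prod-a : ∀ n → prod n * a n ≈ 1#
    prod-a zero = *-identityˡ 1#
    prod-a (suc n) = begin
      prod n * (1# - E (suc n)) * a (suc n)    ≈⟨ *-assoc _ _ _ ⟩
      prod n * ((1# - E (suc n)) * a (suc n))  ≈⟨ *-congˡ (a-suc n) ⟩
      prod n * a n                             ≈⟨ prod-a n ⟩
      1#                                       ∎

    prod-stable : ∀ j → prod (N ℕ.+ j) ≈ prod N
    prod-stable zero = reflexive (≡.cong prod (ℕₚ.+-identityʳ N))
    prod-stable (suc j) = begin
      prod (N ℕ.+ suc j)                             ≡⟨ ≡.cong prod (ℕₚ.+-suc N j) ⟩
      prod (N ℕ.+ j) * (1# - E (suc (N ℕ.+ j)))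
        ≈⟨ *-congˡ (+-congˡ (-‿cong (E-≥N {suc (N ℕ.+ j)} (ℕₚ.≤-trans (ℕₚ.m≤m+n N j) (ℕₚ.n≤1+n _)) ℕₚ.≤-refl))) ⟩
      prod (N ℕ.+ j) * (1# - 0#)                     ≈⟨ solve 1 (λ x → x :* (:1 :- :0) := x) refl _ ⟩
      prod (N ℕ.+ j)                                 ≈⟨ prod-stable j ⟩
      prod N                                         ∎

    a-stable : ∀ j → a (N ℕ.+ j) ≈ a N
    a-stable zero = reflexive (≡.cong a (ℕₚ.+-identityʳ N))
    a-stable (suc j) = begin
      a (N ℕ.+ suc j)                                    ≡⟨ ≡.cong a (ℕₚ.+-suc N j) ⟩
      a (suc (N ℕ.+ j))                                  ≈⟨ solve 1 (λ x → x := (:1 :- :0) :* x) refl _ ⟩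
      (1# - 0#) * a (suc (N ℕ.+ j))
        ≈⟨ *-congʳ (+-congˡ (-‿cong (E-≥N {suc (N ℕ.+ j)} (ℕₚ.≤-trans (ℕₚ.m≤m+n N j) (ℕₚ.n≤1+n _)) ℕₚ.≤-refl))) ⟨
      (1# - E (suc (N ℕ.+ j))) * a (suc (N ℕ.+ j))       ≈⟨ a-suc _ ⟩
      a (N ℕ.+ j)                                        ≈⟨ a-stable j ⟩
      a N                                                ∎

    -- Bailey pairs relative to Q

    -- c′ r = (-1)^r Q^(r(r-1)/2)
    c′ : ℕ → Carrier
    c′ zero    = 1#
    c′ (suc r) = - (E r * c′ r)

    -- This is 1 - Q times the α-sequence of the unit Bailey pair relative to Q; despite the name it
    -- is an input to `bailey`.
    β : ℕ → Carrier
    β r = c′ r * (1# - E (suc (r ℕ.+ r)))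

    -- The defining relation of a Bailey pair, Σ α_r/((Q)_(L-r) (Q)_(L+r+1)), with the usual factor
    -- 1 - Q absorbed into α.
    bailey : (ℕ → Carrier) → ℕ → Carrier
    bailey α L = ∑[ r < suc L ] α r * (a (L ∸ r) * a (suc (L ℕ.+ r)))

    -- Multiplied by 1 - Q^L, the partial sums telescope. The variable d = L - k keeps truncated
    -- subtraction out of the closed form.
    unit-partial : ∀ k d L → L ≡ k ℕ.+ d →
      (1# - E L) * (∑[ r < k ] β r * (a (L ∸ r) * a (suc (L ℕ.+ r))))
        ≈ - (c′ k * (1# - E k) * (a d * a (L ℕ.+ k)))
    unit-partial zero d L eq = begin
      (1# - E L) * 0#                             ≈⟨ solve 2 (λ x y → x :* :0 := :- (:1 :* (:1 :- :1) :* y)) refl _ _ ⟩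
      - (1# * (1# - 1#) * (a d * a (L ℕ.+ 0)))
        ≈⟨ -‿cong (*-congʳ (*-congˡ (+-congˡ (-‿cong (sym E-0))))) ⟩
      - (1# * (1# - E 0) * (a d * a (L ℕ.+ 0)))   ∎
    unit-partial (suc k) d L eq = begin
      (1# - E L) * (∑[ r < k ] term r + term k)
        ≈⟨ distribˡ _ _ _ ⟩
      (1# - E L) * ∑ k term + (1# - E L) * term k
        ≈⟨ +-congʳ (unit-partial k (suc d) L (≡.trans eq (≡.sym (ℕₚ.+-suc k d)))) ⟩
      - (c′ k * (1# - E k) * (a (suc d) * a (L ℕ.+ k))) + (1# - E L) * term k
        ≈⟨ +-cong (-‿cong (*-congˡ (*-congˡ (trans (sym (a-suc (L ℕ.+ k))) (*-congʳ (1-cong (E-expand (k ∷ k ∷ suc d ∷ 1 ∷ [])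
                    (lk (≡.trans eq (≡.sym (ℕₚ.+-suc k d)))))))))))
             (*-cong (1-cong (E-expand (k ∷ suc d ∷ []) (≡.trans eq (e₁ k d))))
               (*-cong (*-congˡ (1-cong (E-expand (k ∷ k ∷ 1 ∷ []) (e₂ k))))
                 (*-congʳ (reflexive (≡.cong a (L∸k eq)))))) ⟩
      - (c′ k * (1# - E k) * (a (suc d) * ((1# - E k * (E k * (E (suc d) * (E 1 * 1#)))) * Z)))
        + (1# - E k * (E (suc d) * 1#)) * (c′ k * (1# - E k * (E k * (E 1 * 1#))) * (a (suc d) * Z))
        -- The telescoping rests on (1 - kD)(1 - k²q) - (1 - k)(1 - k²Dq) = k(1 - kq)(1 - D), where
        -- k, D, q stand for Q^k, Q^(d+1), Q.
        ≈⟨ solve 6 (λ C k D q A Z →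
             :- (C :* (:1 :- k) :* (A :* ((:1 :- k :* (k :* (D :* (q :* :1)))) :* Z)))
               :+ (:1 :- k :* (D :* :1)) :* (C :* (:1 :- k :* (k :* (q :* :1))) :* (A :* Z))
             := :- (:- (k :* C) :* (:1 :- k :* (q :* :1)) :* (((:1 :- D) :* A) :* Z))) refl
             (c′ k) (E k) (E (suc d)) (E 1) (a (suc d)) Z ⟩
      - (- (E k * c′ k) * (1# - E k * (E 1 * 1#)) * (((1# - E (suc d)) * a (suc d)) * Z))
        ≈⟨ -‿cong (*-cong (*-congˡ (1-cong (sym (E-expand (k ∷ 1 ∷ []) (e₃ k)))))
             (*-cong (a-suc d) (reflexive (≡.cong a (≡.sym (ℕₚ.+-suc L k)))))) ⟩
      - (c′ (suc k) * (1# - E (suc k)) * (a d * a (L ℕ.+ suc k))) ∎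
      where
      term = λ r → β r * (a (L ∸ r) * a (suc (L ℕ.+ r)))
      Z = a (suc (L ℕ.+ k))
      1-cong : ∀ {x y} → x ≈ y → 1# - x ≈ 1# - y
      1-cong p = +-congˡ (-‿cong p)
      e₁ : ∀ k d → suc k ℕ.+ d ≡ k ℕ.+ (suc d ℕ.+ 0)
      e₁ = solve-∀
      e₂ : ∀ k → suc (k ℕ.+ k) ≡ k ℕ.+ (k ℕ.+ 1)
      e₂ = solve-∀
      e₃ : ∀ k → suc k ≡ k ℕ.+ 1
      e₃ = solve-∀
      lk : L ≡ k ℕ.+ suc d → suc (L ℕ.+ k) ≡ k ℕ.+ (k ℕ.+ (suc d ℕ.+ 1))
      lk ≡.refl = e₄ k d
        where
        e₄ : ∀ k d → suc (k ℕ.+ suc d ℕ.+ k) ≡ k ℕ.+ (k ℕ.+ (suc d ℕ.+ 1))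
        e₄ = solve-∀
      L∸k : L ≡ suc k ℕ.+ d → L ∸ k ≡ suc d
      L∸k ≡.refl = ≡.trans (≡.cong (_∸ k) (≡.sym (ℕₚ.+-suc k d))) (ℕₚ.m+n∸m≡n k (suc d))

    unit-pair-0 : bailey β 0 ≈ 1#
    unit-pair-0 = begin
      0# + 1# * (1# - E 1) * (1# * a 1)    ≈⟨ solve 2 (λ x y → :0 :+ :1 :* x :* (:1 :* y) := x :* y) refl _ _ ⟩
      (1# - E 1) * a 1                     ≈⟨ a-suc 0 ⟩
      1#                                   ∎

    -- For L > 0 the factor 1 - Q^L is a unit, and the closed form of the first L terms cancels
    -- against the last term.
    unit-pair-suc : ∀ M → bailey β (suc M) ≈ 0#
    unit-pair-suc M = geom-cancel (s ℕ.* L) (bailey β L) (0<s*suc M) (begin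
      (1# - E L) * (∑ L term + term L)
        ≈⟨ distribˡ _ _ _ ⟩
      (1# - E L) * ∑ L term + (1# - E L) * term L
        ≈⟨ +-cong (unit-partial L 0 L (≡.sym (ℕₚ.+-identityʳ L))) (*-congˡ (*-congˡ (*-congʳ (reflexive (≡.cong a (ℕₚ.n∸n≡0 L)))))) ⟩
      - (c′ L * (1# - E L) * (1# * a (L ℕ.+ L))) + (1# - E L) * (c′ L * (1# - E (suc (L ℕ.+ L))) * (1# * a (suc (L ℕ.+ L))))
        ≈⟨ +-congʳ (-‿cong (*-congˡ (*-congˡ (a-suc (L ℕ.+ L))))) ⟨
      - (c′ L * (1# - E L) * (1# * ((1# - E (suc (L ℕ.+ L))) * a (suc (L ℕ.+ L)))))
        + (1# - E L) * (c′ L * (1# - E (suc (L ℕ.+ L))) * (1# * a (suc (L ℕ.+ L))))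
        ≈⟨ solve 4 (λ C l x z → :- (C :* l :* (:1 :* (x :* z))) :+ l :* (C :* x :* (:1 :* z)) := :0) refl _ _ _ _ ⟩
      0# ∎)
      where
      L = suc M
      term = λ r → β r * (a (L ∸ r) * a (suc (L ℕ.+ r)))

    -- Partial sums of the case m = 2r + 1 of the Durfee rectangle identity Σ_d Q^(d² + dm)/((Q)_d
    -- (Q)_(d+m)) = 1/(Q)_∞.
    S : ℕ → ℕ → Carrier
    S n r = ∑[ d < n ] E (d ℕ.* d ℕ.+ d ℕ.+ 2 ℕ.* (d ℕ.* r)) * (a d * a (suc (d ℕ.+ r ℕ.+ r)))

    -- Replacing r by r + 1 changes the sum by a single boundary term whose order grows with n, so
    -- the full sum does not depend on r.
    S-telescope : ∀ n r → S (suc n) r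
      ≈ S n (suc r) + (1# - E (suc r ℕ.+ suc r)) * E (n ℕ.* n ℕ.+ n ℕ.* (suc r ℕ.+ suc r ℕ.+ 1)) * (a n * a (suc (suc (n ℕ.+ r ℕ.+ r))))
    S-telescope zero r = begin
      0# + E 0 * (1# * a (suc (r ℕ.+ r)))
        ≈⟨ +-congˡ (*-congˡ (*-congˡ (sym (trans (*-congʳ (+-congˡ (-‿cong (reflexive (≡.cong (λ k → E (suc k)) (ℕₚ.+-suc r r)))))) (a-suc _))))) ⟩
      0# + E 0 * (1# * ((1# - E (suc r ℕ.+ suc r)) * a (suc (suc (r ℕ.+ r)))))
        ≈⟨ solve 3 (λ x y z → :0 :+ x :* (:1 :* (y :* z)) := :0 :+ y :* x :* (:1 :* z)) refl _ _ _ ⟩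
      0# + (1# - E (suc r ℕ.+ suc r)) * E 0 * (1# * a (suc (suc (r ℕ.+ r)))) ∎
    S-telescope (suc n) r = begin
      S (suc n) r + E (suc n ℕ.* suc n ℕ.+ suc n ℕ.+ 2 ℕ.* (suc n ℕ.* r)) * (a (suc n) * a (suc (suc (n ℕ.+ r ℕ.+ r))))
        ≈⟨ +-congʳ (S-telescope n r) ⟩
      S n (suc r) + (1# - E (suc r ℕ.+ suc r)) * E (n ℕ.* n ℕ.+ n ℕ.* (suc r ℕ.+ suc r ℕ.+ 1)) * (a n * a (suc (suc (n ℕ.+ r ℕ.+ r))))
        + E (suc n ℕ.* suc n ℕ.+ suc n ℕ.+ 2 ℕ.* (suc n ℕ.* r)) * (a (suc n) * a (suc (suc (n ℕ.+ r ℕ.+ r))))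
        ≈⟨ trans (+-cong (+-congˡ (*-cong (*-cong (+-congˡ (-‿cong (E-expand (r ℕ.+ r ∷ 1 ∷ 1 ∷ []) (e₁ r))))
               (E-expand (n ℕ.* n ∷ n ℕ.* (r ℕ.+ r) ∷ n ∷ n ∷ n ∷ []) (e₂ n r)))
               (*-cong an Zn))) (*-cong (E-expand (n ℕ.* n ∷ n ℕ.* (r ℕ.+ r) ∷ n ∷ n ∷ n ∷ r ℕ.+ r ∷ 1 ∷ 1 ∷ []) (e₃ n r)) (*-congˡ Zn)))
             (solve 8 (λ Y w q M P n A Z →
               Y :+ (:1 :- w :* (q :* (q :* :1))) :* (M :* (P :* (n :* (n :* (n :* :1))))) :* ((:1 :- n :* (q :* :1)) :* A :* ((:1 :- n :* (w :* (q :* (q :* (q :* :1))))) :* Z))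
                 :+ M :* (P :* (n :* (n :* (n :* (w :* (q :* (q :* :1))))))) :* (A :* ((:1 :- n :* (w :* (q :* (q :* (q :* :1))))) :* Z))
               := Y :+ M :* (P :* (n :* (n :* (n :* :1)))) :* ((:1 :- n :* (q :* :1)) :* A :* Z)
                 :+ (:1 :- w :* (q :* (q :* :1))) :* (M :* (P :* (n :* (n :* (n :* (n :* (n :* (w :* (q :* (q :* (q :* (q :* :1)))))))))))) :* (A :* Z)) refl
               (S n (suc r)) (E (r ℕ.+ r)) (E 1) (E (n ℕ.* n)) (E (n ℕ.* (r ℕ.+ r))) (E n) (a (suc n)) Z) ⟩
      _ ≈⟨ +-cong (+-congˡ (*-cong (E-expand (n ℕ.* n ∷ n ℕ.* (r ℕ.+ r) ∷ n ∷ n ∷ n ∷ []) (e₄ n r)) (*-cong an (reflexive (≡.cong a (≡.cong suc (e₅ n r)))))))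
             (*-cong (*-cong (+-congˡ (-‿cong (E-expand (r ℕ.+ r ∷ 1 ∷ 1 ∷ []) (e₁ r))))
               (E-expand (n ℕ.* n ∷ n ℕ.* (r ℕ.+ r) ∷ n ∷ n ∷ n ∷ n ∷ n ∷ r ℕ.+ r ∷ 1 ∷ 1 ∷ 1 ∷ 1 ∷ []) (e₆ n r))) refl) ⟨
      S n (suc r) + E (n ℕ.* n ℕ.+ n ℕ.+ 2 ℕ.* (n ℕ.* suc r)) * (a n * a (suc (n ℕ.+ suc r ℕ.+ suc r)))
        + (1# - E (suc r ℕ.+ suc r)) * E (suc n ℕ.* suc n ℕ.+ suc n ℕ.* (suc r ℕ.+ suc r ℕ.+ 1)) * (a (suc n) * a (suc (suc (suc n ℕ.+ r ℕ.+ r)))) ∎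
      where
      Z = a (suc (suc (suc n ℕ.+ r ℕ.+ r)))
      an : a n ≈ (1# - E n * (E 1 * 1#)) * a (suc n)
      an = trans (sym (a-suc n)) (*-congʳ (+-congˡ (-‿cong (E-expand (n ∷ 1 ∷ []) (eq n)))))
        where
        eq : ∀ n → suc n ≡ n ℕ.+ 1
        eq = solve-∀
      Zn : a (suc (suc (n ℕ.+ r ℕ.+ r))) ≈ (1# - E n * (E (r ℕ.+ r) * (E 1 * (E 1 * (E 1 * 1#))))) * Z
      Zn = trans (sym (a-suc _)) (*-congʳ (+-congˡ (-‿cong (E-expand (n ∷ r ℕ.+ r ∷ 1 ∷ 1 ∷ 1 ∷ []) (eq n r)))))
        where
        eq : ∀ n r → suc (suc (suc n ℕ.+ r ℕ.+ r)) ≡ n ℕ.+ (r ℕ.+ r ℕ.+ 3)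
        eq = solve-∀
      e₁ : ∀ r → suc r ℕ.+ suc r ≡ r ℕ.+ r ℕ.+ 2
      e₁ = solve-∀
      e₂ : ∀ n r → n ℕ.* n ℕ.+ n ℕ.* (suc r ℕ.+ suc r ℕ.+ 1) ≡ n ℕ.* n ℕ.+ (n ℕ.* (r ℕ.+ r) ℕ.+ (n ℕ.+ (n ℕ.+ (n ℕ.+ 0))))
      e₂ = solve-∀
      e₃ : ∀ n r → suc n ℕ.* suc n ℕ.+ suc n ℕ.+ 2 ℕ.* (suc n ℕ.* r) ≡ n ℕ.* n ℕ.+ (n ℕ.* (r ℕ.+ r) ℕ.+ (n ℕ.+ (n ℕ.+ (n ℕ.+ (r ℕ.+ r ℕ.+ 2)))))
      e₃ = solve-∀
      e₄ : ∀ n r → n ℕ.* n ℕ.+ n ℕ.+ 2 ℕ.* (n ℕ.* suc r) ≡ n ℕ.* n ℕ.+ (n ℕ.* (r ℕ.+ r) ℕ.+ (n ℕ.+ (n ℕ.+ (n ℕ.+ 0))))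
      e₄ = solve-∀
      e₅ : ∀ n r → n ℕ.+ suc r ℕ.+ suc r ≡ suc (suc n ℕ.+ r ℕ.+ r)
      e₅ = solve-∀
      e₆ : ∀ n r → suc n ℕ.* suc n ℕ.+ suc n ℕ.* (suc r ℕ.+ suc r ℕ.+ 1)
        ≡ n ℕ.* n ℕ.+ (n ℕ.* (r ℕ.+ r) ℕ.+ (n ℕ.+ (n ℕ.+ (n ℕ.+ (n ℕ.+ (n ℕ.+ (r ℕ.+ r ℕ.+ 4)))))))
      e₆ = solve-∀

    a∞ : Carrier
    a∞ = a N

    S-step : ∀ r → S N r ≈ S N (suc r)
    S-step r = begin
      S N r          ≈⟨ +-identityʳ _ ⟨
      S N r + 0#
        ≈⟨ +-congˡ (trans (*-congʳ (E-≥N {N} ℕₚ.≤-refl (ℕₚ.≤-trans (ℕₚ.m≤n+m N (N ℕ.* N)) (ℕₚ.m≤m+n _ _)))) (zeroˡ _)) ⟨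
      S (suc N) r    ≈⟨ S-telescope N r ⟩
      S N (suc r) + (1# - E (suc r ℕ.+ suc r)) * E (N ℕ.* N ℕ.+ N ℕ.* (suc r ℕ.+ suc r ℕ.+ 1)) * (a N * a (suc (suc (N ℕ.+ r ℕ.+ r))))
        ≈⟨ +-congˡ (*-congʳ (*-congˡ (E-≥N {N} ℕₚ.≤-refl (ℕₚ.≤-trans (ℕₚ.m≤m*n N N) (ℕₚ.m≤m+n _ _))))) ⟩
      S N (suc r) + (1# - E (suc r ℕ.+ suc r)) * 0# * (a N * a (suc (suc (N ℕ.+ r ℕ.+ r))))
        ≈⟨ solve 3 (λ x y z → x :+ y :* :0 :* z := x) refl _ _ _ ⟩
      S N (suc r)    ∎

    S-start : ∀ r → S N r ≈ S N 0
    S-start zero    = refl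
    S-start (suc r) = trans (sym (S-step r)) (S-start r)

    S-N : S N N ≈ a∞
    S-N = begin
      S N N ≈⟨ ∑-extend {N} {1} _ (s≤s z≤n) (λ { (suc d) _ → trans (*-congʳ (E-≥N {N} ℕₚ.≤-refl
                 (ℕₚ.≤-trans (ℕₚ.m≤m+n N (d ℕ.* N)) (ℕₚ.≤-trans (ℕₚ.m≤m+n _ _) (ℕₚ.m≤n+m _ (suc d ℕ.* suc d ℕ.+ suc d)))))) (zeroˡ _) }) ⟩
      0# + E 0 * (1# * a (suc (0 ℕ.+ N ℕ.+ N)))
        ≈⟨ +-congˡ (*-cong E-0 (*-congˡ (trans (reflexive (≡.cong a (≡.sym (ℕₚ.+-suc N N)))) (a-stable (suc N))))) ⟩
      0# + 1# * (1# * a∞)   ≈⟨ solve 1 (λ x → :0 :+ :1 :* (:1 :* x) := x) refl _ ⟩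
      a∞                    ∎

    -- By independence of r the sum may be evaluated at r = `N`, where only d = 0 survives.
    S-value : ∀ r → S N r ≈ a∞
    S-value r = trans (S-start r) (trans (sym (S-start N)) S-N)

    -- The limiting case of Bailey's lemma.
    bailey-sum : ∀ α → ∑[ L < N ] E (L ℕ.* L ℕ.+ L) * bailey α L ≈ (∑[ r < N ] E (r ℕ.* r ℕ.+ r) * α r) * a∞
    bailey-sum α = begin
      ∑[ L < N ] E (L ℕ.* L ℕ.+ L) * bailey α L
        ≈⟨ ∑-cong′ N (λ L → sym (∑-*ˡ (suc L) _ _)) ⟩
      ∑[ L < N ] ∑[ r < suc L ] E (L ℕ.* L ℕ.+ L) * (α r * (a (L ∸ r) * a (suc (L ℕ.+ r))))
        ≈⟨ ∑-triangle N _ ⟩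
      ∑[ r < N ] ∑[ d < N ∸ r ] E ((r ℕ.+ d) ℕ.* (r ℕ.+ d) ℕ.+ (r ℕ.+ d)) * (α r * (a (r ℕ.+ d ∸ r) * a (suc (r ℕ.+ d ℕ.+ r))))
        ≈⟨ ∑-cong′ N (λ r → ∑-extend {N} {N ∸ r} _ (ℕₚ.m∸n≤m N r) (λ d p →
             trans (*-congʳ (E-≥N {r ℕ.+ d} (ℕₚ.≤-trans (ℕₚ.m≤n+m∸n N r) (ℕₚ.+-monoʳ-≤ r p)) (ℕₚ.m≤n+m _ ((r ℕ.+ d) ℕ.* (r ℕ.+ d))))) (zeroˡ _))) ⟨
      ∑[ r < N ] ∑[ d < N ] E ((r ℕ.+ d) ℕ.* (r ℕ.+ d) ℕ.+ (r ℕ.+ d)) * (α r * (a (r ℕ.+ d ∸ r) * a (suc (r ℕ.+ d ℕ.+ r))))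
        -- The exponent separates as (r² + r) + (d² + d + 2dr), so the inner sum is `S N r`, the
        -- same for every r.
        ≈⟨ ∑-cong′ N (λ r → trans (∑-cong′ N (summand r)) (trans (∑-*ˡ N _ _) (*-congˡ (S-value r)))) ⟩
      ∑[ r < N ] E (r ℕ.* r ℕ.+ r) * α r * a∞
        ≈⟨ ∑-*ʳ N _ _ ⟩
      (∑[ r < N ] E (r ℕ.* r ℕ.+ r) * α r) * a∞ ∎
      where
      e₁ : ∀ r d → (r ℕ.+ d) ℕ.* (r ℕ.+ d) ℕ.+ (r ℕ.+ d) ≡ (r ℕ.* r ℕ.+ r) ℕ.+ (d ℕ.* d ℕ.+ d ℕ.+ 2 ℕ.* (d ℕ.* r))
      e₁ = solve-∀
      e₂ : ∀ r d → r ℕ.+ d ℕ.+ r ≡ d ℕ.+ r ℕ.+ r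
      e₂ = solve-∀
      summand : ∀ r d → E ((r ℕ.+ d) ℕ.* (r ℕ.+ d) ℕ.+ (r ℕ.+ d)) * (α r * (a (r ℕ.+ d ∸ r) * a (suc (r ℕ.+ d ℕ.+ r))))
        ≈ E (r ℕ.* r ℕ.+ r) * α r * (E (d ℕ.* d ℕ.+ d ℕ.+ 2 ℕ.* (d ℕ.* r)) * (a d * a (suc (d ℕ.+ r ℕ.+ r))))
      summand r d = trans
        (*-cong (trans (reflexive (≡.cong E (e₁ r d))) (E-+ _ _))
          (*-congˡ (*-cong (reflexive (≡.cong a (ℕₚ.m+n∸m≡n r d))) (reflexive (≡.cong a (≡.cong suc (e₂ r d)))))))
        (solve 4 (λ x y z w → x :* y :* (z :* w) := x :* z :* (y :* w)) refl _ _ _ _)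

    -- Bailey's lemma for the unit pair: only L = 0 survives on the left. This is the pentagonal
    -- number theorem before its summands are split.
    euler : ∑[ r < N ] E (r ℕ.* r ℕ.+ r) * β r ≈ prod N
    euler = begin
      P                    ≈⟨ *-identityʳ P ⟨
      P * 1#               ≈⟨ *-congˡ (trans (*-comm _ _) (prod-a N)) ⟨
      P * (a∞ * prod N)    ≈⟨ *-assoc _ _ _ ⟨
      P * a∞ * prod N      ≈⟨ *-congʳ (bailey-sum β) ⟨
      (∑[ L < N ] E (L ℕ.* L ℕ.+ L) * bailey β L) * prod N   ≈⟨ *-congʳ (∑-extend {N} {1} _ (s≤s z≤n) (λ { (suc L) _ →
                                trans (*-congˡ (unit-pair-suc L)) (zeroʳ _) })) ⟩
      (0# + E 0 * bailey β 0) * prod N     ≈⟨ *-congʳ (+-congˡ (*-cong E-0 unit-pair-0)) ⟩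
      (0# + 1# * 1#) * prod N   ≈⟨ solve 1 (λ x → (:0 :+ :1 :* :1) :* x := x) refl _ ⟩
      prod N               ∎
      where P = ∑[ r < N ] E (r ℕ.* r ℕ.+ r) * β r

    module Universal (x y : ℕ) (0<x : 0 < x) (0<y : 0 < y) (x+y≡s : x ℕ.+ y ≡ s) where
      -- `gx r` and `gy r` are 1/(1 - q^x Q^r) and 1/(1 - q^y Q^r), and `B n` is 1/((q^x;Q)_(n+1)
      -- (q^y;Q)_(n+1)). The choice of `α` makes (`α`, `B`) a Bailey pair.
      gx gy α B : ℕ → Carrier
      gx r = geom (x ℕ.+ s ℕ.* r)
      gy r = geom (y ℕ.+ s ℕ.* r)
      α r = β r * (E r * (gx r * gy r))
      B zero    = gx 0 * gy 0
      B (suc n) = B n * (gx (suc n) * gy (suc n))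

      gx-inverse : ∀ r → (1# - e x * E r) * gx r ≈ 1#
      gx-inverse r = trans (*-congʳ (+-congˡ (-‿cong (sym (e-+ _ _))))) (geom-inverse _ (ℕₚ.<-≤-trans 0<x (ℕₚ.m≤m+n x _)))

      gy-inverse : ∀ r → (1# - e y * E r) * gy r ≈ 1#
      gy-inverse r = trans (*-congʳ (+-congˡ (-‿cong (sym (e-+ _ _))))) (geom-inverse _ (ℕₚ.<-≤-trans 0<y (ℕₚ.m≤m+n y _)))

      E1 : E 1 ≈ e x * e y
      E1 = trans (e-cong (≡.trans (ℕₚ.*-identityʳ s) (≡.sym x+y≡s))) (e-+ x y)

      -- Termwise, multiplication by both factors turns the L-th sum into the M-th plus Q^L times a
      -- term of the unit pair, and those extra terms add up to 0 because L > 0.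
      bailey-α-suc : ∀ M → (1# - e x * E (suc M)) * (1# - e y * E (suc M)) * bailey α (suc M) ≈ bailey α M
      bailey-α-suc M = begin
        w * (∑ L term + term L)
          ≈⟨ trans (distribˡ _ _ _) (+-congʳ (sym (∑-*ˡ L _ _))) ⟩
        (∑[ r < L ] w * term r) + w * term L
          ≈⟨ +-cong (∑-cong L step) top ⟩
        (∑[ r < L ] (term′ r + E L * unit r)) + E L * unit L
          ≈⟨ +-congʳ (∑-+ L _ _) ⟩
        ∑ L term′ + (∑[ r < L ] E L * unit r) + E L * unit L
          ≈⟨ +-assoc _ _ _ ⟩
        ∑ L term′ + (∑[ r < suc L ] E L * unit r)
          ≈⟨ +-congˡ (trans (∑-*ˡ (suc L) _ _) (*-congˡ (unit-pair-suc M))) ⟩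
        ∑ L term′ + E L * 0#
          ≈⟨ solve 2 (λ x y → x :+ y :* :0 := x) refl _ _ ⟩
        bailey α M ∎
        where
        L = suc M
        w = (1# - e x * E L) * (1# - e y * E L)
        term term′ unit : ℕ → Carrier
        term  r = α r * (a (L ∸ r) * a (suc (L ℕ.+ r)))
        term′ r = α r * (a (M ∸ r) * a (suc (M ℕ.+ r)))
        unit  r = β r * (a (L ∸ r) * a (suc (L ℕ.+ r)))
        -- The term r = L has no counterpart in `bailey α M`; it contributes to the unit pair only.
        top : w * term L ≈ E L * unit L
        top = begin
          w * (β L * (E L * (gx L * gy L)) * A)
            ≈⟨ solve 7 (λ u v b k g h A → u :* v :* (b :* (k :* (g :* h)) :* A) := (u :* g) :* (v :* h) :* (k :* (b :* A))) refl _ _ _ _ _ _ _ ⟩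
          (1# - e x * E L) * gx L * ((1# - e y * E L) * gy L) * (E L * (β L * A))
            ≈⟨ *-congʳ (*-cong (gx-inverse L) (gy-inverse L)) ⟩
          1# * 1# * (E L * (β L * A))
            ≈⟨ solve 1 (λ x → :1 :* :1 :* x := x) refl _ ⟩
          E L * unit L ∎
          where A = a (L ∸ L) * a (suc (L ℕ.+ L))
        step : ∀ r → r < L → w * term r ≈ term′ r + E L * unit r
        step r (s≤s r≤M) = begin
          w * (β r * (E r * (gx r * gy r)) * (a (L ∸ r) * Z))
            ≈⟨ *-cong (*-cong (+-congˡ (-‿cong (*-congˡ EL))) (+-congˡ (-‿cong (*-congˡ EL)))) (*-congˡ (*-congʳ aL)) ⟩
          (1# - e x * (E r * D)) * (1# - e y * (E r * D)) * (β r * (E r * (gx r * gy r)) * (A * Z))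
            -- The underlying identity is (1 - xrD)(1 - yrD) = (1 - D)(1 - xyr²D) + D(1 - xr)(1 -
            -- yr); since q^x q^y = Q, the product xyr²D is Q^(L+r+1).
            ≈⟨ solve 9 (λ x y r D b g h A Z →
                 (:1 :- x :* (r :* D)) :* (:1 :- y :* (r :* D)) :* (b :* (r :* (g :* h)) :* (A :* Z))
                 := b :* (r :* (g :* h)) :* ((:1 :- D) :* A :* ((:1 :- r :* (r :* (D :* ((x :* y) :* :1)))) :* Z))
                   :+ r :* D :* (((:1 :- x :* r) :* g :* ((:1 :- y :* r) :* h)) :* (b :* (A :* Z)))) refl
                 (e x) (e y) (E r) D (β r) (gx r) (gy r) A Z ⟩
          α r * ((1# - D) * A * ((1# - E r * (E r * (D * ((e x * e y) * 1#)))) * Z))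
            + E r * D * (((1# - e x * E r) * gx r * ((1# - e y * E r) * gy r)) * (β r * (A * Z)))
            ≈⟨ +-cong (*-congˡ (*-cong (a-suc δ) (trans (*-congʳ (+-congˡ (-‿cong (sym EZ)))) (a-suc (suc (M ℕ.+ r))))))
                 (*-cong (sym EL) (trans (*-cong (trans (*-cong (gx-inverse r) (gy-inverse r)) (*-identityˡ 1#)) (*-congˡ (*-congʳ (sym aL)))) (*-identityˡ _))) ⟩
          α r * (a δ * a (suc (M ℕ.+ r))) + E L * (β r * (a (L ∸ r) * Z)) ∎
          where
          δ = M ∸ r
          Z = a (suc (L ℕ.+ r))
          D = E (suc δ)
          A = a (suc δ)
          aL : a (L ∸ r) ≈ A
          aL = reflexive (≡.cong a (ℕₚ.+-∸-assoc 1 r≤M))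
          r+sδ : r ℕ.+ suc δ ≡ L
          r+sδ = ≡.trans (ℕₚ.+-suc r δ) (≡.cong suc (ℕₚ.m+[n∸m]≡n r≤M))
          EL : E L ≈ E r * D
          EL = trans (reflexive (≡.cong E (≡.sym r+sδ))) (E-+ r (suc δ))
          e₁ : ∀ r k → suc (k ℕ.+ r) ≡ r ℕ.+ (k ℕ.+ 1)
          e₁ = solve-∀
          EZ : E (suc (L ℕ.+ r)) ≈ E r * (E r * (D * ((e x * e y) * 1#)))
          EZ = trans (reflexive (≡.cong E (≡.trans (e₁ r L) (≡.cong (λ k → r ℕ.+ (k ℕ.+ 1)) (≡.sym r+sδ)))))
            (trans (E-expand (r ∷ r ∷ suc δ ∷ 1 ∷ []) (e₂ r (suc δ)))
              (*-congˡ (*-congˡ (*-congˡ (*-congʳ E1)))))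
            where
            e₂ : ∀ r k → r ℕ.+ (r ℕ.+ k ℕ.+ 1) ≡ r ℕ.+ (r ℕ.+ (k ℕ.+ 1))
            e₂ = solve-∀

      -- Both sides satisfy the same first-order recursion with unit coefficients.
      B-bailey : ∀ L → B L ≈ bailey α L
      B-bailey zero = sym (begin
        0# + 1# * (1# - E 1) * (E 0 * (gx 0 * gy 0)) * (1# * a 1)
          ≈⟨ solve 4 (λ q k g z → :0 :+ :1 :* q :* (k :* g) :* (:1 :* z) := g :* k :* (q :* z)) refl _ _ _ _ ⟩
        gx 0 * gy 0 * E 0 * ((1# - E 1) * a 1)
          ≈⟨ *-cong (*-congˡ E-0) (a-suc 0) ⟩
        gx 0 * gy 0 * 1# * 1#
          ≈⟨ solve 1 (λ x → x :* :1 :* :1 := x) refl _ ⟩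
        gx 0 * gy 0 ∎)
      B-bailey (suc M) = begin
        B M * (gx L * gy L)
          ≈⟨ *-congʳ (trans (B-bailey M) (sym (bailey-α-suc M))) ⟩
        (1# - e x * E L) * (1# - e y * E L) * bailey α L * (gx L * gy L)
          ≈⟨ solve 5 (λ u v b g h → u :* v :* b :* (g :* h) := (u :* g) :* (v :* h) :* b) refl _ _ _ _ _ ⟩
        (1# - e x * E L) * gx L * ((1# - e y * E L) * gy L) * bailey α L
          ≈⟨ *-congʳ (*-cong (gx-inverse L) (gy-inverse L)) ⟩
        1# * 1# * bailey α L   ≈⟨ solve 1 (λ x → :1 :* :1 :* x := x) refl _ ⟩
        bailey α L ∎
        where L = suc M

      universal : prod N * (∑[ L < N ] E (L ℕ.* L ℕ.+ L) * B L) ≈ ∑[ r < N ] E (r ℕ.* r ℕ.+ r) * α r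
      universal = begin
        prod N * (∑[ L < N ] E (L ℕ.* L ℕ.+ L) * B L)
          ≈⟨ *-congˡ (trans (∑-cong′ N (λ L → *-congˡ (B-bailey L))) (bailey-sum α)) ⟩
        prod N * (P * a∞)    ≈⟨ solve 3 (λ x y z → x :* (y :* z) := y :* (x :* z)) refl _ _ _ ⟩
        P * (prod N * a∞)    ≈⟨ *-congˡ (prod-a N) ⟩
        P * 1#               ≈⟨ *-identityʳ P ⟩
        P                    ∎
        where P = ∑[ r < N ] E (r ℕ.* r ℕ.+ r) * α r

-- Triangular numbers and Zagier's involution

τ : ℕ → ℕ
τ zero    = 0
τ (suc i) = τ i ℕ.+ suc i

τ-double : ∀ i → τ i ℕ.+ τ i ≡ i ℕ.* i ℕ.+ i
τ-double zero    = ≡.refl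
τ-double (suc i) = ≡.trans (e₁ (τ i) i) (≡.trans (≡.cong (ℕ._+ (suc i ℕ.+ suc i)) (τ-double i)) (e₂ i))
  where
  e₁ : ∀ t i → (t ℕ.+ suc i) ℕ.+ (t ℕ.+ suc i) ≡ t ℕ.+ t ℕ.+ (suc i ℕ.+ suc i)
  e₁ = solve-∀
  e₂ : ∀ i → i ℕ.* i ℕ.+ i ℕ.+ (suc i ℕ.+ suc i) ≡ suc i ℕ.* suc i ℕ.+ suc i
  e₂ = solve-∀

n≤τ : ∀ n → n ≤ τ n
n≤τ zero    = z≤n
n≤τ (suc n) = ℕₚ.m≤n+m (suc n) (τ n)

double-injective : ∀ {m n} → m ℕ.+ m ≡ n ℕ.+ n → m ≡ n
double-injective {m} {n} p = ℕₚ.*-cancelʳ-≡ m n 2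
  (≡.trans (e m) (≡.trans p (≡.sym (e n))))
  where
  e : ∀ m → m ℕ.* 2 ≡ m ℕ.+ m
  e = solve-∀

-- Triangular numbers are compared through their doubles, which are polynomials in the index.
τ+τ : ∀ i j k → (i ℕ.* i ℕ.+ i) ℕ.+ (j ℕ.* j ℕ.+ j) ≡ k ℕ.+ k → τ i ℕ.+ τ j ≡ k
τ+τ i j k p = double-injective (≡.trans (e (τ i) (τ j)) (≡.trans (≡.cong₂ ℕ._+_ (τ-double i) (τ-double j)) p))
  where
  e : ∀ s t → (s ℕ.+ t) ℕ.+ (s ℕ.+ t) ≡ (s ℕ.+ s) ℕ.+ (t ℕ.+ t)
  e = solve-∀

-- The value of x² + x + (y+1)(z+1) on the half y ≥ x, with y = x + w.
form : ℕ → ℕ → ℕ → ℕ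
form x w z = x ℕ.* x ℕ.+ x ℕ.+ suc (x ℕ.+ w) ℕ.* suc z

-- The value shared by corresponding points of the two outer regions: s² + s + (z+1)(t+1) with s = x
-- + z + 1.
outer : ℕ → ℕ → ℕ → ℕ
outer z x t = suc (x ℕ.+ z) ℕ.* suc (suc (x ℕ.+ z)) ℕ.+ suc z ℕ.* suc t

w≤form : ∀ x w z → w ≤ form x w z
w≤form x w z = ℕₚ.≤-trans (ℕₚ.≤-trans (ℕₚ.m≤n+m w (suc x)) (ℕₚ.m≤m*n (suc (x ℕ.+ w)) (suc z))) (ℕₚ.m≤n+m _ (x ℕ.* x ℕ.+ x))

x+z≤form : ∀ x w z → x ℕ.+ z ≤ form x w z
x+z≤form x w z = ℕₚ.+-mono-≤ (ℕₚ.m≤n+m x (x ℕ.* x)) (ℕₚ.≤-trans (ℕₚ.n≤1+n z) (ℕₚ.m≤n*m (suc z) (suc (x ℕ.+ w))))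

-- After adding xw, the value depends on x and w symmetrically once x + p is fixed. This is the
-- source of the involution in the middle region.
form-normal : ∀ x w p → form x w p ℕ.+ x ℕ.* w ≡ suc (x ℕ.+ w) ℕ.* suc (x ℕ.+ p)
form-normal = e
  where
  e : ∀ x w p → x ℕ.* x ℕ.+ x ℕ.+ suc (x ℕ.+ w) ℕ.* suc p ℕ.+ x ℕ.* w ≡ suc (x ℕ.+ w) ℕ.* suc (x ℕ.+ p)
  e = solve-∀

form-exchange : ∀ k x w → x ≤ k → w ≤ k → form x w (k ∸ x) ≡ form w x (k ∸ w)
form-exchange k x w x≤k w≤k = ℕₚ.+-cancelʳ-≡ (x ℕ.* w) _ _ (begin
  form x w (k ∸ x) ℕ.+ x ℕ.* w             ≡⟨ form-normal x w (k ∸ x) ⟩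
  suc (x ℕ.+ w) ℕ.* suc (x ℕ.+ (k ∸ x))
    ≡⟨ ≡.cong₂ (λ m n → suc m ℕ.* suc n) (ℕₚ.+-comm x w) (≡.trans (ℕₚ.m+[n∸m]≡n x≤k) (≡.sym (ℕₚ.m+[n∸m]≡n w≤k))) ⟩
  suc (w ℕ.+ x) ℕ.* suc (w ℕ.+ (k ∸ w))    ≡⟨ form-normal w x (k ∸ w) ⟨
  form w x (k ∸ w) ℕ.+ w ℕ.* x             ≡⟨ ≡.cong (form w x (k ∸ w) ℕ.+_) (ℕₚ.*-comm w x) ⟩
  form w x (k ∸ w) ℕ.+ x ℕ.* w             ∎)
  where open ≡.≡-Reasoning

form-outer : ∀ x z t → form x (suc (x ℕ.+ z) ℕ.+ suc t) z ≡ outer z x t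
form-outer = e
  where
  e : ∀ x z t → x ℕ.* x ℕ.+ x ℕ.+ suc (x ℕ.+ (suc (x ℕ.+ z) ℕ.+ suc t)) ℕ.* suc z
    ≡ suc (x ℕ.+ z) ℕ.* suc (suc (x ℕ.+ z)) ℕ.+ suc z ℕ.* suc t
  e = solve-∀

form-wall : ∀ x z → form x (suc (x ℕ.+ z) ℕ.+ 0) z ≡ suc (x ℕ.+ z) ℕ.* suc (suc (x ℕ.+ z))
form-wall = e
  where
  e : ∀ x z → x ℕ.* x ℕ.+ x ℕ.+ suc (x ℕ.+ (suc (x ℕ.+ z) ℕ.+ 0)) ℕ.* suc z ≡ suc (x ℕ.+ z) ℕ.* suc (suc (x ℕ.+ z))
  e = solve-∀

below-outer : ∀ z y t → suc (y ℕ.+ t) ℕ.* suc (y ℕ.+ t) ℕ.+ suc (y ℕ.+ t) ℕ.+ suc y ℕ.* suc z ≡ outer y t z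
below-outer = e
  where
  e : ∀ z y t → suc (y ℕ.+ t) ℕ.* suc (y ℕ.+ t) ℕ.+ suc (y ℕ.+ t) ℕ.+ suc y ℕ.* suc z
    ≡ suc (t ℕ.+ y) ℕ.* suc (suc (t ℕ.+ y)) ℕ.+ suc y ℕ.* suc z
  e = solve-∀

-- δ k is to be thought of as the indicator of k = N, with values in a ring of
-- characteristic 2; the sums below count representations of N modulo 2.
module Count {c ℓ} (R : CommutativeRing c ℓ)
  (1+1≈0 : CommutativeRing._≈_ R (CommutativeRing._+_ R (CommutativeRing.1# R) (CommutativeRing.1# R)) (CommutativeRing.0# R))
  (δ : ℕ → CommutativeRing.Carrier R) (B : ℕ)
  (δ-big : ∀ k → B ≤ k → CommutativeRing._≈_ R (δ k) (CommutativeRing.0# R)) where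

  open CommutativeRing R hiding (zero)
  open RingKit R
  open Char2 1+1≈0
  open Relation.Binary.Reasoning.Setoid setoid

  δ-≤ : ∀ {m k} → B ≤ m → m ≤ k → δ k ≈ 0#
  δ-≤ p q = δ-big _ (ℕₚ.≤-trans p q)

  δ-cong : ∀ {m n} → m ≡ n → δ m ≈ δ n
  δ-cong p = reflexive (≡.cong δ p)

  -- The sum-and-difference substitution. With j = i + t + 1, an even t = 2x gives y = x + i, and an
  -- odd t = 2y + 1 gives x = y + i + 1; the two parities fill the regions y ≥ x and y < x.
  triangular-pairs : ∑[ j < B ] ∑[ i < j ] δ (τ i ℕ.+ τ j)
    ≈ ∑[ x < B ] ∑[ y < B ] δ (x ℕ.* x ℕ.+ x ℕ.+ suc y ℕ.* suc y)
  triangular-pairs = begin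
    ∑[ j < B ] ∑[ i < j ] δ (τ i ℕ.+ τ j)
      ≈⟨ ∑-below B _ (λ { j i (inj₁ p) → δ-≤ p (ℕₚ.≤-trans (n≤τ j) (ℕₚ.m≤n+m (τ j) (τ i)))
                        ; j i (inj₂ p) → δ-≤ p (ℕₚ.≤-trans (n≤τ i) (ℕₚ.m≤m+n _ _)) }) ⟩
    ∑[ i < B ] ∑[ t < B ] δ (τ i ℕ.+ τ (suc (i ℕ.+ t)))
      ≈⟨ ∑-cong′ B (λ i → trans (sym (∑-extend {B ℕ.+ B} _ (ℕₚ.m≤m+n B B) (λ t p →
           δ-≤ p (ℕₚ.≤-trans (ℕₚ.≤-trans (ℕₚ.m≤n+m t (suc i)) (n≤τ (suc (i ℕ.+ t)))) (ℕₚ.m≤n+m _ (τ i))))))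
           (∑-even-odd B _)) ⟩
    ∑[ i < B ] (∑[ x < B ] δ (τ i ℕ.+ τ (suc (i ℕ.+ (x ℕ.+ x)))) + ∑[ y < B ] δ (τ i ℕ.+ τ (suc (i ℕ.+ suc (y ℕ.+ y)))))
      ≈⟨ ∑-+ B _ _ ⟩
    ∑[ i < B ] ∑[ x < B ] δ (τ i ℕ.+ τ (suc (i ℕ.+ (x ℕ.+ x)))) + ∑[ i < B ] ∑[ y < B ] δ (τ i ℕ.+ τ (suc (i ℕ.+ suc (y ℕ.+ y))))
      ≈⟨ +-cong (∑-swap B B _) (∑-swap B B _) ⟩
    ∑[ x < B ] ∑[ i < B ] δ (τ i ℕ.+ τ (suc (i ℕ.+ (x ℕ.+ x)))) + ∑[ y < B ] ∑[ i < B ] δ (τ i ℕ.+ τ (suc (i ℕ.+ suc (y ℕ.+ y))))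
      ≈⟨ +-cong (∑-cong′ B λ x → ∑-cong′ B λ i → δ-cong (τ+τ i (suc (i ℕ.+ (x ℕ.+ x))) (x ℕ.* x ℕ.+ x ℕ.+ suc (x ℕ.+ i) ℕ.* suc (x ℕ.+ i)) (e₁ x i)))
                (∑-cong′ B λ y → ∑-cong′ B λ i → δ-cong (τ+τ i (suc (i ℕ.+ suc (y ℕ.+ y))) (suc (y ℕ.+ i) ℕ.* suc (y ℕ.+ i) ℕ.+ suc (y ℕ.+ i) ℕ.+ suc y ℕ.* suc y) (e₂ y i))) ⟩
    ∑[ x < B ] ∑[ w < B ] δ (x ℕ.* x ℕ.+ x ℕ.+ suc (x ℕ.+ w) ℕ.* suc (x ℕ.+ w))
      + ∑[ y < B ] ∑[ t < B ] δ (suc (y ℕ.+ t) ℕ.* suc (y ℕ.+ t) ℕ.+ suc (y ℕ.+ t) ℕ.+ suc y ℕ.* suc y)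
      ≈⟨ ∑-cases B _ (λ { x y (inj₁ p) → δ-≤ p (ℕₚ.≤-trans (ℕₚ.m≤n+m x (x ℕ.* x)) (ℕₚ.m≤m+n _ _))
                        ; x y (inj₂ p) → δ-≤ p (ℕₚ.≤-trans (ℕₚ.≤-trans (ℕₚ.n≤1+n y) (ℕₚ.m≤m*n (suc y) (suc y))) (ℕₚ.m≤n+m _ (x ℕ.* x ℕ.+ x))) }) ⟨
    ∑[ x < B ] ∑[ y < B ] δ (x ℕ.* x ℕ.+ x ℕ.+ suc y ℕ.* suc y) ∎
    where
    e₁ : ∀ x i → (i ℕ.* i ℕ.+ i) ℕ.+ (suc (i ℕ.+ (x ℕ.+ x)) ℕ.* suc (i ℕ.+ (x ℕ.+ x)) ℕ.+ suc (i ℕ.+ (x ℕ.+ x)))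
      ≡ (x ℕ.* x ℕ.+ x ℕ.+ suc (x ℕ.+ i) ℕ.* suc (x ℕ.+ i)) ℕ.+ (x ℕ.* x ℕ.+ x ℕ.+ suc (x ℕ.+ i) ℕ.* suc (x ℕ.+ i))
    e₁ = solve-∀
    e₂ : ∀ y i → (i ℕ.* i ℕ.+ i) ℕ.+ (suc (i ℕ.+ suc (y ℕ.+ y)) ℕ.* suc (i ℕ.+ suc (y ℕ.+ y)) ℕ.+ suc (i ℕ.+ suc (y ℕ.+ y)))
      ≡ (suc (y ℕ.+ i) ℕ.* suc (y ℕ.+ i) ℕ.+ suc (y ℕ.+ i) ℕ.+ suc y ℕ.* suc y)
        ℕ.+ (suc (y ℕ.+ i) ℕ.* suc (y ℕ.+ i) ℕ.+ suc (y ℕ.+ i) ℕ.+ suc y ℕ.* suc y)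
    e₂ = solve-∀

  -- Modulo 2 the pairs y ≠ z cancel against their mirror images, so the diagonal y = z may be
  -- replaced by the whole square. This brings in Zagier's three variables.
  square-to-product : ∑[ x < B ] ∑[ y < B ] δ (x ℕ.* x ℕ.+ x ℕ.+ suc y ℕ.* suc y)
    ≈ ∑[ x < B ] ∑[ y < B ] ∑[ z < B ] δ (x ℕ.* x ℕ.+ x ℕ.+ suc y ℕ.* suc z)
  square-to-product = ∑-cong′ B λ x → sym (∑-symmetric B _ λ y z _ _ →
    δ-cong (≡.cong (x ℕ.* x ℕ.+ x ℕ.+_) (ℕₚ.*-comm (suc y) (suc z))))

  -- Zagier's three regions for x² + x + (y+1)(z+1) = N: the maps between the outer two
  -- are mutually inverse, the middle one carries an involution, and the wall
  -- y = 2x + z + 1 is left over.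
  private
    middle middle-diagonal wall : Carrier
    middle = ∑[ z < B ] ∑[ x < B ] ∑[ w < suc (x ℕ.+ z) ] δ (form x w z)
    middle-diagonal = ∑[ x < B ] ∑[ d < B ] δ (form x x d)
    wall = ∑[ s < B ] ∑[ _ < s ] δ (s ℕ.* suc s)

    to-triangle : ∀ (f : ℕ → ℕ → Carrier) → (∀ x z → B ≤ x ℕ.+ z → f x z ≈ 0#) →
      ∑[ x < B ] ∑[ z < B ] f x z ≈ ∑[ k < B ] ∑[ x < suc k ] f x (k ∸ x)
    to-triangle f p = sym (begin
      ∑[ k < B ] ∑[ x < suc k ] f x (k ∸ x)           ≈⟨ ∑-triangle B _ ⟩
      ∑[ x < B ] ∑[ d < B ∸ x ] f x (x ℕ.+ d ∸ x)
        ≈⟨ ∑-cong′ B (λ x → ∑-cong′ (B ∸ x) (λ d → reflexive (≡.cong (f x) (ℕₚ.m+n∸m≡n x d)))) ⟩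
      ∑[ x < B ] ∑ (B ∸ x) (f x)
        ≈⟨ ∑-cong′ B (λ x → ∑-extend {B} {B ∸ x} _ (ℕₚ.m∸n≤m B x) (λ d q →
             p x d (ℕₚ.≤-trans (ℕₚ.m≤n+m∸n B x) (ℕₚ.+-monoʳ-≤ x q)))) ⟨
      ∑[ x < B ] ∑ B (f x)                            ∎)

    -- The region is w ≤ x + z. At fixed k = x + z, exchanging x and w preserves it and the value,
    -- and the fixed points are w = x.
    middle-involution : middle ≈ middle-diagonal
    middle-involution = begin
      middle
        ≈⟨ ∑-swap B B _ ⟩
      ∑[ x < B ] ∑[ z < B ] ∑[ w < suc (x ℕ.+ z) ] δ (form x w z)
        ≈⟨ to-triangle _ (λ x z p → ∑-0 (suc (x ℕ.+ z)) (λ w _ → δ-≤ p (x+z≤form x w z))) ⟩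
      ∑[ k < B ] ∑[ x < suc k ] ∑[ w < suc (x ℕ.+ (k ∸ x)) ] δ (form x w (k ∸ x))
        ≈⟨ ∑-cong′ B (λ k → trans (∑-cong (suc k) (λ { x (s≤s x≤k) → reflexive (≡.cong (λ n → ∑[ w < suc n ] δ (form x w (k ∸ x))) (ℕₚ.m+[n∸m]≡n x≤k)) }))
             (∑-symmetric (suc k) _ (λ { x w (s≤s x≤k) (s≤s w≤k) → δ-cong (form-exchange k x w x≤k w≤k) }))) ⟩
      ∑[ k < B ] ∑[ x < suc k ] δ (form x x (k ∸ x))
        ≈⟨ to-triangle _ (λ x z p → δ-≤ p (x+z≤form x x z)) ⟨
      middle-diagonal ∎

    -- The value depends only on s = x + z + 1, and each s arises from s pairs (x , z).
    wall-sum : ∑[ z < B ] ∑[ x < B ] δ (suc (x ℕ.+ z) ℕ.* suc (suc (x ℕ.+ z))) ≈ wall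
    wall-sum = begin
      ∑[ z < B ] ∑[ x < B ] δ (suc (x ℕ.+ z) ℕ.* suc (suc (x ℕ.+ z)))
        ≈⟨ ∑-swap B B _ ⟩
      ∑[ x < B ] ∑[ z < B ] δ (suc (x ℕ.+ z) ℕ.* suc (suc (x ℕ.+ z)))
        ≈⟨ to-triangle _ (λ x z p → δ-≤ p (ℕₚ.≤-trans (ℕₚ.n≤1+n _) (ℕₚ.m≤m*n (suc (x ℕ.+ z)) _))) ⟩
      ∑[ k < B ] ∑[ x < suc k ] δ (suc (x ℕ.+ (k ∸ x)) ℕ.* suc (suc (x ℕ.+ (k ∸ x))))
        ≈⟨ ∑-cong′ B (λ k → ∑-cong (suc k) (λ { x (s≤s x≤k) → δ-cong (≡.cong (λ n → suc n ℕ.* suc (suc n)) (ℕₚ.m+[n∸m]≡n x≤k)) })) ⟩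
      ∑[ k < B ] ∑[ _ < suc k ] δ (suc k ℕ.* suc (suc k))
        ≈⟨ +-identityˡ _ ⟨
      0# + ∑[ k < B ] ∑[ _ < suc k ] δ (suc k ℕ.* suc (suc k))
        ≈⟨ ∑-first B _ ⟨
      ∑[ s < suc B ] ∑[ _ < s ] δ (s ℕ.* suc s)
        ≈⟨ ∑-extend {suc B} {B} _ (ℕₚ.n≤1+n B) (λ s p → ∑-0 s (λ _ _ → δ-≤ p (ℕₚ.m≤m*n s (suc s)))) ⟩
      wall ∎

  zagier : ∑[ x < B ] ∑[ y < B ] ∑[ z < B ] δ (x ℕ.* x ℕ.+ x ℕ.+ suc y ℕ.* suc z) ≈ wall + middle-diagonal
  zagier = begin
    ∑[ x < B ] ∑[ y < B ] ∑[ z < B ] G x y z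
      ≈⟨ trans (∑-cong′ B (λ x → ∑-swap B B _)) (∑-swap B B _) ⟩
    ∑[ z < B ] ∑[ x < B ] ∑[ y < B ] G x y z
      ≈⟨ ∑-cong′ B (λ z → ∑-cases B (λ x y → G x y z)
           (λ { x y (inj₁ p) → δ-≤ p (ℕₚ.≤-trans (ℕₚ.m≤n+m x (x ℕ.* x)) (ℕₚ.m≤m+n _ _))
              ; x y (inj₂ p) → δ-≤ p (ℕₚ.≤-trans (ℕₚ.≤-trans (ℕₚ.n≤1+n y) (ℕₚ.m≤m*n (suc y) (suc z))) (ℕₚ.m≤n+m _ (x ℕ.* x ℕ.+ x))) })) ⟩
    ∑[ z < B ] (∑[ x < B ] ∑[ w < B ] δ (form x w z) + ∑[ y < B ] ∑[ t < B ] G (suc (y ℕ.+ t)) y z)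
      ≈⟨ ∑-+ B _ _ ⟩
    ∑[ z < B ] ∑[ x < B ] ∑[ w < B ] δ (form x w z) + ∑[ z < B ] ∑[ y < B ] ∑[ t < B ] G (suc (y ℕ.+ t)) y z
      ≈⟨ +-cong above below ⟩
    middle + (wall + Outer) + Outer
      ≈⟨ solve 3 (λ m w o → m :+ (w :+ o) :+ o := w :+ m :+ (o :+ o)) refl _ _ _ ⟩
    wall + middle + (Outer + Outer)
      ≈⟨ +-cong (+-congˡ middle-involution) (x+x≈0 Outer) ⟩
    wall + middle-diagonal + 0#
      ≈⟨ +-identityʳ _ ⟩
    wall + middle-diagonal ∎
    where
    G : ℕ → ℕ → ℕ → Carrier
    G x y z = δ (x ℕ.* x ℕ.+ x ℕ.+ suc y ℕ.* suc z)
    Outer = ∑[ z < B ] ∑[ x < B ] ∑[ t < B ] δ (outer z x t)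
    -- Each row is cut at w = x + z + 1: the middle region lies before it, the wall is that point,
    -- and an outer region follows.
    row : ∀ z x → ∑[ w < B ] δ (form x w z) ≈ ∑[ w < suc (x ℕ.+ z) ] δ (form x w z)
      + (δ (suc (x ℕ.+ z) ℕ.* suc (suc (x ℕ.+ z))) + ∑[ t < B ] δ (outer z x t))
    row z x = trans (∑-extend-shift (suc (x ℕ.+ z)) B _ (λ w p → δ-≤ p (w≤form x w z)))
      (+-congˡ (trans (∑-extend-shift 1 B _ (λ t p → δ-≤ p (ℕₚ.≤-trans (ℕₚ.m≤n+m t (suc (x ℕ.+ z))) (w≤form x _ z))))
        (+-cong (trans (+-identityˡ _) (δ-cong (form-wall x z))) (∑-cong′ B (λ t → δ-cong (form-outer x z t))))))
    above : ∑[ z < B ] ∑[ x < B ] ∑[ w < B ] δ (form x w z) ≈ middle + (wall + Outer)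
    above = begin
      ∑[ z < B ] ∑[ x < B ] ∑[ w < B ] δ (form x w z)
        ≈⟨ ∑-cong′ B (λ z → trans (∑-cong′ B (row z)) (trans (∑-+ B _ _) (+-congˡ (∑-+ B _ _)))) ⟩
      ∑[ z < B ] (∑[ x < B ] ∑[ w < suc (x ℕ.+ z) ] δ (form x w z)
        + (∑[ x < B ] δ (suc (x ℕ.+ z) ℕ.* suc (suc (x ℕ.+ z))) + ∑[ x < B ] ∑[ t < B ] δ (outer z x t)))
        ≈⟨ trans (∑-+ B _ _) (+-congˡ (∑-+ B _ _)) ⟩
      middle + (∑[ z < B ] ∑[ x < B ] δ (suc (x ℕ.+ z) ℕ.* suc (suc (x ℕ.+ z))) + Outer)
        ≈⟨ +-congˡ (+-congʳ wall-sum) ⟩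
      middle + (wall + Outer) ∎
    below : ∑[ z < B ] ∑[ y < B ] ∑[ t < B ] G (suc (y ℕ.+ t)) y z ≈ Outer
    below = begin
      ∑[ z < B ] ∑[ y < B ] ∑[ t < B ] G (suc (y ℕ.+ t)) y z
        ≈⟨ ∑-cong′ B (λ z → ∑-cong′ B (λ y → ∑-cong′ B (λ t → δ-cong (below-outer z y t)))) ⟩
      ∑[ z < B ] ∑[ y < B ] ∑[ t < B ] δ (outer y t z)
        ≈⟨ ∑-swap B B _ ⟩
      ∑[ y < B ] ∑[ z < B ] ∑[ t < B ] δ (outer y t z)
        ≈⟨ ∑-cong′ B (λ y → ∑-swap B B _) ⟩
      Outer ∎

  -- The last sum runs over factorisations: 4(x² + x + (2x+1)(d+1)) + 1 = (2x+1)(2x+1 + 4(d+1)).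
  pairs-mod2 : ∑[ j < B ] ∑[ i < j ] δ (τ i ℕ.+ τ j)
    ≈ ∑[ s < B ] ∑[ _ < s ] δ (s ℕ.* suc s) + ∑[ x < B ] ∑[ d < B ] δ (x ℕ.* x ℕ.+ x ℕ.+ suc (x ℕ.+ x) ℕ.* suc d)
  pairs-mod2 = trans triangular-pairs (trans square-to-product zagier)

-- Pentagonal numbers as thirds of triangular numbers

-- The pentagonal numbers r(3r+1)/2 and (r+1)(3r+2)/2.
ω ω′ : ℕ → ℕ
ω zero    = 0
ω (suc r) = ω r ℕ.+ (3 ℕ.* r ℕ.+ 2)
ω′ r = ω r ℕ.+ suc (r ℕ.+ r)

ω-double : ∀ r → ω r ℕ.+ ω r ≡ 3 ℕ.* (r ℕ.* r) ℕ.+ r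
ω-double zero    = ≡.refl
ω-double (suc r) = ≡.trans (e₁ (ω r) r) (≡.trans (≡.cong (ℕ._+ (2 ℕ.* (3 ℕ.* r ℕ.+ 2))) (ω-double r)) (e₂ r))
  where
  e₁ : ∀ w r → w ℕ.+ (3 ℕ.* r ℕ.+ 2) ℕ.+ (w ℕ.+ (3 ℕ.* r ℕ.+ 2)) ≡ w ℕ.+ w ℕ.+ (2 ℕ.* (3 ℕ.* r ℕ.+ 2))
  e₁ = solve-∀
  e₂ : ∀ r → 3 ℕ.* (r ℕ.* r) ℕ.+ r ℕ.+ (2 ℕ.* (3 ℕ.* r ℕ.+ 2)) ≡ 3 ℕ.* (suc r ℕ.* suc r) ℕ.+ suc r
  e₂ = solve-∀

ω′-double : ∀ r → ω′ r ℕ.+ ω′ r ≡ 3 ℕ.* (r ℕ.* r) ℕ.+ 5 ℕ.* r ℕ.+ 2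
ω′-double r = ≡.trans (e₁ (ω r) r) (≡.trans (≡.cong (ℕ._+ (2 ℕ.* suc (r ℕ.+ r))) (ω-double r)) (e₂ r))
  where
  e₁ : ∀ w r → w ℕ.+ suc (r ℕ.+ r) ℕ.+ (w ℕ.+ suc (r ℕ.+ r)) ≡ w ℕ.+ w ℕ.+ (2 ℕ.* suc (r ℕ.+ r))
  e₁ = solve-∀
  e₂ : ∀ r → 3 ℕ.* (r ℕ.* r) ℕ.+ r ℕ.+ (2 ℕ.* suc (r ℕ.+ r)) ≡ 3 ℕ.* (r ℕ.* r) ℕ.+ 5 ℕ.* r ℕ.+ 2
  e₂ = solve-∀

n≤ω : ∀ r → r ≤ ω r
n≤ω zero    = z≤n
n≤ω (suc r) = ℕₚ.≤-trans (ℕₚ.≤-trans (ℕₚ.m≤m+n (suc r) (2 ℕ.* r ℕ.+ 1)) (ℕₚ.≤-reflexive (e r))) (ℕₚ.m≤n+m _ (ω r))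
  where
  e : ∀ r → suc r ℕ.+ (2 ℕ.* r ℕ.+ 1) ≡ 3 ℕ.* r ℕ.+ 2
  e = solve-∀

-- Along the residues 0, 1, 2 modulo 3, τ is 3ω, 1 modulo 3, and 3ω′. Hence the triangular numbers
-- divisible by 3 are the tripled pentagonal numbers of both kinds.
τ-ω : ∀ r → τ (r ℕ.* 3) ≡ ω r ℕ.* 3
τ-ω zero    = ≡.refl
τ-ω (suc r) = ≡.trans (≡.cong (λ t → t ℕ.+ suc (r ℕ.* 3) ℕ.+ suc (suc (r ℕ.* 3)) ℕ.+ suc (suc (suc (r ℕ.* 3)))) (τ-ω r)) (e (ω r) r)
  where
  e : ∀ w r → w ℕ.* 3 ℕ.+ suc (r ℕ.* 3) ℕ.+ suc (suc (r ℕ.* 3)) ℕ.+ suc (suc (suc (r ℕ.* 3))) ≡ (w ℕ.+ (3 ℕ.* r ℕ.+ 2)) ℕ.* 3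
  e = solve-∀

τ-ω₁ : ∀ r → τ (1 ℕ.+ r ℕ.* 3) ≡ 1 ℕ.+ (ω r ℕ.+ r) ℕ.* 3
τ-ω₁ r = ≡.trans (≡.cong (ℕ._+ suc (r ℕ.* 3)) (τ-ω r)) (e (ω r) r)
  where
  e : ∀ w r → w ℕ.* 3 ℕ.+ suc (r ℕ.* 3) ≡ 1 ℕ.+ (w ℕ.+ r) ℕ.* 3
  e = solve-∀

τ-ω₂ : ∀ r → τ (2 ℕ.+ r ℕ.* 3) ≡ ω′ r ℕ.* 3
τ-ω₂ r = ≡.trans (≡.cong (ℕ._+ suc (suc (r ℕ.* 3))) (τ-ω₁ r)) (e (ω r) r)
  where
  e : ∀ w r → 1 ℕ.+ (w ℕ.+ r) ℕ.* 3 ℕ.+ suc (suc (r ℕ.* 3)) ≡ (w ℕ.+ suc (r ℕ.+ r)) ℕ.* 3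
  e = solve-∀

-- Modulo 2, the sum of W-term is (q²;q²)_∞ Σ_{k≥1} q^(k²) and the sum of G-term is (q²;q²)_∞ U F;
-- ε k stands for q^k, or for one of its coefficients.
module Terms {c ℓ} (R : CommutativeRing c ℓ) (ε : ℕ → CommutativeRing.Carrier R) (M : ℕ) where
  open CommutativeRing R
  open RingKit R

  cross : ℕ → ℕ → Carrier
  cross q r = ε (ω q ℕ.+ ω r) + ε (ω′ q ℕ.+ ω r) + ε (ω q ℕ.+ ω′ r) + ε (ω′ q ℕ.+ ω′ r)

  W-term : ℕ → Carrier
  W-term r = (∑[ _ < r ] (ε (ω r ℕ.+ ω r) + ε (ω′ r ℕ.+ ω′ r))) + ε (ω′ r ℕ.+ ω′ r) + ε (ω r ℕ.+ ω′ r) + (∑[ q < r ] cross q r)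

  G-term : ℕ → Carrier
  G-term r = ∑[ s < M ] ε (ω r ℕ.+ ω r ℕ.+ suc (6 ℕ.* r) ℕ.* suc s) + ∑[ s < M ] ε (ω′ r ℕ.+ ω′ r ℕ.+ (6 ℕ.* r ℕ.+ 5) ℕ.* s)

-- The count restricted to multiples of 3

module Thirds {c ℓ} (R : CommutativeRing c ℓ)
  (1+1≈0 : CommutativeRing._≈_ R (CommutativeRing._+_ R (CommutativeRing.1# R) (CommutativeRing.1# R)) (CommutativeRing.0# R))
  (δ : ℕ → CommutativeRing.Carrier R) (M : ℕ)
  (δ-big : ∀ k → M ℕ.* 3 ≤ k → CommutativeRing._≈_ R (δ k) (CommutativeRing.0# R))
  (δ-1 : ∀ m → CommutativeRing._≈_ R (δ (1 ℕ.+ m ℕ.* 3)) (CommutativeRing.0# R))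
  (δ-2 : ∀ m → CommutativeRing._≈_ R (δ (2 ℕ.+ m ℕ.* 3)) (CommutativeRing.0# R)) where

  open CommutativeRing R hiding (zero)
  open RingKit R
  open Char2 1+1≈0
  open Relation.Binary.Reasoning.Setoid setoid
  open Count R 1+1≈0 δ (M ℕ.* 3) δ-big using (pairs-mod2)

  ε : ℕ → Carrier
  ε m = δ (m ℕ.* 3)

  open Terms R ε M

  ε-big : ∀ m → M ≤ m → ε m ≈ 0#
  ε-big m p = δ-big _ (ℕₚ.*-monoˡ-≤ 3 p)

  private
    on : ∀ {k} m → k ≡ m ℕ.* 3 → δ k ≈ ε m
    on m p = reflexive (≡.cong δ p)

    off₁ : ∀ {k} m → k ≡ 1 ℕ.+ m ℕ.* 3 → δ k ≈ 0#
    off₁ m p = trans (reflexive (≡.cong δ p)) (δ-1 m)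

    off₂ : ∀ {k} m → k ≡ 2 ℕ.+ m ℕ.* 3 → δ k ≈ 0#
    off₂ m p = trans (reflexive (≡.cong δ p)) (δ-2 m)

    +3 : ∀ m n → m ℕ.* 3 ℕ.+ n ℕ.* 3 ≡ (m ℕ.+ n) ℕ.* 3
    +3 = solve-∀

    ∑-thirds₀₂ : ∀ n f → (∀ r → f (1 ℕ.+ r ℕ.* 3) ≈ 0#) → ∑ (n ℕ.* 3) f ≈ ∑[ r < n ] (f (r ℕ.* 3) + f (2 ℕ.+ r ℕ.* 3))
    ∑-thirds₀₂ n f p = trans (∑-thirds n f) (∑-cong′ n (λ r → +-congʳ (trans (+-congˡ (p r)) (+-identityʳ _))))

    ∑-thirds₂ : ∀ n f → (∀ r → f (r ℕ.* 3) ≈ 0#) → (∀ r → f (1 ℕ.+ r ℕ.* 3) ≈ 0#) →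
      ∑ (n ℕ.* 3) f ≈ ∑[ r < n ] f (2 ℕ.+ r ℕ.* 3)
    ∑-thirds₂ n f p q = trans (∑-thirds₀₂ n f q) (∑-cong′ n (λ r → trans (+-congʳ (p r)) (+-identityˡ _)))

  t : ℕ → ℕ → Carrier
  t i j = δ (τ i ℕ.+ τ j)

  t₀₀ : ∀ q r → t (q ℕ.* 3) (r ℕ.* 3) ≈ ε (ω q ℕ.+ ω r)
  t₀₀ q r = on (ω q ℕ.+ ω r) (≡.trans (≡.cong₂ ℕ._+_ (τ-ω q) (τ-ω r)) (+3 (ω q) (ω r)))

  t₀₂ : ∀ q r → t (q ℕ.* 3) (2 ℕ.+ r ℕ.* 3) ≈ ε (ω q ℕ.+ ω′ r)
  t₀₂ q r = on (ω q ℕ.+ ω′ r) (≡.trans (≡.cong₂ ℕ._+_ (τ-ω q) (τ-ω₂ r)) (+3 (ω q) (ω′ r)))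

  t₂₀ : ∀ q r → t (2 ℕ.+ q ℕ.* 3) (r ℕ.* 3) ≈ ε (ω′ q ℕ.+ ω r)
  t₂₀ q r = on (ω′ q ℕ.+ ω r) (≡.trans (≡.cong₂ ℕ._+_ (τ-ω₂ q) (τ-ω r)) (+3 (ω′ q) (ω r)))

  t₂₂ : ∀ q r → t (2 ℕ.+ q ℕ.* 3) (2 ℕ.+ r ℕ.* 3) ≈ ε (ω′ q ℕ.+ ω′ r)
  t₂₂ q r = on (ω′ q ℕ.+ ω′ r) (≡.trans (≡.cong₂ ℕ._+_ (τ-ω₂ q) (τ-ω₂ r)) (+3 (ω′ q) (ω′ r)))

  t₀₁ : ∀ q r → t (q ℕ.* 3) (1 ℕ.+ r ℕ.* 3) ≈ 0#
  t₀₁ q r = off₁ (ω q ℕ.+ (ω r ℕ.+ r)) (≡.trans (≡.cong₂ ℕ._+_ (τ-ω q) (τ-ω₁ r)) (e (ω q) (ω r ℕ.+ r)))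
    where
    e : ∀ m n → m ℕ.* 3 ℕ.+ (1 ℕ.+ n ℕ.* 3) ≡ 1 ℕ.+ (m ℕ.+ n) ℕ.* 3
    e = solve-∀

  t₂₁ : ∀ q r → t (2 ℕ.+ q ℕ.* 3) (1 ℕ.+ r ℕ.* 3) ≈ 0#
  t₂₁ q r = off₁ (ω′ q ℕ.+ (ω r ℕ.+ r)) (≡.trans (≡.cong₂ ℕ._+_ (τ-ω₂ q) (τ-ω₁ r)) (e (ω′ q) (ω r ℕ.+ r)))
    where
    e : ∀ m n → m ℕ.* 3 ℕ.+ (1 ℕ.+ n ℕ.* 3) ≡ 1 ℕ.+ (m ℕ.+ n) ℕ.* 3
    e = solve-∀

  t₁₁ : ∀ q r → t (1 ℕ.+ q ℕ.* 3) (1 ℕ.+ r ℕ.* 3) ≈ 0#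
  t₁₁ q r = off₂ ((ω q ℕ.+ q) ℕ.+ (ω r ℕ.+ r)) (≡.trans (≡.cong₂ ℕ._+_ (τ-ω₁ q) (τ-ω₁ r)) (e (ω q ℕ.+ q) (ω r ℕ.+ r)))
    where
    e : ∀ m n → (1 ℕ.+ m ℕ.* 3) ℕ.+ (1 ℕ.+ n ℕ.* 3) ≡ 2 ℕ.+ (m ℕ.+ n) ℕ.* 3
    e = solve-∀

  t-comm : ∀ i j → t i j ≈ t j i
  t-comm i j = reflexive (≡.cong δ (ℕₚ.+-comm (τ i) (τ j)))

  -- Modulo 3, τ takes only the values 0 and 1, so τ i + τ j is divisible by 3 only if neither index
  -- is 1 modulo 3. The extra term comes from i = 3r, j = 3r + 2.
  pairs : ∑[ j < M ℕ.* 3 ] ∑[ i < j ] t i j ≈ ∑[ r < M ] ((∑[ q < r ] cross q r) + ε (ω r ℕ.+ ω′ r))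
  pairs = begin
    ∑[ j < M ℕ.* 3 ] ∑[ i < j ] t i j
      ≈⟨ ∑-thirds₀₂ M _ (λ r → trans (+-congˡ (t₀₁ r r))
           (trans (+-congʳ (trans (∑-thirds r _) (∑-0 r (λ q _ →
             trans (+-cong (trans (+-cong (t₀₁ q r) (t₁₁ q r)) (+-identityˡ 0#)) (t₂₁ q r)) (+-identityˡ 0#))))) (+-identityˡ 0#))) ⟩
    ∑[ r < M ] ((∑[ i < r ℕ.* 3 ] t i (r ℕ.* 3))
      + ((∑[ i < r ℕ.* 3 ] t i (2 ℕ.+ r ℕ.* 3)) + t (r ℕ.* 3) (2 ℕ.+ r ℕ.* 3) + t (1 ℕ.+ r ℕ.* 3) (2 ℕ.+ r ℕ.* 3)))
      ≈⟨ ∑-cong′ M (λ r → +-cong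
           (trans (∑-thirds₀₂ r _ (λ q → trans (t-comm _ (r ℕ.* 3)) (t₀₁ r q))) (∑-cong′ r (λ q → +-cong (t₀₀ q r) (t₂₀ q r))))
           (+-cong (+-cong (trans (∑-thirds₀₂ r _ (λ q → trans (t-comm (1 ℕ.+ q ℕ.* 3) (2 ℕ.+ r ℕ.* 3)) (t₂₁ r q))) (∑-cong′ r (λ q → +-cong (t₀₂ q r) (t₂₂ q r))))
             (t₀₂ r r)) (trans (t-comm (1 ℕ.+ r ℕ.* 3) (2 ℕ.+ r ℕ.* 3)) (t₂₁ r r)))) ⟩
    ∑[ r < M ] ((∑[ q < r ] (ε (ω q ℕ.+ ω r) + ε (ω′ q ℕ.+ ω r)))
      + ((∑[ q < r ] (ε (ω q ℕ.+ ω′ r) + ε (ω′ q ℕ.+ ω′ r))) + ε (ω r ℕ.+ ω′ r) + 0#))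
      ≈⟨ ∑-cong′ M (λ r → trans
           (solve 3 (λ a b c → a :+ (b :+ c :+ :0) := (a :+ b) :+ c) refl _ _ _)
           (+-congʳ (trans (sym (∑-+ r _ _)) (∑-cong′ r (λ q → sym (+-assoc _ _ _)))))) ⟩
    ∑[ r < M ] ((∑[ q < r ] cross q r) + ε (ω r ℕ.+ ω′ r)) ∎

  ∑-const-3 : ∀ r c → ∑[ _ < r ℕ.* 3 ] c ≈ ∑[ _ < r ] c
  ∑-const-3 r c = trans (∑-thirds r _) (∑-cong′ r (λ _ → trans (+-congʳ (x+x≈0 c)) (+-identityˡ c)))

  -- Only s = 3r and s = 3r + 2 make s(s+1) divisible by 3, with quotients 2ω r and 2ω′ r; their
  -- multiplicities 3r and 3r + 2 have the parity of r.
  wall-thirds : ∑[ s < M ℕ.* 3 ] ∑[ _ < s ] δ (s ℕ.* suc s) ≈ ∑[ r < M ] ∑[ _ < r ] (ε (ω r ℕ.+ ω r) + ε (ω′ r ℕ.+ ω′ r))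
  wall-thirds = trans
    (∑-thirds₀₂ M _ (λ r → ∑-0 (1 ℕ.+ r ℕ.* 3) (λ _ _ → off₂ (3 ℕ.* (r ℕ.* r) ℕ.+ 3 ℕ.* r) (e₁ r))))
    (∑-cong′ M (λ r → trans (+-cong
        (trans (∑-const-3 r _) (∑-cong′ r (λ _ → on (ω r ℕ.+ ω r) (≡.trans (e₀ r) (≡.cong (ℕ._* 3) (≡.sym (ω-double r)))))))
        (trans (+-assoc _ _ _) (trans (+-congˡ (x+x≈0 _)) (trans (+-identityʳ _)
          (trans (∑-const-3 r _) (∑-cong′ r (λ _ → on (ω′ r ℕ.+ ω′ r) (≡.trans (e₂ r) (≡.cong (ℕ._* 3) (≡.sym (ω′-double r)))))))))))
      (sym (∑-+ r _ _))))
    where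
    e₀ : ∀ r → r ℕ.* 3 ℕ.* suc (r ℕ.* 3) ≡ (3 ℕ.* (r ℕ.* r) ℕ.+ r) ℕ.* 3
    e₀ = solve-∀
    e₁ : ∀ r → (1 ℕ.+ r ℕ.* 3) ℕ.* suc (1 ℕ.+ r ℕ.* 3) ≡ 2 ℕ.+ (3 ℕ.* (r ℕ.* r) ℕ.+ 3 ℕ.* r) ℕ.* 3
    e₁ = solve-∀
    e₂ : ∀ r → (2 ℕ.+ r ℕ.* 3) ℕ.* suc (2 ℕ.+ r ℕ.* 3) ≡ (3 ℕ.* (r ℕ.* r) ℕ.+ 5 ℕ.* r ℕ.+ 2) ℕ.* 3
    e₂ = solve-∀

  -- Divisibility by 3 excludes x ≡ 1 modulo 3, and for the other two residues of x it forces d ≡ 2.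
  diagonal-thirds : ∑[ x < M ℕ.* 3 ] ∑[ d < M ℕ.* 3 ] δ (x ℕ.* x ℕ.+ x ℕ.+ suc (x ℕ.+ x) ℕ.* suc d)
    ≈ ∑[ r < M ] (∑[ s < M ] ε (ω r ℕ.+ ω r ℕ.+ suc (6 ℕ.* r) ℕ.* suc s) + ∑[ s < M ] ε (ω′ r ℕ.+ ω′ r ℕ.+ (6 ℕ.* r ℕ.+ 5) ℕ.* suc s))
  diagonal-thirds = trans
    (∑-thirds₀₂ M _ (λ r → ∑-0 (M ℕ.* 3) (λ d _ → off₂ (3 ℕ.* (r ℕ.* r) ℕ.+ 3 ℕ.* r ℕ.+ suc (r ℕ.+ r) ℕ.* suc d) (e₁ r d))))
    (∑-cong′ M (λ r → +-cong
      (trans (∑-thirds₂ M _ (λ s → off₁ (3 ℕ.* (r ℕ.* r) ℕ.+ r ℕ.+ 2 ℕ.* r ℕ.+ suc (6 ℕ.* r) ℕ.* s) (e₀₀ r s)) (λ s → off₂ (3 ℕ.* (r ℕ.* r) ℕ.+ r ℕ.+ 4 ℕ.* r ℕ.+ suc (6 ℕ.* r) ℕ.* s) (e₀₁ r s)))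
        (∑-cong′ M (λ s → on (ω r ℕ.+ ω r ℕ.+ suc (6 ℕ.* r) ℕ.* suc s) (≡.trans (e₀₂ r s) (≡.cong (λ w → (w ℕ.+ suc (6 ℕ.* r) ℕ.* suc s) ℕ.* 3) (≡.sym (ω-double r)))))))
      (trans (∑-thirds₂ M _ (λ s → off₂ (3 ℕ.* (r ℕ.* r) ℕ.+ 5 ℕ.* r ℕ.+ 3 ℕ.+ 2 ℕ.* r ℕ.+ (6 ℕ.* r ℕ.+ 5) ℕ.* s) (e₂₀ r s)) (λ s → off₁ (3 ℕ.* (r ℕ.* r) ℕ.+ 5 ℕ.* r ℕ.+ 5 ℕ.+ 4 ℕ.* r ℕ.+ (6 ℕ.* r ℕ.+ 5) ℕ.* s) (e₂₁ r s)))
        (∑-cong′ M (λ s → on (ω′ r ℕ.+ ω′ r ℕ.+ (6 ℕ.* r ℕ.+ 5) ℕ.* suc s) (≡.trans (e₂₂ r s) (≡.cong (λ w → (w ℕ.+ (6 ℕ.* r ℕ.+ 5) ℕ.* suc s) ℕ.* 3) (≡.sym (ω′-double r)))))))))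
    where
    e₁ : ∀ r d → (1 ℕ.+ r ℕ.* 3) ℕ.* (1 ℕ.+ r ℕ.* 3) ℕ.+ (1 ℕ.+ r ℕ.* 3) ℕ.+ suc ((1 ℕ.+ r ℕ.* 3) ℕ.+ (1 ℕ.+ r ℕ.* 3)) ℕ.* suc d
      ≡ 2 ℕ.+ (3 ℕ.* (r ℕ.* r) ℕ.+ 3 ℕ.* r ℕ.+ suc (r ℕ.+ r) ℕ.* suc d) ℕ.* 3
    e₁ = solve-∀
    e₀₀ : ∀ r s → r ℕ.* 3 ℕ.* (r ℕ.* 3) ℕ.+ r ℕ.* 3 ℕ.+ suc (r ℕ.* 3 ℕ.+ r ℕ.* 3) ℕ.* suc (s ℕ.* 3)
      ≡ 1 ℕ.+ (3 ℕ.* (r ℕ.* r) ℕ.+ r ℕ.+ 2 ℕ.* r ℕ.+ suc (6 ℕ.* r) ℕ.* s) ℕ.* 3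
    e₀₀ = solve-∀
    e₀₁ : ∀ r s → r ℕ.* 3 ℕ.* (r ℕ.* 3) ℕ.+ r ℕ.* 3 ℕ.+ suc (r ℕ.* 3 ℕ.+ r ℕ.* 3) ℕ.* suc (1 ℕ.+ s ℕ.* 3)
      ≡ 2 ℕ.+ (3 ℕ.* (r ℕ.* r) ℕ.+ r ℕ.+ 4 ℕ.* r ℕ.+ suc (6 ℕ.* r) ℕ.* s) ℕ.* 3
    e₀₁ = solve-∀
    e₀₂ : ∀ r s → r ℕ.* 3 ℕ.* (r ℕ.* 3) ℕ.+ r ℕ.* 3 ℕ.+ suc (r ℕ.* 3 ℕ.+ r ℕ.* 3) ℕ.* suc (2 ℕ.+ s ℕ.* 3)
      ≡ (3 ℕ.* (r ℕ.* r) ℕ.+ r ℕ.+ suc (6 ℕ.* r) ℕ.* suc s) ℕ.* 3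
    e₀₂ = solve-∀
    e₂₀ : ∀ r s → (2 ℕ.+ r ℕ.* 3) ℕ.* (2 ℕ.+ r ℕ.* 3) ℕ.+ (2 ℕ.+ r ℕ.* 3) ℕ.+ suc ((2 ℕ.+ r ℕ.* 3) ℕ.+ (2 ℕ.+ r ℕ.* 3)) ℕ.* suc (s ℕ.* 3)
      ≡ 2 ℕ.+ (3 ℕ.* (r ℕ.* r) ℕ.+ 5 ℕ.* r ℕ.+ 3 ℕ.+ 2 ℕ.* r ℕ.+ (6 ℕ.* r ℕ.+ 5) ℕ.* s) ℕ.* 3
    e₂₀ = solve-∀
    e₂₁ : ∀ r s → (2 ℕ.+ r ℕ.* 3) ℕ.* (2 ℕ.+ r ℕ.* 3) ℕ.+ (2 ℕ.+ r ℕ.* 3) ℕ.+ suc ((2 ℕ.+ r ℕ.* 3) ℕ.+ (2 ℕ.+ r ℕ.* 3)) ℕ.* suc (1 ℕ.+ s ℕ.* 3)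
      ≡ 1 ℕ.+ (3 ℕ.* (r ℕ.* r) ℕ.+ 5 ℕ.* r ℕ.+ 5 ℕ.+ 4 ℕ.* r ℕ.+ (6 ℕ.* r ℕ.+ 5) ℕ.* s) ℕ.* 3
    e₂₁ = solve-∀
    e₂₂ : ∀ r s → (2 ℕ.+ r ℕ.* 3) ℕ.* (2 ℕ.+ r ℕ.* 3) ℕ.+ (2 ℕ.+ r ℕ.* 3) ℕ.+ suc ((2 ℕ.+ r ℕ.* 3) ℕ.+ (2 ℕ.+ r ℕ.* 3)) ℕ.* suc (2 ℕ.+ s ℕ.* 3)
      ≡ (3 ℕ.* (r ℕ.* r) ℕ.+ 5 ℕ.* r ℕ.+ 2 ℕ.+ (6 ℕ.* r ℕ.+ 5) ℕ.* suc s) ℕ.* 3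
    e₂₂ = solve-∀

  -- The count replaces the triangular pairs in W by wall plus factorisations, and the wall cancels
  -- the r-fold terms of W. The leftover ε(2ω′ r) supplies s = 0 in the second sum of `G-term`,
  -- since `diagonal` starts at `suc s`.
  W≈G : ∑ M W-term ≈ ∑ M G-term
  W≈G = begin
    ∑ M W-term
      ≈⟨ ∑-cong′ M (λ r → solve 4 (λ a b c d → a :+ b :+ c :+ d := a :+ (b :+ (d :+ c))) refl _ _ _ _) ⟩
    ∑[ r < M ] (wall r + (ε (ω′ r ℕ.+ ω′ r) + pair r))
      ≈⟨ trans (∑-+ M _ _) (+-congˡ (∑-+ M _ _)) ⟩
    ∑ M wall + (∑[ r < M ] ε (ω′ r ℕ.+ ω′ r) + ∑ M pair)
      ≈⟨ +-congˡ (+-congˡ (trans (sym pairs) (trans pairs-mod2 (+-cong wall-thirds diagonal-thirds)))) ⟩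
    ∑ M wall + (∑[ r < M ] ε (ω′ r ℕ.+ ω′ r) + (∑ M wall + ∑ M diagonal))
      ≈⟨ solve 3 (λ w e d → w :+ (e :+ (w :+ d)) := e :+ d :+ (w :+ w)) refl _ _ _ ⟩
    ∑[ r < M ] ε (ω′ r ℕ.+ ω′ r) + ∑ M diagonal + (∑ M wall + ∑ M wall)
      ≈⟨ trans (+-cong (sym (∑-+ M _ _)) (x+x≈0 _)) (+-identityʳ _) ⟩
    ∑[ r < M ] (ε (ω′ r ℕ.+ ω′ r) + diagonal r)
      ≈⟨ ∑-cong′ M (λ r → trans (solve 3 (λ a b c → a :+ (b :+ c) := b :+ (a :+ c)) refl _ _ _)
           (+-congˡ (sym (trans (∑-extend-shift 1 M _ (λ s p → ε-big _ (ℕₚ.≤-trans p (ℕₚ.≤-trans (ℕₚ.m≤n*m s (6 ℕ.* r ℕ.+ 5) ⦃ ℕ.>-nonZero (ℕₚ.<-≤-trans (s≤s z≤n) (ℕₚ.m≤n+m 5 (6 ℕ.* r))) ⦄) (ℕₚ.m≤n+m _ (ω′ r ℕ.+ ω′ r))))))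
             (+-congʳ (trans (+-identityˡ _) (reflexive (≡.cong ε (e (ω′ r) r))))))))) ⟩
    ∑ M G-term ∎
    where
    wall pair diagonal : ℕ → Carrier
    wall r = ∑[ _ < r ] (ε (ω r ℕ.+ ω r) + ε (ω′ r ℕ.+ ω′ r))
    pair r = (∑[ q < r ] cross q r) + ε (ω r ℕ.+ ω′ r)
    diagonal r = ∑[ s < M ] ε (ω r ℕ.+ ω r ℕ.+ suc (6 ℕ.* r) ℕ.* suc s) + ∑[ s < M ] ε (ω′ r ℕ.+ ω′ r ℕ.+ (6 ℕ.* r ℕ.+ 5) ℕ.* suc s)
    e : ∀ w r → w ℕ.+ w ℕ.+ (6 ℕ.* r ℕ.+ 5) ℕ.* 0 ≡ w ℕ.+ w
    e = solve-∀

  -- The operator U keeps one residue class of t in each geometric series: t ≡ 2 modulo 3 in the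
  -- first and t ≡ 0 in the second.
  G-thirds : ∀ r →
    ∑[ t < M ℕ.* 3 ] δ (1 ℕ.+ 6 ℕ.* (ω r ℕ.+ r) ℕ.+ t ℕ.* (1 ℕ.+ 6 ℕ.* r))
      + ∑[ t < M ℕ.* 3 ] δ (1 ℕ.+ 6 ℕ.* (ω r ℕ.+ r) ℕ.+ (5 ℕ.+ 6 ℕ.* r) ℕ.+ t ℕ.* (5 ℕ.+ 6 ℕ.* r))
    ≈ G-term r
  G-thirds r = +-cong
    (trans (∑-thirds₂ M _ (λ s → off₁ (2 ℕ.* (ω r ℕ.+ r) ℕ.+ s ℕ.* suc (6 ℕ.* r)) (x₀ (ω r) r s))
                          (λ s → off₂ (2 ℕ.* (ω r ℕ.+ r) ℕ.+ 2 ℕ.* r ℕ.+ s ℕ.* suc (6 ℕ.* r)) (x₁ (ω r) r s)))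
      (∑-cong′ M (λ s → on (ω r ℕ.+ ω r ℕ.+ suc (6 ℕ.* r) ℕ.* suc s) (x₂ (ω r) r s))))
    (trans (∑-thirds₀₂ M _ (λ s → off₂ (2 ℕ.* ω r ℕ.+ 6 ℕ.* r ℕ.+ 3 ℕ.+ s ℕ.* (6 ℕ.* r ℕ.+ 5)) (y₁ (ω r) r s)))
      (∑-cong′ M (λ s → trans (+-cong (on (ω′ r ℕ.+ ω′ r ℕ.+ (6 ℕ.* r ℕ.+ 5) ℕ.* s) (y₀ (ω r) r s))
          (off₁ (2 ℕ.* ω r ℕ.+ 8 ℕ.* r ℕ.+ 5 ℕ.+ s ℕ.* (6 ℕ.* r ℕ.+ 5)) (y₂ (ω r) r s))) (+-identityʳ _))))
    where
    x₀ : ∀ w r s → 1 ℕ.+ 6 ℕ.* (w ℕ.+ r) ℕ.+ s ℕ.* 3 ℕ.* (1 ℕ.+ 6 ℕ.* r) ≡ 1 ℕ.+ (2 ℕ.* (w ℕ.+ r) ℕ.+ s ℕ.* suc (6 ℕ.* r)) ℕ.* 3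
    x₀ = solve-∀
    x₁ : ∀ w r s → 1 ℕ.+ 6 ℕ.* (w ℕ.+ r) ℕ.+ (1 ℕ.+ s ℕ.* 3) ℕ.* (1 ℕ.+ 6 ℕ.* r) ≡ 2 ℕ.+ (2 ℕ.* (w ℕ.+ r) ℕ.+ 2 ℕ.* r ℕ.+ s ℕ.* suc (6 ℕ.* r)) ℕ.* 3
    x₁ = solve-∀
    x₂ : ∀ w r s → 1 ℕ.+ 6 ℕ.* (w ℕ.+ r) ℕ.+ (2 ℕ.+ s ℕ.* 3) ℕ.* (1 ℕ.+ 6 ℕ.* r) ≡ (w ℕ.+ w ℕ.+ suc (6 ℕ.* r) ℕ.* suc s) ℕ.* 3
    x₂ = solve-∀
    y₀ : ∀ w r s → 1 ℕ.+ 6 ℕ.* (w ℕ.+ r) ℕ.+ (5 ℕ.+ 6 ℕ.* r) ℕ.+ s ℕ.* 3 ℕ.* (5 ℕ.+ 6 ℕ.* r)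
      ≡ (w ℕ.+ suc (r ℕ.+ r) ℕ.+ (w ℕ.+ suc (r ℕ.+ r)) ℕ.+ (6 ℕ.* r ℕ.+ 5) ℕ.* s) ℕ.* 3
    y₀ = solve-∀
    y₁ : ∀ w r s → 1 ℕ.+ 6 ℕ.* (w ℕ.+ r) ℕ.+ (5 ℕ.+ 6 ℕ.* r) ℕ.+ (1 ℕ.+ s ℕ.* 3) ℕ.* (5 ℕ.+ 6 ℕ.* r)
      ≡ 2 ℕ.+ (2 ℕ.* w ℕ.+ 6 ℕ.* r ℕ.+ 3 ℕ.+ s ℕ.* (6 ℕ.* r ℕ.+ 5)) ℕ.* 3
    y₁ = solve-∀
    y₂ : ∀ w r s → 1 ℕ.+ 6 ℕ.* (w ℕ.+ r) ℕ.+ (5 ℕ.+ 6 ℕ.* r) ℕ.+ (2 ℕ.+ s ℕ.* 3) ℕ.* (5 ℕ.+ 6 ℕ.* r)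
      ≡ 1 ℕ.+ (2 ℕ.* w ℕ.+ 8 ℕ.* r ℕ.+ 5 ℕ.+ s ℕ.* (6 ℕ.* r ℕ.+ 5)) ℕ.* 3
    y₂ = solve-∀

  G-term-big : ∀ r → M ≤ r → G-term r ≈ 0#
  G-term-big r M≤r = trans (+-cong
    (∑-0 M (λ s _ → ε-big _ (ℕₚ.≤-trans M≤r (ℕₚ.≤-trans (n≤ω r) (ℕₚ.≤-trans (ℕₚ.m≤m+n (ω r) (ω r)) (ℕₚ.m≤m+n _ _))))))
    (∑-0 M (λ s _ → ε-big _ (ℕₚ.≤-trans M≤r (ℕₚ.≤-trans (n≤ω r) (ℕₚ.≤-trans (ℕₚ.m≤m+n (ω r) (suc (r ℕ.+ r))) (ℕₚ.≤-trans (ℕₚ.m≤m+n (ω′ r) (ω′ r)) (ℕₚ.m≤m+n _ _))))))))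
    (+-identityˡ 0#)

-- The pentagonal number theorem, modulo 4 and modulo 2

module Pentagonal {c ℓ} (R : CommutativeRing c ℓ) (e : ℕ → CommutativeRing.Carrier R)
  (e-0 : CommutativeRing._≈_ R (e 0) (CommutativeRing.1# R))
  (e-+ : ∀ m n → CommutativeRing._≈_ R (e (m ℕ.+ n)) (CommutativeRing._*_ R (e m) (e n)))
  (K : ℕ) (e-big : ∀ n → K < n → CommutativeRing._≈_ R (e n) (CommutativeRing.0# R)) where

  open CommutativeRing R hiding (zero)
  open RingKit R
  open QSeries R e e-0 e-+ K e-big
  open Relation.Binary.Reasoning.Setoid setoid

  sgn : ℕ → Carrier
  sgn zero    = 1#
  sgn (suc r) = - sgn r

  module _ (s : ℕ) (0<s : 0 < s) where
    open Base s 0<s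

    c′-ω : ∀ r → E (r ℕ.* r ℕ.+ r) * c′ r ≈ sgn r * E (ω r)
    c′-ω zero = *-comm _ _
    c′-ω (suc r) = begin
      E (suc r ℕ.* suc r ℕ.+ suc r) * (- (E r * c′ r))
        ≈⟨ *-congʳ (trans (reflexive (≡.cong E (e₁ r))) (E-+ _ _)) ⟩
      E (r ℕ.* r ℕ.+ r) * E (r ℕ.+ r ℕ.+ 2) * (- (E r * c′ r))
        ≈⟨ solve 4 (λ x y k c → x :* y :* (:- (k :* c)) := :- (x :* c :* (k :* y))) refl _ _ _ _ ⟩
      - (E (r ℕ.* r ℕ.+ r) * c′ r * (E r * E (r ℕ.+ r ℕ.+ 2)))
        ≈⟨ -‿cong (*-cong (c′-ω r) (sym (trans (reflexive (≡.cong E (e₂ r))) (E-+ _ _)))) ⟩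
      - (sgn r * E (ω r) * E (3 ℕ.* r ℕ.+ 2))
        ≈⟨ solve 3 (λ x y z → :- (x :* y :* z) := :- x :* (y :* z)) refl _ _ _ ⟩
      - sgn r * (E (ω r) * E (3 ℕ.* r ℕ.+ 2))
        ≈⟨ *-congˡ (sym (E-+ _ _)) ⟩
      - sgn r * E (ω (suc r)) ∎
      where
      e₁ : ∀ r → suc r ℕ.* suc r ℕ.+ suc r ≡ (r ℕ.* r ℕ.+ r) ℕ.+ (r ℕ.+ r ℕ.+ 2)
      e₁ = solve-∀
      e₂ : ∀ r → 3 ℕ.* r ℕ.+ 2 ≡ r ℕ.+ (r ℕ.+ r ℕ.+ 2)
      e₂ = solve-∀

    -- The factor 1 - Q^(2r+1) in `euler` splits each summand into a pair, as ω′ r = ω r + 2r + 1.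
    pentagonal-number-theorem : ∑[ r < N ] sgn r * (E (ω r) - E (ω′ r)) ≈ prod N
    pentagonal-number-theorem = trans (∑-cong′ N (λ r → begin
      sgn r * (E (ω r) - E (ω′ r))
        ≈⟨ *-congˡ (+-congˡ (-‿cong (E-+ _ _))) ⟩
      sgn r * (E (ω r) - E (ω r) * E (suc (r ℕ.+ r)))
        ≈⟨ solve 3 (λ s x y → s :* (x :- x :* y) := s :* x :* (:1 :- y)) refl _ _ _ ⟩
      sgn r * E (ω r) * (1# - E (suc (r ℕ.+ r)))
        ≈⟨ *-congʳ (c′-ω r) ⟨
      E (r ℕ.* r ℕ.+ r) * c′ r * (1# - E (suc (r ℕ.+ r)))
        ≈⟨ *-assoc _ _ _ ⟩
      E (r ℕ.* r ℕ.+ r) * β r ∎)) euler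

  module Mod4 (4≈0 : (1# + 1#) + (1# + 1#) ≈ 0#) where
    open Terms R e N
    module P₁ = Base 1 (s≤s z≤n)
    module P₂ = Base 2 (s≤s z≤n)

    private
      two : Carrier
      two = 1# + 1#

      -- The solver does not know that 4 = 0, so the multiple of 4 to be discarded is supplied as
      -- `z`.
      drop-4 : ∀ {x y} z → x ≈ y + (two + two) * z → x ≈ y
      drop-4 z p = trans p (trans (+-congˡ (trans (*-congʳ 4≈0) (zeroˡ z))) (+-identityʳ _))

      A B p : ℕ → Carrier
      A r = e (ω r)
      B r = e (ω′ r)
      p r = sgn r * (A r - B r)

      -- The integer r as a ring element. It enters through (-1)^r ≡ 1 + 2r modulo 4 and becomes the
      -- r-fold sums in `W-term`.
      κ : ℕ → Carrier
      κ r = ∑[ _ < r ] 1#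

      κ-* : ∀ r x → ∑[ _ < r ] x ≈ κ r * x
      κ-* r x = trans (∑-cong′ r (λ _ → sym (*-identityˡ x))) (∑-*ʳ r x _)

      sgn-κ : ∀ r → sgn r ≈ 1# + two * κ r
      sgn-κ zero = solve 0 (:1 := :1 :+ (:1 :+ :1) :* :0) refl
      sgn-κ (suc r) = trans (-‿cong (sgn-κ r)) (drop-4 (- (1# + κ r))
        (solve 1 (λ k → :- (:1 :+ (:1 :+ :1) :* k) := :1 :+ (:1 :+ :1) :* (k :+ :1) :+ (:1 :+ :1 :+ (:1 :+ :1)) :* (:- (:1 :+ k))) refl _))

      two-p : ∀ r → two * p r ≈ two * (A r + B r)
      two-p r = trans (*-congˡ (*-congʳ (sgn-κ r))) (drop-4 (κ r * (A r - B r) - B r)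
        (solve 3 (λ k a b → (:1 :+ :1) :* ((:1 :+ (:1 :+ :1) :* k) :* (a :- b))
          := (:1 :+ :1) :* (a :+ b) :+ (:1 :+ :1 :+ (:1 :+ :1)) :* (k :* (a :- b) :- b)) refl _ _ _))

      two-pp : ∀ q r → two * (p q * p r) ≈ two * cross q r
      two-pp q r = begin
        two * (p q * p r)                 ≈⟨ *-assoc _ _ _ ⟨
        two * p q * p r                   ≈⟨ *-congʳ (two-p q) ⟩
        two * (A q + B q) * p r           ≈⟨ solve 3 (λ t x y → t :* x :* y := x :* (t :* y)) refl _ _ _ ⟩
        (A q + B q) * (two * p r)         ≈⟨ *-congˡ (two-p r) ⟩
        (A q + B q) * (two * (A r + B r))
          ≈⟨ solve 5 (λ t a b c d → (a :+ b) :* (t :* (c :+ d)) := t :* (a :* c :+ b :* c :+ a :* d :+ b :* d)) refl _ _ _ _ _ ⟩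
        two * (A q * A r + B q * A r + A q * B r + B q * B r)
          ≈⟨ *-congˡ (+-cong (+-cong (+-cong (e-+ _ _) (e-+ _ _)) (e-+ _ _)) (e-+ _ _)) ⟨
        two * cross q r ∎

      own : ℕ → Carrier
      own r = (∑[ _ < r ] (e (ω r ℕ.+ ω r) + e (ω′ r ℕ.+ ω′ r))) + e (ω′ r ℕ.+ ω′ r) + e (ω r ℕ.+ ω′ r)

      -- Modulo 4, (1 + 2r)(a² - b²) - (a - b)² ≡ 2(r(a² + b²) + b² + ab), whose bracket is `own r`.
      square-term : ∀ r → sgn r * (P₂.E (ω r) - P₂.E (ω′ r)) ≈ p r * p r + two * own r
      square-term r = begin
        sgn r * (P₂.E (ω r) - P₂.E (ω′ r))
          ≈⟨ *-cong (sgn-κ r) (+-cong (sq (ω r)) (-‿cong (sq (ω′ r)))) ⟩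
        (1# + two * κ r) * (A r * A r - B r * B r)
          ≈⟨ drop-4 (- (κ r * (B r * B r)) - B r * B r - (κ r + κ r * κ r) * ((A r - B r) * (A r - B r))) (solve 3 (λ k a b →
               (:1 :+ (:1 :+ :1) :* k) :* (a :* a :- b :* b)
               := (:1 :+ (:1 :+ :1) :* k) :* (a :- b) :* ((:1 :+ (:1 :+ :1) :* k) :* (a :- b))
                 :+ (:1 :+ :1) :* (k :* (a :* a :+ b :* b) :+ b :* b :+ a :* b)
                 :+ (:1 :+ :1 :+ (:1 :+ :1)) :* (:- (k :* (b :* b)) :- b :* b :- (k :+ k :* k) :* ((a :- b) :* (a :- b)))) refl _ _ _) ⟩
        (1# + two * κ r) * (A r - B r) * ((1# + two * κ r) * (A r - B r))
          + two * (κ r * (A r * A r + B r * B r) + B r * B r + A r * B r)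
          ≈⟨ +-cong (*-cong (*-congʳ (sgn-κ r)) (*-congʳ (sgn-κ r)))
               (*-congˡ (+-cong (+-cong (trans (κ-* r _) (*-congˡ (+-cong (e-+ _ _) (e-+ _ _)))) (e-+ _ _)) (e-+ _ _))) ⟨
        p r * p r + two * own r ∎
        where
        sq : ∀ k → P₂.E k ≈ e k * e k
        sq k = trans (e-cong (≡.cong (k ℕ.+_) (ℕₚ.+-identityʳ k))) (e-+ k k)

    W : Carrier
    W = ∑ N W-term

    -- Both products are expanded by the pentagonal number theorem. The diagonal of the square
    -- differs from the series in q² by 2 `own`; the off-diagonal part is already doubled, so its
    -- signs do not matter modulo 4.
    prod-W : P₂.prod N ≈ P₁.prod N * P₁.prod N + two * W
    prod-W = begin
      P₂.prod N
        ≈⟨ pentagonal-number-theorem 2 (s≤s z≤n) ⟨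
      ∑[ r < N ] sgn r * (P₂.E (ω r) - P₂.E (ω′ r))
        ≈⟨ trans (∑-cong′ N square-term) (trans (∑-+ N _ _) (+-congˡ (∑-*ˡ N _ _))) ⟩
      ∑[ r < N ] p r * p r + two * ∑ N own
        -- The added 2X + 2X vanishes: one copy completes the square, the other completes `W`.
        ≈⟨ sym (drop-4 X (solve 3 (λ s o x → s :+ (:1 :+ :1) :* x :+ (:1 :+ :1) :* (o :+ x)
             := s :+ (:1 :+ :1) :* o :+ (:1 :+ :1 :+ (:1 :+ :1)) :* x) refl _ _ _)) ⟩
      ∑[ r < N ] p r * p r + two * X + two * (∑ N own + X)
        ≈⟨ +-cong (+-congˡ two-X) (*-congˡ (sym (∑-+ N _ _))) ⟩
      ∑[ r < N ] p r * p r + two * (∑[ r < N ] ∑[ q < r ] p q * p r) + two * W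
        ≈⟨ +-congʳ (∑-square N p) ⟨
      ∑ N p * ∑ N p + two * W
        ≈⟨ +-congʳ (*-cong P P) ⟩
      P₁.prod N * P₁.prod N + two * W ∎
      where
      X = ∑[ r < N ] ∑[ q < r ] cross q r
      E₁ : ∀ k → e k ≈ P₁.E k
      E₁ k = e-cong (≡.sym (ℕₚ.+-identityʳ k))
      P : ∑ N p ≈ P₁.prod N
      P = trans (∑-cong′ N (λ r → *-congˡ (+-cong (E₁ (ω r)) (-‿cong (E₁ (ω′ r)))))) (pentagonal-number-theorem 1 (s≤s z≤n))
      two-X : two * X ≈ two * (∑[ r < N ] ∑[ q < r ] p q * p r)
      two-X = begin
        two * X                                         ≈⟨ ∑-*ˡ N _ _ ⟨
        ∑[ r < N ] two * (∑[ q < r ] cross q r)         ≈⟨ ∑-cong′ N (λ r → trans (sym (∑-*ˡ r _ _))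
          (trans (∑-cong′ r (λ q → sym (two-pp q r))) (∑-*ˡ r _ _))) ⟩
        ∑[ r < N ] two * (∑[ q < r ] p q * p r)         ≈⟨ ∑-*ˡ N _ _ ⟩
        two * (∑[ r < N ] ∑[ q < r ] p q * p r)         ∎

    T : ℕ → Carrier
    T n = ∑[ i < n ] ∑[ t < N ] e (suc t ℕ.* suc i)

    -- 1 - x² = (1 - x)² (1 + 2x/(1 - x)), and the factors 1 + 2(…) multiply additively modulo 4.
    prod-T : ∀ n → P₂.prod n ≈ P₁.prod n * P₁.prod n * (1# + two * T n)
    prod-T zero = solve 0 (:1 := :1 :* :1 :* (:1 :+ (:1 :+ :1) :* :0)) refl
    prod-T (suc n) = begin
      P₂.prod n * (1# - P₂.E (suc n))
        ≈⟨ *-cong (prod-T n) (+-congˡ (-‿cong (trans (e-cong (≡.cong (suc n ℕ.+_) (ℕₚ.+-identityʳ (suc n)))) (e-+ (suc n) (suc n))))) ⟩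
      P * P * (1# + two * T n) * (1# - x * x)
        ≈⟨ drop-4 (P * P * (1# - x) * x * T n) (solve 3 (λ P T x →
             P :* P :* (:1 :+ (:1 :+ :1) :* T) :* (:1 :- x :* x)
             := P :* (:1 :- x) :* P :* ((:1 :- x) :* (:1 :+ (:1 :+ :1) :* T) :+ (:1 :+ :1) :* x :* :1)
               :+ (:1 :+ :1 :+ (:1 :+ :1)) :* (P :* P :* (:1 :- x) :* x :* T)) refl P (T n) x) ⟩
      P * (1# - x) * P * ((1# - x) * (1# + two * T n) + two * x * 1#)
        ≈⟨ *-congˡ (+-congˡ (*-congˡ (sym (geom-inverse (suc n) (s≤s z≤n))))) ⟩
      P * (1# - x) * P * ((1# - x) * (1# + two * T n) + two * x * ((1# - x) * geom (suc n)))
        ≈⟨ solve 4 (λ P T x g → P :* (:1 :- x) :* P :* ((:1 :- x) :* (:1 :+ (:1 :+ :1) :* T) :+ (:1 :+ :1) :* x :* ((:1 :- x) :* g))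
             := P :* (:1 :- x) :* (P :* (:1 :- x)) :* (:1 :+ (:1 :+ :1) :* (T :+ x :* g))) refl P (T n) x (geom (suc n)) ⟩
      P * (1# - x) * (P * (1# - x)) * (1# + two * (T n + x * geom (suc n)))
        ≈⟨ *-cong (*-cong (*-congˡ xE) (*-congˡ xE)) (+-congˡ (*-congˡ (+-congˡ (trans (sym (∑-*ˡ N _ _)) (∑-cong′ N (λ t → sym (e-+ _ _))))))) ⟩
      P₁.prod (suc n) * P₁.prod (suc n) * (1# + two * T (suc n)) ∎
      where
      P = P₁.prod n
      x = e (suc n)
      xE : 1# - x ≈ 1# - P₁.E (suc n)
      xE = +-congˡ (-‿cong (e-cong (≡.sym (ℕₚ.+-identityʳ (suc n)))))

    -- Two evaluations of (q²;q²)_∞ - (q;q)_∞² are compared. The factor 2 stays, because 2 is a zero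
    -- divisor here; it is removed on integer coefficients later.
    two-W : two * (P₁.prod N * P₁.prod N * T N) ≈ two * W
    two-W = begin
      two * (P * T N)
        ≈⟨ solve 2 (λ p t → (:1 :+ :1) :* (p :* t) := p :* (:1 :+ (:1 :+ :1) :* t) :- p) refl _ _ ⟩
      P * (1# + two * T N) - P     ≈⟨ +-congʳ (prod-T N) ⟨
      P₂.prod N - P                ≈⟨ +-congʳ prod-W ⟩
      P + two * W - P              ≈⟨ solve 2 (λ p w → p :+ (:1 :+ :1) :* w :- p := (:1 :+ :1) :* w) refl _ _ ⟩
      two * W                      ∎
      where P = P₁.prod N * P₁.prod N

  module Mod2 (1+1≈0 : 1# + 1# ≈ 0#) where
    open Char2 1+1≈0
    module P₆ = Base 6 (s≤s z≤n)
    open P₆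
    module U₆ = Universal 1 5 (s≤s z≤n) (s≤s z≤n) ≡.refl
    open U₆

    sgn≈1 : ∀ r → sgn r ≈ 1#
    sgn≈1 zero    = refl
    sgn≈1 (suc r) = trans (-x≈x _) (sgn≈1 r)

    F : Carrier
    F = ∑[ L < N ] e 1 * (E (L ℕ.* L ℕ.+ L) * B L)

    -- The series qQ^(ω r + r)/(1 - qQ^r) and qQ^(ω r + r) q⁵Q^r/(1 - q⁵Q^r), written out so that U
    -- can act on single exponents.
    G₆ : ℕ → Carrier
    G₆ r = ∑[ t < N ] e (1 ℕ.+ 6 ℕ.* (ω r ℕ.+ r) ℕ.+ t ℕ.* (1 ℕ.+ 6 ℕ.* r))
      + ∑[ t < N ] e (1 ℕ.+ 6 ℕ.* (ω r ℕ.+ r) ℕ.+ (5 ℕ.+ 6 ℕ.* r) ℕ.+ t ℕ.* (5 ℕ.+ 6 ℕ.* r))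

    -- The summand splits because (1 - XY)/((1 - X)(1 - Y)) = 1/(1 - X) + Y/(1 - Y).
    α-term : ∀ r → e 1 * (E (r ℕ.* r ℕ.+ r) * α r) ≈ G₆ r
    α-term r = begin
      e 1 * (E (r ℕ.* r ℕ.+ r) * (c′ r * (1# - E (suc (r ℕ.+ r))) * (E r * (gx r * gy r))))
        ≈⟨ solve 6 (λ q m c x k g → q :* (m :* (c :* x :* (k :* g))) := q :* (m :* c :* k) :* (x :* g)) refl _ _ _ _ _ _ ⟩
      e 1 * (E (r ℕ.* r ℕ.+ r) * c′ r * E r) * ((1# - E (suc (r ℕ.+ r))) * (gx r * gy r))
        ≈⟨ *-cong (*-congˡ (trans (*-congʳ (trans (c′-ω 6 (s≤s z≤n) r) (trans (*-congʳ (sgn≈1 r)) (*-identityˡ _)))) (sym (E-+ (ω r) r))))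
             (trans (*-congʳ (+-congˡ (-‿cong XY)))
               (trans (solve 4 (λ x y g h → (:1 :- x :* y) :* (g :* h) := ((:1 :- y) :* h) :* g :+ y :* h :* ((:1 :- x) :* g)) refl X Y (gx r) (gy r))
                 (+-cong (trans (*-congʳ (gy-inverse r)) (*-identityˡ _)) (trans (*-congˡ (gx-inverse r)) (*-identityʳ _))))) ⟩
      e 1 * E (ω r ℕ.+ r) * (gx r + Y * gy r)
        ≈⟨ solve 5 (λ q m g y h → q :* m :* (g :+ y :* h) := q :* m :* g :+ q :* m :* y :* h) refl _ _ _ _ _ ⟩
      e 1 * E (ω r ℕ.+ r) * gx r + e 1 * E (ω r ℕ.+ r) * Y * gy r
        ≈⟨ +-cong (*-congʳ (e-+ _ _)) (*-congʳ (trans (e-+ _ _) (*-cong (e-+ _ _) (e-+ _ _)))) ⟨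
      e (1 ℕ.+ 6 ℕ.* (ω r ℕ.+ r)) * gx r + e (1 ℕ.+ 6 ℕ.* (ω r ℕ.+ r) ℕ.+ (5 ℕ.+ 6 ℕ.* r)) * gy r
        ≈⟨ +-cong (trans (sym (∑-*ˡ N _ _)) (∑-cong′ N (λ t → sym (e-+ _ _)))) (trans (sym (∑-*ˡ N _ _)) (∑-cong′ N (λ t → sym (e-+ _ _)))) ⟩
      G₆ r ∎
      where
      X = e 1 * E r
      Y = e 5 * E r
      e₁ : ∀ r → suc (r ℕ.+ r) ≡ r ℕ.+ (r ℕ.+ 1)
      e₁ = solve-∀
      XY : E (suc (r ℕ.+ r)) ≈ X * Y
      XY = trans (E-expand (r ∷ r ∷ 1 ∷ []) (e₁ r)) (trans (*-congˡ (*-congˡ (*-congʳ E1)))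
        (solve 3 (λ k x y → k :* (k :* (x :* y :* :1)) := x :* k :* (y :* k)) refl _ _ _))

    prod-F : prod N * F ≈ ∑ N G₆
    prod-F = begin
      prod N * F
        ≈⟨ *-congˡ (∑-*ˡ N _ _) ⟩
      prod N * (e 1 * (∑[ L < N ] E (L ℕ.* L ℕ.+ L) * B L))
        ≈⟨ solve 3 (λ x y z → x :* (y :* z) := y :* (x :* z)) refl _ _ _ ⟩
      e 1 * (prod N * (∑[ L < N ] E (L ℕ.* L ℕ.+ L) * B L))
        ≈⟨ *-congˡ universal ⟩
      e 1 * (∑[ r < N ] E (r ℕ.* r ℕ.+ r) * α r)
        ≈⟨ trans (sym (∑-*ˡ N _ _)) (∑-cong′ N α-term) ⟩
      ∑ N G₆ ∎

-- Extraction of every third coefficient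

halve : ∀ x y → x ℤ.+ x ≡ y ℤ.+ y [mod 4 ] → x ≡ y [mod 2 ]
halve x y (congruent (divides q p)) = congruent (divides q (ℤₚ.*-cancelʳ-≡ _ _ (+ 2) (≡.trans (e₁ x y) (≡.trans p (e₂ q)))))
  where
  open ℤ-Solver.+-*-Solver
  e₁ : ∀ x y → (x ℤ.- y) ℤ.* + 2 ≡ (x ℤ.+ x) ℤ.- (y ℤ.+ y)
  e₁ = solve 2 (λ x y → (x :- y) :* con (+ 2) := (x :+ x) :- (y :+ y)) ≡.refl
  e₂ : ∀ q → q ℤ.* + 4 ≡ q ℤ.* + 2 ℤ.* + 2
  e₂ = solve 1 (λ q → q :* con (+ 4) := q :* con (+ 2) :* con (+ 2)) ≡.refl

mod4⇒mod2 : ∀ {x y} → x ≡ y [mod 4 ] → x ≡ y [mod 2 ]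
mod4⇒mod2 (congruent p) = congruent (ℤ∣.∣-trans (divides (+ 2) ≡.refl) p)

mono-scale : ∀ m j → mono (m ℕ.* 3) (j ℕ.* 3) ≡ mono m j
mono-scale zero    zero    = ≡.refl
mono-scale zero    (suc j) = ≡.refl
mono-scale (suc m) zero    = ≡.refl
mono-scale (suc m) (suc j) = ≡.trans (mono-suc (2 ℕ.+ m ℕ.* 3) (2 ℕ.+ j ℕ.* 3))
  (≡.trans (mono-suc (1 ℕ.+ m ℕ.* 3) (1 ℕ.+ j ℕ.* 3)) (≡.trans (mono-suc (m ℕ.* 3) (j ℕ.* 3))
    (≡.trans (mono-scale m j) (≡.sym (mono-suc m j)))))

mono-1-mod-3 : ∀ m j → mono (1 ℕ.+ m ℕ.* 3) (j ℕ.* 3) ≡ + 0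
mono-1-mod-3 m       zero    = ≡.refl
mono-1-mod-3 zero    (suc j) = ≡.refl
mono-1-mod-3 (suc m) (suc j) = ≡.trans (mono-suc (3 ℕ.+ m ℕ.* 3) (2 ℕ.+ j ℕ.* 3))
  (≡.trans (mono-suc (2 ℕ.+ m ℕ.* 3) (1 ℕ.+ j ℕ.* 3)) (≡.trans (mono-suc (1 ℕ.+ m ℕ.* 3) (j ℕ.* 3)) (mono-1-mod-3 m j)))

mono-2-mod-3 : ∀ m j → mono (2 ℕ.+ m ℕ.* 3) (j ℕ.* 3) ≡ + 0
mono-2-mod-3 m       zero    = ≡.refl
mono-2-mod-3 zero    (suc j) = ≡.refl
mono-2-mod-3 (suc m) (suc j) = ≡.trans (mono-suc (4 ℕ.+ m ℕ.* 3) (2 ℕ.+ j ℕ.* 3))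
  (≡.trans (mono-suc (3 ℕ.+ m ℕ.* 3) (1 ℕ.+ j ℕ.* 3)) (≡.trans (mono-suc (2 ℕ.+ m ℕ.* 3) (j ℕ.* 3)) (mono-2-mod-3 m j)))

U : Series → Series
U f j = f (j ℕ.* 3)

U-shift : ∀ k f j → shift (k ℕ.* 3) f (j ℕ.* 3) ≡ shift k (U f) j
U-shift zero    f j       = ≡.refl
U-shift (suc k) f zero    = ≡.refl
U-shift (suc k) f (suc j) = ≡.trans (shift-suc (2 ℕ.+ k ℕ.* 3) f (2 ℕ.+ j ℕ.* 3))
  (≡.trans (shift-suc (1 ℕ.+ k ℕ.* 3) f (1 ℕ.+ j ℕ.* 3)) (≡.trans (shift-suc (k ℕ.* 3) f (j ℕ.* 3))
    (≡.trans (U-shift k f j) (≡.sym (shift-suc k (U f) j)))))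

sumTo-∑ : ∀ m n f → sumTo n f ≡ RingKit.∑ (ℤ/ m) n f
sumTo-∑ m zero    f = ≡.refl
sumTo-∑ m (suc n) f = ≡.cong (ℤ._+ f n) (sumTo-∑ m n f)

∑-coeff : ∀ m K m′ n f j → RingKit.∑ (Truncated.series m K) n f j ≡ RingKit.∑ (ℤ/ m′) n (λ i → f i j)
∑-coeff m K m′ zero    f j = ≡.refl
∑-coeff m K m′ (suc n) f j = ≡.cong (ℤ._+ f n j) (∑-coeff m K m′ n f j)

1+1≈0[2] : + 1 ℤ.+ + 1 ≡ + 0 [mod 2 ]
1+1≈0[2] = congruent (divides (+ 1) ≡.refl)

series-1+1≈0 : ∀ K → Truncated._≃_ 2 K (one ⊕ one) zeros
series-1+1≈0 K = Truncated.coeffs λ { zero _ → 1+1≈0[2] ; (suc j) _ → ≡⇒≡mod ≡.refl }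

series-4≈0 : ∀ K → Truncated._≃_ 4 K ((one ⊕ one) ⊕ (one ⊕ one)) zeros
series-4≈0 K = Truncated.coeffs λ { zero _ → congruent (divides (+ 1) ≡.refl) ; (suc j) _ → ≡⇒≡mod ≡.refl }

module Dissection (n : ℕ) where
  -- F is needed up to q^(3n) and U F up to q^n. The three rings below share the carrier `Series`,
  -- so a series moves between moduli and precisions unchanged.
  K : ℕ
  K = n ℕ.* 3

  module S₂ = Truncated 2 n
  module S₄ = Truncated 4 n
  module S₆ = Truncated 2 K
  module R₂ = CommutativeRing S₂.series
  module R₄ = CommutativeRing S₄.series
  module R₆ = CommutativeRing S₆.series
  module Z₂ = CommutativeRing (ℤ/ 2)
  module Σ₂ = RingKit (ℤ/ 2)
  module Q₄ = Pentagonal S₄.series mono S₄.mono-0 S₄.mono-+ n S₄.mono-big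
  module M₄ = Q₄.Mod4 (series-4≈0 n)
  module Q₆ = Pentagonal S₆.series mono S₆.mono-0 S₆.mono-+ K S₆.mono-big
  module M₆ = Q₆.Mod2 (series-1+1≈0 K)
  module P₂ = M₄.P₂
  module P₆ = M₆.P₆

  M : ℕ
  M = suc n

  reduce : ∀ {f g} → f S₄.≃ g → f S₂.≃ g
  reduce p = S₂.coeffs λ j j≤n → mod4⇒mod2 (S₄.coeff p j j≤n)

  U-cong : ∀ {f g} → f S₆.≃ g → U f S₂.≃ U g
  U-cong p = S₂.coeffs λ j j≤n → S₆.coeff p (j ℕ.* 3) (ℕₚ.*-monoˡ-≤ 3 j≤n)

  U-factor : ∀ k g → U ((one R₆.- mono (k ℕ.* 3)) ⊛ g) S₂.≃ (one R₂.- mono k) ⊛ U g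
  U-factor k g = R₂.trans (U-cong (S.solve 2 (λ x g → (S.:1 S.:- x) S.:* g S.:= g S.:- x S.:* g) R₆.refl (mono (k ℕ.* 3)) g))
    (R₂.trans (S₂.≗⇒≃ (λ j → ≡.cong (λ x → g (j ℕ.* 3) ℤ.- x)
      (≡.trans (⊛-mono (k ℕ.* 3) g (j ℕ.* 3)) (≡.trans (U-shift k g j) (≡.sym (⊛-mono k (U g) j))))))
      (R₂.sym (S′.solve 2 (λ x g → (S′.:1 S′.:- x) S′.:* g S′.:= g S′.:- x S′.:* g) R₂.refl (mono k) (U g))))
    where
    module S = RingKit S₆.series
    module S′ = RingKit S₂.series

  -- Each factor 1 - q^(6i) is a series in q³, so it passes through U and becomes 1 - q^(2i).
  U-prod : ∀ i g → U (P₆.prod i ⊛ g) S₂.≃ P₂.prod i ⊛ U g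
  U-prod zero g = R₂.trans (U-cong (R₆.*-identityˡ g)) (R₂.sym (R₂.*-identityˡ (U g)))
  U-prod (suc i) g = begin
    U ((P₆.prod i ⊛ f₆) ⊛ g)       ≈⟨ U-cong (R₆.*-assoc (P₆.prod i) f₆ g) ⟩
    U (P₆.prod i ⊛ (f₆ ⊛ g))     ≈⟨ U-prod i (f₆ ⊛ g) ⟩
    P₂.prod i ⊛ U (f₆ ⊛ g)
      ≡⟨ ≡.cong (λ k → P₂.prod i ⊛ U ((one R₆.- mono k) ⊛ g)) (e i) ⟩
    P₂.prod i ⊛ U ((one R₆.- mono (2 ℕ.* suc i ℕ.* 3)) ⊛ g)
      ≈⟨ R₂.*-congˡ {P₂.prod i} (U-factor (2 ℕ.* suc i) g) ⟩
    P₂.prod i ⊛ (f₂ ⊛ U g)       ≈⟨ R₂.*-assoc (P₂.prod i) f₂ (U g) ⟨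
    (P₂.prod i ⊛ f₂) ⊛ U g       ∎
    where
    open Relation.Binary.Reasoning.Setoid R₂.setoid
    f₆ = one R₆.- P₆.E (suc i)
    f₂ = one R₂.- P₂.E (suc i)
    e : ∀ i → 6 ℕ.* suc i ≡ 2 ℕ.* suc i ℕ.* 3
    e = solve-∀

  module _ (j : ℕ) (j≤n : j ≤ n) where
    δ : ℕ → ℤ
    δ k = mono k (j ℕ.* 3)

    δ-big : ∀ k → suc (n ℕ.* 3) ≤ k → δ k Z₂.≈ + 0
    δ-big k p = ≡⇒≡mod (mono-off k (j ℕ.* 3) (λ { ≡.refl → ℕₚ.<⇒≱ p (ℕₚ.*-monoˡ-≤ 3 j≤n) }))

    -- The bound must be a multiple of 3 to be cut into thirds; `M * 3` exceeds 3n + 1 by 2, hence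
    -- the slack.
    module Th = Thirds (ℤ/ 2) 1+1≈0[2] δ M (λ k p → δ-big k (ℕₚ.≤-trans (ℕₚ.m≤n+m (suc (n ℕ.* 3)) 2) p))
      (λ m → ≡⇒≡mod (mono-1-mod-3 m j)) (λ m → ≡⇒≡mod (mono-2-mod-3 m j))
    open Terms (ℤ/ 2) Th.ε M

    G-coeff : ∀ r → M₆.G₆ r (j ℕ.* 3) Z₂.≈ G-term r
    G-coeff r = begin
      M₆.G₆ r (j ℕ.* 3)
        ≡⟨ ≡.cong₂ ℤ._+_ (∑-coeff 2 K 2 (suc K) _ (j ℕ.* 3)) (∑-coeff 2 K 2 (suc K) _ (j ℕ.* 3)) ⟩
      (Σ₂.∑ (suc K) (λ t → δ (x t))) ℤ.+ (Σ₂.∑ (suc K) (λ t → δ (y t)))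
        ≈⟨ Z₂.+-cong
             (Σ₂.∑-extend {M ℕ.* 3} {suc K} _ (ℕₚ.m≤n+m (suc K) 2) (λ t p → δ-big (x t) (ℕₚ.≤-trans p (ℕₚ.≤-trans (ℕₚ.m≤m*n t (1 ℕ.+ 6 ℕ.* r)) (ℕₚ.m≤n+m _ (1 ℕ.+ 6 ℕ.* (ω r ℕ.+ r)))))))
             (Σ₂.∑-extend {M ℕ.* 3} {suc K} _ (ℕₚ.m≤n+m (suc K) 2) (λ t p → δ-big (y t) (ℕₚ.≤-trans p (ℕₚ.≤-trans (ℕₚ.m≤m*n t (5 ℕ.+ 6 ℕ.* r)) (ℕₚ.m≤n+m _ (1 ℕ.+ 6 ℕ.* (ω r ℕ.+ r) ℕ.+ (5 ℕ.+ 6 ℕ.* r))))))) ⟨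
      (Σ₂.∑ (M ℕ.* 3) (λ t → δ (x t))) ℤ.+ (Σ₂.∑ (M ℕ.* 3) (λ t → δ (y t)))
        ≈⟨ Th.G-thirds r ⟩
      G-term r ∎
      where
      open Relation.Binary.Reasoning.Setoid Z₂.setoid
      x y : ℕ → ℕ
      x t = 1 ℕ.+ 6 ℕ.* (ω r ℕ.+ r) ℕ.+ t ℕ.* (1 ℕ.+ 6 ℕ.* r)
      y t = 1 ℕ.+ 6 ℕ.* (ω r ℕ.+ r) ℕ.+ (5 ℕ.+ 6 ℕ.* r) ℕ.+ t ℕ.* (5 ℕ.+ 6 ℕ.* r)

    -- The coefficient of q^j in q^m is that of q^(3j) in q^(3m), so `W`, built at precision n, can
    -- be read inside the count at 3j.
    W-coeff : ∀ r → Terms.W-term S₄.series mono M r j Z₂.≈ W-term r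
    W-coeff r = Z₂.+-cong (Z₂.+-cong (Z₂.+-cong
        (Z₂.trans (≡⇒≡mod (∑-coeff 4 n 2 r _ j)) (Σ₂.∑-cong′ r (λ _ → ≡⇒≡mod (≡.cong₂ ℤ._+_ (ε≡ (ω r ℕ.+ ω r)) (ε≡ (ω′ r ℕ.+ ω′ r))))))
        (≡⇒≡mod (ε≡ (ω′ r ℕ.+ ω′ r)))) (≡⇒≡mod (ε≡ (ω r ℕ.+ ω′ r))))
      (Z₂.trans (≡⇒≡mod (∑-coeff 4 n 2 r _ j)) (Σ₂.∑-cong′ r (λ q → ≡⇒≡mod
        (≡.cong₂ ℤ._+_ (≡.cong₂ ℤ._+_ (≡.cong₂ ℤ._+_ (ε≡ (ω q ℕ.+ ω r)) (ε≡ (ω′ q ℕ.+ ω r))) (ε≡ (ω q ℕ.+ ω′ r))) (ε≡ (ω′ q ℕ.+ ω′ r))))))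
      where
      ε≡ : ∀ m → mono m j ≡ Th.ε m
      ε≡ m = ≡.sym (mono-scale m j)

    U-G≈W-coeff : U (RingKit.∑ S₆.series (suc K) M₆.G₆) j Z₂.≈ M₄.W j
    U-G≈W-coeff = begin
      U (RingKit.∑ S₆.series (suc K) M₆.G₆) j
        ≡⟨ ∑-coeff 2 K 2 (suc K) M₆.G₆ (j ℕ.* 3) ⟩
      Σ₂.∑ (suc K) (λ r → M₆.G₆ r (j ℕ.* 3))
        ≈⟨ Σ₂.∑-cong′ (suc K) G-coeff ⟩
      Σ₂.∑ (suc K) G-term
        ≈⟨ Σ₂.∑-extend {suc K} {M} _ (s≤s (ℕₚ.m≤m*n n 3)) Th.G-term-big ⟩
      Σ₂.∑ M G-term
        ≈⟨ Th.W≈G ⟨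
      Σ₂.∑ M W-term
        ≈⟨ Σ₂.∑-cong′ M W-coeff ⟨
      Σ₂.∑ M (λ r → Terms.W-term S₄.series mono M r j)
        ≡⟨ ∑-coeff 4 n 2 M _ j ⟨
      M₄.W j ∎
      where open Relation.Binary.Reasoning.Setoid Z₂.setoid

  U-F≈W : P₂.prod M ⊛ U M₆.F S₂.≃ M₄.W
  U-F≈W = begin
    -- `U-prod` needs equally many factors on both sides; those beyond the first `M` are then
    -- dropped, being 1 at precision n.
    P₂.prod M ⊛ U M₆.F           ≈⟨ R₂.*-congʳ {U M₆.F} (reduce prods) ⟨
    P₂.prod (suc K) ⊛ U M₆.F     ≈⟨ U-prod (suc K) M₆.F ⟨
    U (P₆.prod (suc K) ⊛ M₆.F)   ≈⟨ U-cong M₆.prod-F ⟩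
    U (RingKit.∑ S₆.series (suc K) M₆.G₆)  ≈⟨ S₂.coeffs U-G≈W-coeff ⟩
    M₄.W                         ∎
    where
    open Relation.Binary.Reasoning.Setoid R₂.setoid
    prods : P₂.prod (suc K) S₄.≃ P₂.prod M
    prods = R₄.trans (R₄.reflexive (≡.cong (λ k → P₂.prod (suc k)) (≡.sym (ℕₚ.m+[n∸m]≡n (ℕₚ.m≤m*n n 3))))) (P₂.prod-stable (K ∸ n))

  P₁² : Series
  P₁² = M₄.P₁.prod M ⊛ M₄.P₁.prod M

  T : Series
  T = M₄.T M

  -- The doubled identity modulo 4 is halved on each integer coefficient.
  P₁²T≈W : P₁² ⊛ T S₂.≃ M₄.W
  P₁²T≈W = S₂.coeffs λ j j≤n → halve _ _ (S₄.coeff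
    (R₄.trans (R₄.sym (double (P₁² ⊛ T))) (R₄.trans M₄.two-W (double M₄.W))) j j≤n)
    where
    module S = RingKit S₄.series
    double : ∀ f → (one ⊕ one) ⊛ f S₄.≃ f ⊕ f
    double f = S.solve 1 (λ f → (S.:1 S.:+ S.:1) S.:* f S.:= f S.:+ f) R₄.refl f

  P₂≈P₁² : P₂.prod M S₂.≃ P₁²
  P₂≈P₁² = R₂.trans (reduce M₄.prod-W) (R₂.trans (R₂.+-congˡ {P₁²}
    (R₂.trans (R₂.*-congʳ {M₄.W} (series-1+1≈0 n)) (R₂.zeroˡ M₄.W))) (R₂.+-identityʳ P₁²))

  -- Modulo 2 both series have the same product with the unit (q²;q²)_∞, which is cancelled by its
  -- inverse `P₂.a M`.
  U-F≈T : U M₆.F S₂.≃ T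
  U-F≈T = begin
    U M₆.F                            ≈⟨ unit (U M₆.F) ⟨
    P₂.a M ⊛ (P₂.prod M ⊛ U M₆.F)     ≈⟨ R₂.*-congˡ {P₂.a M} (R₂.trans U-F≈W (R₂.sym (R₂.trans (R₂.*-congʳ {T} P₂≈P₁²) P₁²T≈W))) ⟩
    P₂.a M ⊛ (P₂.prod M ⊛ T)          ≈⟨ unit T ⟩
    T                                 ∎
    where
    open Relation.Binary.Reasoning.Setoid R₂.setoid
    unit : ∀ f → P₂.a M ⊛ (P₂.prod M ⊛ f) S₂.≃ f
    unit f = R₂.trans (R₂.sym (R₂.*-assoc (P₂.a M) (P₂.prod M) f))
      (R₂.trans (R₂.*-congʳ {f} (R₂.trans (R₂.*-comm (P₂.a M) (P₂.prod M)) (reduce (P₂.prod-a M)))) (R₂.*-identityˡ f))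

  -- The coefficient counts factorisations of n into two ordered factors; exchanging the factors
  -- leaves, modulo 2, only the square ones.
  T-coeff : T n Z₂.≈ Σ₂.∑ M (λ i → mono (suc i ℕ.* suc i) n)
  T-coeff = begin
    T n
      ≡⟨ ∑-coeff 4 n 2 M _ n ⟩
    Σ₂.∑ M (λ i → RingKit.∑ S₄.series M (λ t → mono (suc t ℕ.* suc i)) n)
      ≈⟨ Σ₂.∑-cong′ M (λ i → ≡⇒≡mod (∑-coeff 4 n 2 M _ n)) ⟩
    Σ₂.∑ M (λ i → Σ₂.∑ M (λ t → mono (suc t ℕ.* suc i) n))
      ≈⟨ Σ₂.Char2.∑-symmetric 1+1≈0[2] M _ (λ i t _ _ → ≡⇒≡mod (≡.cong (λ k → mono k n) (ℕₚ.*-comm (suc t) (suc i)))) ⟩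
    Σ₂.∑ M (λ i → mono (suc i ℕ.* suc i) n) ∎
    where open Relation.Binary.Reasoning.Setoid Z₂.setoid

-- Identification of F with the sum defining ξ

poch-0 : ∀ a d n → poch (suc a) d n 0 ≡ + 1
poch-0 a d zero = ≡.refl
poch-0 a d (suc n) rewrite poch-0 a d n = ≡.refl

shift-vanish : ∀ k f j → j < k → shift k f j ≡ + 0
shift-vanish k f j p rewrite ≤ᵇ-false p = ≡.refl

-- The summation index is L + 1, and `∸` does not truncate because 6(L+1)² ≥ 6(L+1).
xi-exponent : ∀ L → 6 ℕ.* suc L ℕ.* suc L ∸ 6 ℕ.* suc L ℕ.+ 1 ≡ 1 ℕ.+ 6 ℕ.* (L ℕ.* L ℕ.+ L)
xi-exponent L = ≡.trans (≡.cong (ℕ._+ 1) (≡.trans (≡.cong (_∸ 6 ℕ.* suc L) (e L)) (ℕₚ.m+n∸n≡m (6 ℕ.* (L ℕ.* L ℕ.+ L)) (6 ℕ.* suc L))))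
  (ℕₚ.+-comm (6 ℕ.* (L ℕ.* L ℕ.+ L)) 1)
  where
  e : ∀ L → 6 ℕ.* suc L ℕ.* suc L ≡ 6 ℕ.* (L ℕ.* L ℕ.+ L) ℕ.+ 6 ℕ.* suc L
  e = solve-∀

module XiSide (n : ℕ) where
  open Dissection n
  open M₆.U₆ using (B; gx; gy)
  open QSeries S₆.series mono S₆.mono-0 S₆.mono-+ K S₆.mono-big using (geom-inverse)
  open Relation.Binary.Reasoning.Setoid R₆.setoid
  private module S = RingKit S₆.series

  pochs : ℕ → Series
  pochs L = poch 1 6 L ⊛ poch 5 6 L

  gx-inverse : ∀ r → (one ⊖ mono (1 ℕ.+ 6 ℕ.* r)) ⊛ gx r S₆.≃ one
  gx-inverse r = geom-inverse (1 ℕ.+ 6 ℕ.* r) (s≤s z≤n)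

  gy-inverse : ∀ r → (one ⊖ mono (5 ℕ.+ 6 ℕ.* r)) ⊛ gy r S₆.≃ one
  gy-inverse r = geom-inverse (5 ℕ.+ 6 ℕ.* r) (s≤s z≤n)

  regroup : ∀ p p′ u v b g h → (((p ⊛ u) ⊛ (p′ ⊛ v)) ⊛ (b ⊛ (g ⊛ h))) S₆.≃ (((p ⊛ p′) ⊛ b) ⊛ ((u ⊛ g) ⊛ (v ⊛ h)))
  regroup = S.solve 7 (λ p p′ u v b g h → ((p S.:* u) S.:* (p′ S.:* v)) S.:* (b S.:* (g S.:* h))
    S.:= ((p S.:* p′) S.:* b) S.:* ((u S.:* g) S.:* (v S.:* h))) R₆.refl

  pochs-step : ∀ L b → pochs L ⊛ b S₆.≃ one → pochs (suc L) ⊛ (b ⊛ (gx L ⊛ gy L)) S₆.≃ one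
  pochs-step L b p = R₆.trans
    (regroup (poch 1 6 L) (poch 5 6 L) (one ⊖ mono (1 ℕ.+ 6 ℕ.* L)) (one ⊖ mono (5 ℕ.+ 6 ℕ.* L)) b (gx L) (gy L))
    (R₆.trans (R₆.*-cong p (R₆.*-cong (gx-inverse L) (gy-inverse L)))
      (R₆.trans (R₆.*-identityˡ _) (R₆.*-identityˡ one)))

  pochs-B : ∀ L → pochs (suc L) ⊛ B L S₆.≃ one
  pochs-B zero = R₆.trans (R₆.*-congˡ {pochs 1} (R₆.sym (R₆.*-identityˡ (B 0))))
    (pochs-step 0 one (R₆.trans (R₆.*-identityʳ (pochs 0)) (R₆.*-identityˡ one)))
  pochs-B (suc L) = pochs-step (suc L) (B L) (pochs-B L)

  -- Inverses are unique, and `B L` is the product of the inverses of all the factors.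
  inv-pochs : ∀ L → inv (pochs (suc L)) S₆.≃ B L
  inv-pochs L = begin
    g                ≈⟨ R₆.*-identityʳ g ⟨
    g ⊛ one          ≈⟨ R₆.*-congˡ {g} (pochs-B L) ⟨
    g ⊛ (f ⊛ B L)    ≈⟨ S.solve 3 (λ g f b → g S.:* (f S.:* b) S.:= (f S.:* g) S.:* b) R₆.refl g f (B L) ⟩
    (f ⊛ g) ⊛ B L    ≈⟨ R₆.*-congʳ {B L} (S₆.inv-≈ f f0) ⟩
    one ⊛ B L        ≈⟨ R₆.*-identityˡ (B L) ⟩
    B L              ∎
    where
    f = pochs (suc L)
    g = inv f
    f0 : f 0 ≡ + 1
    f0 rewrite poch-0 0 6 (suc L) | poch-0 4 6 (suc L) = ≡.refl

  xiTerm-B : ∀ L → mono 1 ⊛ (P₆.E (L ℕ.* L ℕ.+ L) ⊛ B L) S₆.≃ xiTerm (suc L)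
  xiTerm-B L = begin
    mono 1 ⊛ (mono k ⊛ B L)        ≈⟨ R₆.*-assoc (mono 1) (mono k) (B L) ⟨
    (mono 1 ⊛ mono k) ⊛ B L        ≈⟨ R₆.*-cong (R₆.sym (S₆.mono-+ 1 k)) (R₆.sym (inv-pochs L)) ⟩
    mono (1 ℕ.+ k) ⊛ g             ≈⟨ S₆.shift-≈ (1 ℕ.+ k) g ⟨
    shift (1 ℕ.+ k) g              ≡⟨ ≡.cong (λ k → shift k g) (xi-exponent L) ⟨
    xiTerm (suc L)                 ∎
    where
    k = 6 ℕ.* (L ℕ.* L ℕ.+ L)
    g = inv (pochs (suc L))

  xi-sum : ℤ
  xi-sum = sumTo K (λ i → xiTerm (suc i) K)

  F-coeff : M₆.F K Z₂.≈ xi-sum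
  F-coeff = Z₂.trans
    (Z₂.trans (≡⇒≡mod (∑-coeff 2 K 2 (suc K) _ K)) (Σ₂.∑-cong′ (suc K) (λ L → S₆.coeff (xiTerm-B L) K ℕₚ.≤-refl)))
    (≡⇒≡mod (≡.trans (≡.sym (sumTo-∑ 2 (suc K) _)) (≡.trans (≡.cong (λ x → xi-sum ℤ.+ x) last) (ℤₚ.+-identityʳ xi-sum))))
    where
    -- F has one summand more than the sum in `pξ`; its order 6(K² + K) + 1 exceeds K.
    last : xiTerm (suc K) K ≡ + 0
    last = shift-vanish _ (inv (pochs (suc K))) K (≡.subst (K <_) (≡.sym (xi-exponent K))
      (s≤s (ℕₚ.≤-trans (ℕₚ.m≤n+m K (K ℕ.* K)) (ℕₚ.m≤n*m (K ℕ.* K ℕ.+ K) 6))))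

  xi-mod2 : xi-sum Z₂.≈ Σ₂.∑ (suc n) (λ i → mono (suc i ℕ.* suc i) n)
  xi-mod2 = Z₂.trans (Z₂.sym F-coeff) (Z₂.trans (S₂.coeff U-F≈T n ℕₚ.≤-refl) T-coeff)

-- From parity to the remainder modulo 4

double-mod4 : ∀ {x y} → x ≡ y [mod 2 ] → + 2 ℤ.* x ≡ + 2 ℤ.* y [mod 4 ]
double-mod4 {x} {y} (congruent (divides q p)) = congruent (divides q (≡.trans (e₁ x y) (≡.trans (≡.cong (+ 2 ℤ.*_) p) (e₂ q))))
  where
  open ℤ-Solver.+-*-Solver
  e₁ : ∀ x y → + 2 ℤ.* x ℤ.- + 2 ℤ.* y ≡ + 2 ℤ.* (x ℤ.- y)
  e₁ = solve 2 (λ x y → con (+ 2) :* x :- con (+ 2) :* y := con (+ 2) :* (x :- y)) ≡.refl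
  e₂ : ∀ q → + 2 ℤ.* (q ℤ.* + 2) ≡ q ℤ.* + 4
  e₂ = solve 1 (λ q → con (+ 2) :* (q :* con (+ 2)) := q :* con (+ 4)) ≡.refl

-- Two numbers below 4 differ by less than 4 in absolute value, so a difference divisible by 4 is 0.
%4-unique : ∀ x c → c < 4 → x ≡ + c [mod 4 ] → x %ℕ 4 ≡ c
%4-unique x c c<4 (congruent p) = ℤₚ.+-injective (ℤₚ.i-j≡0⇒i≡j (+ r) (+ c) (small (+ r ℤ.- + c) bound 4∣r-c))
  where
  open ℤ-Solver.+-*-Solver
  r = x %ℕ 4
  e : ∀ r c q → r ℤ.- c ≡ (r ℤ.+ q ℤ.* + 4) ℤ.- c ℤ.+ (ℤ.- q) ℤ.* + 4
  e = solve 3 (λ r c q → r :- c := (r :+ q :* con (+ 4)) :- c :+ (:- q) :* con (+ 4)) ≡.refl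
  4∣r-c : + 4 ℤ∣.∣ + r ℤ.- + c
  4∣r-c = ≡.subst (+ 4 ℤ∣.∣_) (≡.sym (≡.trans (e (+ r) (+ c) (x /ℕ 4))
      (≡.cong (λ y → y ℤ.- + c ℤ.+ (ℤ.- (x /ℕ 4)) ℤ.* + 4) (≡.sym (a≡a%ℕn+[a/ℕn]*n x 4)))))
    (ℤ∣.∣m∣n⇒∣m+n p (divides (ℤ.- (x /ℕ 4)) ≡.refl))
  bound : ℤ.∣ + r ℤ.- + c ∣ < 4
  bound = ≡.subst (λ y → ℤ.∣ y ∣ < 4) (≡.sym (ℤₚ.m-n≡m⊖n r c))
    (ℕₚ.≤-<-trans (ℤₚ.∣m⊝n∣≤m⊔n r c) (ℕₚ.⊔-pres-<m (n%ℕd<d x 4) c<4))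
  small : ∀ z → ℤ.∣ z ∣ < 4 → + 4 ℤ∣.∣ z → z ≡ + 0
  small z b d with ℤ.∣ z ∣ in eq
  ... | zero = ℤₚ.∣i∣≡0⇒i≡0 eq
  ... | suc k = contradiction (≡.subst (4 ℕ∣.∣_) eq (ℤ∣.∣⇒∣ᵤ d)) (>⇒∤ b)

square-injective : ∀ i k → i ℕ.* i ≡ k ℕ.* k → i ≡ k
square-injective i k p with ℕₚ.<-cmp i k
... | tri< i<k _ _ = contradiction p (ℕₚ.<⇒≢ (ℕₚ.*-mono-< i<k i<k))
... | tri≈ _ i≡k _ = i≡k
... | tri> _ _ k<i = contradiction (≡.sym p) (ℕₚ.<⇒≢ (ℕₚ.*-mono-< k<i k<i))

pξ-%4 : ∀ m (c : ℕ) → c < 2 →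
  RingKit.∑ (ℤ/ 2) (suc (suc m)) (λ i → mono (suc i ℕ.* suc i) (suc m)) ≡ + c [mod 2 ] →
  pξ (3 ℕ.* suc m) %ℕ 4 ≡ 2 ℕ.* c
pξ-%4 m c c<2 p = ≡.trans (≡.cong (λ k → pξ k %ℕ 4) (ℕₚ.*-comm 3 (suc m)))
  (%4-unique (pξ (suc m ℕ.* 3)) (2 ℕ.* c) (ℕₚ.*-monoʳ-< 2 c<2) (≡.subst₂ (_≡_[mod 4 ])
    -- For a positive argument `one` contributes 0, so the coefficient is exactly twice `xi-sum`.
    (≡.sym (ℤₚ.+-identityˡ (+ 2 ℤ.* XiSide.xi-sum (suc m)))) (≡.sym (ℤₚ.pos-* 2 c))
    (double-mod4 (CommutativeRing.trans (ℤ/ 2) (XiSide.xi-mod2 (suc m)) p))))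

open import Data.Nat using (_*_)

theorem4p1 : (n : ℕ) →
    (n ≡ 0 → pξ (3 * n) %ℕ 4 ≡ 1)
    × (n ≢ 0 → ∃[ k ] n ≡ k * k → pξ (3 * n) %ℕ 4 ≡ 2)
    × (n ≢ 0 → ¬ (∃[ k ] n ≡ k * k) → pξ (3 * n) %ℕ 4 ≡ 0)
-- The coefficient `pξ 0` is evaluated outright: its sum is empty and the constant term is 1.
theorem4p1 zero = (λ _ → ≡.refl) , (λ p → contradiction ≡.refl p) , (λ p → contradiction ≡.refl p)
theorem4p1 (suc m) = (λ ()) , square , nonsquare
  where
  open RingKit (ℤ/ 2) using (∑-single; ∑-0)
  open CommutativeRing (ℤ/ 2) using (trans)

  square : suc m ≢ 0 → ∃[ k ] suc m ≡ k * k → pξ (3 * suc m) %ℕ 4 ≡ 2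
  -- The root of a positive square is positive. Writing it as `suc k` makes k the index of the only
  -- nonzero summand.
  square _ (suc k , eq) = pξ-%4 m 1 (ℕₚ.n<1+n 1)
    (trans (∑-single (suc (suc m)) _ k
        (ℕₚ.≤-trans (ℕₚ.m≤m*n (suc k) (suc k)) (ℕₚ.≤-trans (ℕₚ.≤-reflexive (≡.sym eq)) (ℕₚ.n≤1+n _)))
        (λ i i≢k → ≡⇒≡mod (mono-off (suc i * suc i) (suc m)
          (λ p → i≢k (ℕₚ.suc-injective (square-injective (suc i) (suc k) (≡.trans p eq)))))))
      (≡⇒≡mod (≡.trans (≡.cong (mono (suc k * suc k)) eq) (mono-diag (suc k * suc k)))))

  nonsquare : suc m ≢ 0 → ¬ (∃[ k ] suc m ≡ k * k) → pξ (3 * suc m) %ℕ 4 ≡ 0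
  nonsquare _ ns = pξ-%4 m 0 (s≤s z≤n)
    (∑-0 (suc (suc m)) (λ i _ → ≡⇒≡mod (mono-off (suc i * suc i) (suc m) (λ p → ns (suc i , ≡.sym p)))))
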